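{- Let $k \ge 3$, let $r_1 \geq r_2 \geq \cdots \geq r_k\ge 1$ be integers, and let $n = \sum_{i=1}^{k} r_i$. Then $A_{\text{no3l}}(r_1, r_2, \ldots, r_k) \leq n - \max(2, r_k+1)$.
   Context: $A_{\text{no3l}}(r_1,r_2,\dots,r_k)$ denotes the minimum, over all choices of pairwise disjoint sets $\mathcal P_1,\dots,\mathcal P_k\subset\mathbb{R}^2$ with $|\mathcal P_i| = r_i$ and such that no three of the $n$ points lie on a line, of the number of distinct values in $(0,\pi)$ of angles $\angle xyz$ whose three points $x,y,z$ lie in three distinct sets among $\mathcal P_1,\dots,\mathcal P_k$. -}

module Defs where

open import Data.Fin.Base using (Fin)
open import Data.Integer.Base as ℤ using (-1ℤ)
open import Data.Nat.Base as ℕ using (ℕ; zero; suc; _!)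
import Data.Nat.Properties as ℕ
open import Data.Product using (Σ; ∃; ∃-syntax; _×_; _,_; proj₁; proj₂)
open import Data.Rational.Base as ℚ using (ℚ; 0ℚ; 1ℚ; ½; ∣_∣)
import Data.Rational.Properties as ℚ
open import Data.Rational.Solver using (module +-*-Solver)
open import Function.Base using (_∘_)
open import Function.Definitions using (Injective)
open import Relation.Binary.PropositionalEquality
  using (_≡_; _≢_; refl; sym; trans; cong; cong₂; subst)
open import Relation.Nullary.Negation using (¬_)

------------------------------------------------------------------------
-- Real numbers: Cauchy sequences of rationals, compared up to _≃_.

IsCauchy : (ℕ → ℚ) → Set
IsCauchy f = ∀ ε → 0ℚ ℚ.< ε →
  ∃[ N ] ∀ m n → N ℕ.≤ m → N ℕ.≤ n → ∣ f m ℚ.- f n ∣ ℚ.< ε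

record ℝ : Set where
  constructor mkℝ
  field
    seq    : ℕ → ℚ
    cauchy : IsCauchy seq

open ℝ public

infix 4 _≃_ _<_ _≤_

_≃_ : ℝ → ℝ → Set
x ≃ y = ∀ ε → 0ℚ ℚ.< ε →
  ∃[ N ] ∀ n → N ℕ.≤ n → ∣ seq x n ℚ.- seq y n ∣ ℚ.< ε

-- The gap ε must be uniform in n: termwise < would not be strict in the limit.
_<_ : ℝ → ℝ → Set
x < y = ∃[ ε ] (0ℚ ℚ.< ε ×
  ∃[ N ] ∀ n → N ℕ.≤ n → seq x n ℚ.+ ε ℚ.< seq y n)

_≤_ : ℝ → ℝ → Set
x ≤ y = ¬ (y < x)

private
  half-pos : ∀ {ε} → 0ℚ ℚ.< ε → 0ℚ ℚ.< ½ ℚ.* ε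
  half-pos {ε} ε>0 =
    subst (ℚ._< ½ ℚ.* ε) (ℚ.*-zeroʳ ½) (ℚ.*-monoʳ-<-pos ½ ε>0)

  halves : ∀ ε → ½ ℚ.* ε ℚ.+ ½ ℚ.* ε ≡ ε
  halves ε = trans (sym (ℚ.*-distribʳ-+ ε ½ ½)) (ℚ.*-identityˡ ε)

  triangle-< : ∀ {p q r a b ε} → r ≡ p ℚ.+ q → ∣ p ∣ ℚ.< a → ∣ q ∣ ℚ.< b →
    a ℚ.+ b ≡ ε → ∣ r ∣ ℚ.< ε
  triangle-< {p} {q} refl p<a q<b refl =
    ℚ.≤-<-trans (ℚ.∣p+q∣≤∣p∣+∣q∣ p q) (ℚ.+-mono-< p<a q<b)

  product-< : ∀ {p q B δ} → 0ℚ ℚ.< B → ∣ p ∣ ℚ.< B → ∣ q ∣ ℚ.< δ →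
    ∣ p ℚ.* q ∣ ℚ.< B ℚ.* δ
  product-< {p} {q} {B} {δ} B>0 p<B q<δ =
    subst (ℚ._< B ℚ.* δ) (sym (ℚ.∣p*q∣≡∣p∣*∣q∣ p q))
      (ℚ.≤-<-trans
        (ℚ.*-monoʳ-≤-nonNeg ∣ q ∣ {{ℚ.∣-∣-nonNeg q}} (ℚ.<⇒≤ p<B))
        (ℚ.*-monoʳ-<-pos B {{ℚ.positive B>0}} q<δ))

  -- For B > 0, the tolerance δ = ε / 2B satisfies B δ = ε / 2.
  tolerance : ∀ {B ε} → 0ℚ ℚ.< B → 0ℚ ℚ.< ε →
    ∃[ δ ] (0ℚ ℚ.< δ × B ℚ.* δ ≡ ½ ℚ.* ε)
  tolerance {B} {ε} B>0 ε>0 = ℚ.1/ B ℚ.* (½ ℚ.* ε) , δ>0 , Bδ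
    where
    instance
      B-pos : ℚ.Positive B
      B-pos = ℚ.positive B>0
      B-nonZero : ℚ.NonZero B
      B-nonZero = ℚ.pos⇒nonZero B
      1/B-pos : ℚ.Positive (ℚ.1/ B)
      1/B-pos = ℚ.1/pos⇒pos B
    δ>0 : 0ℚ ℚ.< ℚ.1/ B ℚ.* (½ ℚ.* ε)
    δ>0 = subst (ℚ._< ℚ.1/ B ℚ.* (½ ℚ.* ε)) (ℚ.*-zeroʳ (ℚ.1/ B))
            (ℚ.*-monoʳ-<-pos (ℚ.1/ B) (half-pos ε>0))
    Bδ : B ℚ.* (ℚ.1/ B ℚ.* (½ ℚ.* ε)) ≡ ½ ℚ.* ε
    Bδ = trans (sym (ℚ.*-assoc B (ℚ.1/ B) (½ ℚ.* ε)))
           (trans (cong (ℚ._* (½ ℚ.* ε)) (ℚ.*-inverseʳ B))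
                  (ℚ.*-identityˡ (½ ℚ.* ε)))

  +-regroup : ∀ a b c d → (a ℚ.+ b) ℚ.- (c ℚ.+ d) ≡ (a ℚ.- c) ℚ.+ (b ℚ.- d)
  +-regroup = solve 4
    (λ a b c d → (a :+ b) :- (c :+ d) := (a :- c) :+ (b :- d)) refl
    where open +-*-Solver

  *-regroup : ∀ a b c d →
    a ℚ.* b ℚ.- c ℚ.* d ≡ a ℚ.* (b ℚ.- d) ℚ.+ d ℚ.* (a ℚ.- c)
  *-regroup = solve 4
    (λ a b c d → a :* b :- c :* d := a :* (b :- d) :+ d :* (a :- c)) refl
    where open +-*-Solver

  neg-regroup : ∀ a b → ℚ.- (a ℚ.- b) ≡ (ℚ.- a) ℚ.- (ℚ.- b)
  neg-regroup = solve 2 (λ a b → :- (a :- b) := (:- a) :- (:- b)) refl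
    where open +-*-Solver

  split : ∀ p q → p ≡ (p ℚ.- q) ℚ.+ q
  split = solve 2 (λ p q → p := (p :- q) :+ q) refl
    where open +-*-Solver

  near-bounded : ∀ {p q a} → ∣ p ℚ.- q ∣ ℚ.< a → ∣ p ∣ ℚ.< a ℚ.+ ∣ q ∣
  near-bounded {p} {q} {a} p-q<a =
    subst (λ t → ∣ t ∣ ℚ.< a ℚ.+ ∣ q ∣) (sym (split p q))
      (ℚ.≤-<-trans (ℚ.∣p+q∣≤∣p∣+∣q∣ (p ℚ.- q) q)
                   (ℚ.+-mono-<-≤ p-q<a (ℚ.≤-refl {∣ q ∣})))

  eventually-bounded : ∀ {f} → IsCauchy f →
    ∃[ B ] (0ℚ ℚ.< B × ∃[ N ] ∀ n → N ℕ.≤ n → ∣ f n ∣ ℚ.< B)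
  eventually-bounded {f} c =
    let N , close = c 1ℚ (ℚ.positive⁻¹ 1ℚ) in
    1ℚ ℚ.+ ∣ f N ∣ ,
    ℚ.+-mono-<-≤ (ℚ.positive⁻¹ 1ℚ) (ℚ.0≤∣p∣ (f N)) ,
    N , λ n N≤n → near-bounded {f n} {f N} (close n N N≤n ℕ.≤-refl)

  ⊔-≤ˡ : ∀ {m n o} → m ℕ.⊔ n ℕ.≤ o → m ℕ.≤ o
  ⊔-≤ˡ {m} {n} = ℕ.m⊔n≤o⇒m≤o m n

  ⊔-≤ʳ : ∀ {m n o} → m ℕ.⊔ n ℕ.≤ o → n ℕ.≤ o
  ⊔-≤ʳ {m} {n} = ℕ.m⊔n≤o⇒n≤o m n

-- Abstract, so that real-number terms do not unfold into these proofs.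
abstract
  +-cauchy : ∀ {f g} → IsCauchy f → IsCauchy g → IsCauchy (λ n → f n ℚ.+ g n)
  +-cauchy {f} {g} cf cg ε ε>0 =
    let M , closeᶠ = cf (½ ℚ.* ε) (half-pos ε>0)
        N , closeᵍ = cg (½ ℚ.* ε) (half-pos ε>0)
    in M ℕ.⊔ N , λ m n m≥ n≥ →
      triangle-< (+-regroup (f m) (g m) (f n) (g n))
        (closeᶠ m n (⊔-≤ˡ m≥) (⊔-≤ˡ n≥))
        (closeᵍ m n (⊔-≤ʳ {M} m≥) (⊔-≤ʳ {M} n≥))
        (halves ε)

  neg-cauchy : ∀ {f} → IsCauchy f → IsCauchy (λ n → ℚ.- f n)
  neg-cauchy {f} cf ε ε>0 =
    let N , close = cf ε ε>0
    in N , λ m n m≥ n≥ →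
      subst (ℚ._< ε)
        (trans (sym (ℚ.∣-p∣≡∣p∣ (f m ℚ.- f n)))
               (cong ∣_∣ (neg-regroup (f m) (f n))))
        (close m n m≥ n≥)

  *-cauchy : ∀ {f g} → IsCauchy f → IsCauchy g → IsCauchy (λ n → f n ℚ.* g n)
  *-cauchy {f} {g} cf cg ε ε>0 =
    let A , A>0 , Nᴬ , f<A = eventually-bounded cf
        B , B>0 , Nᴮ , g<B = eventually-bounded cg
        δᴬ , δᴬ>0 , Aδ     = tolerance {A} {ε} A>0 ε>0
        δᴮ , δᴮ>0 , Bδ     = tolerance {B} {ε} B>0 ε>0
        Nᶠ , closeᶠ        = cf δᴮ δᴮ>0
        Nᵍ , closeᵍ        = cg δᴬ δᴬ>0
        M                  = Nᴬ ℕ.⊔ Nᴮ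
        N                  = Nᶠ ℕ.⊔ Nᵍ
    in M ℕ.⊔ N , λ m n m≥ n≥ →
      triangle-< (*-regroup (f m) (g m) (f n) (g n))
        (product-< {f m} {g m ℚ.- g n} A>0 (f<A m (⊔-≤ˡ (⊔-≤ˡ {M} m≥)))
          (closeᵍ m n (⊔-≤ʳ {Nᶠ} (⊔-≤ʳ {M} m≥)) (⊔-≤ʳ {Nᶠ} (⊔-≤ʳ {M} n≥))))
        (product-< {g n} {f m ℚ.- f n} B>0 (g<B n (⊔-≤ʳ {Nᴬ} (⊔-≤ˡ {M} n≥)))
          (closeᶠ m n (⊔-≤ˡ (⊔-≤ʳ {M} m≥)) (⊔-≤ˡ (⊔-≤ʳ {M} n≥))))
        (trans (cong₂ ℚ._+_ Aδ Bδ) (halves ε))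

infixl 6 _+_ _-_
infixl 7 _*_
infixr 8 _^_
infix  8 -_

fromℚ : ℚ → ℝ
fromℚ q = mkℝ (λ _ → q) λ ε ε>0 →
  0 , λ _ _ _ _ → subst (ℚ._< ε) (sym (cong ∣_∣ (ℚ.+-inverseʳ q))) ε>0

0ℝ 1ℝ : ℝ
0ℝ = fromℚ 0ℚ
1ℝ = fromℚ 1ℚ

_+_ : ℝ → ℝ → ℝ
x + y = mkℝ (λ n → seq x n ℚ.+ seq y n)
            (+-cauchy {seq x} {seq y} (cauchy x) (cauchy y))

-_ : ℝ → ℝ
- x = mkℝ (λ n → ℚ.- seq x n) (neg-cauchy {seq x} (cauchy x))

_-_ : ℝ → ℝ → ℝ
x - y = x + - y

_*_ : ℝ → ℝ → ℝ
x * y = mkℝ (λ n → seq x n ℚ.* seq y n)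
            (*-cauchy {seq x} {seq y} (cauchy x) (cauchy y))

_^_ : ℝ → ℕ → ℝ
x ^ zero  = 1ℝ
x ^ suc n = x * x ^ n

------------------------------------------------------------------------
-- Sine, cosine and π

_⟶_ : (ℕ → ℝ) → ℝ → Set
s ⟶ l = ∀ ε → 0ℚ ℚ.< ε → ∃[ N ] ∀ n → N ℕ.≤ n →
  (s n - l < fromℚ ε) × (l - s n < fromℚ ε)

partialSum : (ℕ → ℝ) → ℕ → ℝ
partialSum t zero    = 0ℝ
partialSum t (suc n) = partialSum t n + t n

-- (-1)ʲ / m!
coefficient : ℕ → ℕ → ℚ
coefficient j m = ((-1ℤ ℤ.^ j) ℚ./ (m !)) {{m ℕ.!≢0}}

cosTerm sinTerm : ℝ → ℕ → ℝ
cosTerm x j = fromℚ (coefficient j (2 ℕ.* j)) * x ^ (2 ℕ.* j)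
sinTerm x j = fromℚ (coefficient j (suc (2 ℕ.* j))) * x ^ suc (2 ℕ.* j)

-- cos x = c and sin x = s, as sums of the power series
IsCos IsSin : ℝ → ℝ → Set
IsCos x c = partialSum (cosTerm x) ⟶ c
IsSin x s = partialSum (sinTerm x) ⟶ s

-- π is the smallest positive zero of sine.
record IsPi (p : ℝ) : Set where
  field
    positive : 0ℝ < p
    zero-sin : IsSin p 0ℝ
    smallest : ∀ t → 0ℝ < t → t < p → ∃[ s ] (IsSin t s × ¬ (s ≃ 0ℝ))

------------------------------------------------------------------------
-- The Euclidean plane

record Point : Set where
  constructor ⟨_,_⟩
  field
    xc yc : ℝ

open Point public

infix 4 _≈ₚ_

_≈ₚ_ : Point → Point → Set
p ≈ₚ q = (xc p ≃ xc q) × (yc p ≃ yc q)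

infixl 6 _-ᵥ_
infixl 7 _·_

_-ᵥ_ : Point → Point → Point
p -ᵥ q = ⟨ xc p - xc q , yc p - yc q ⟩

_·_ : Point → Point → ℝ
u · v = xc u * xc v + yc u * yc v

IsNorm : Point → ℝ → Set
IsNorm u ρ = (0ℝ ≤ ρ) × (ρ * ρ ≃ u · u)

-- The line α X + β Y = γ; a degenerate equation α = β = 0 is excluded.
record Line : Set where
  field
    α β γ         : ℝ
    nondegenerate : ¬ ((α ≃ 0ℝ) × (β ≃ 0ℝ))

_On_ : Point → Line → Set
p On ℓ = α * xc p + β * yc p ≃ γ
  where open Line ℓ

Collinear : Point → Point → Point → Set
Collinear p q r = ∃[ ℓ ] (p On ℓ × q On ℓ × r On ℓ)

-- θ ∈ (0, π) is the measure of the angle ∠xyz, with vertex y: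
-- (x - y) · (z - y) = |x - y| |z - y| cos θ.
record IsAngle (x y z : Point) (θ : ℝ) : Set where
  field
    θ>0    : 0ℝ < θ
    θ<π    : ∃[ π ] (IsPi π × θ < π)
    cosine : ∃[ ρ ] ∃[ σ ] ∃[ c ]
             ( IsNorm (x -ᵥ y) ρ × IsNorm (z -ᵥ y) σ × IsCos θ c
             × (x -ᵥ y) · (z -ᵥ y) ≃ ρ * σ * c )

------------------------------------------------------------------------
-- Coloured point sets and their rainbow angles

-- (i , j) names the j-th point of 𝒫ᵢ.
Label : ∀ {k} → (Fin k → ℕ) → Set
Label {k} r = Σ (Fin k) (Fin ∘ r)

-- Injectivity of the labelling says both that |𝒫ᵢ| = rᵢ and that the 𝒫ᵢ are
-- pairwise disjoint.
record Configuration {k} (r : Fin k → ℕ) : Set where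
  field
    point     : Label r → Point
    injective : Injective _≡_ _≈ₚ_ point
    no3l      : ∀ a b c → a ≢ b → b ≢ c → a ≢ c →
                ¬ Collinear (point a) (point b) (point c)

Rainbow : ∀ {k} {r : Fin k → ℕ} → Label r → Label r → Label r → Set
Rainbow a b c =
  (proj₁ a ≢ proj₁ b) × (proj₁ b ≢ proj₁ c) × (proj₁ a ≢ proj₁ c)

-- Exactly d values occur: they are enumerated without repetition by `value`.
record HasDistinctAngles {k} {r : Fin k → ℕ}
                         (𝒫 : Configuration r) (d : ℕ) : Set where
  open Configuration 𝒫
  field
    value      : Fin d → ℝ
    distinct   : Injective _≡_ _≃_ value
    realised   : ∀ i → ∃[ a ] ∃[ b ] ∃[ c ]
                 ( Rainbow {r = r} a b c
                 × IsAngle (point a) (point b) (point c) (value i) )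
    exhaustive : ∀ a b c → Rainbow {r = r} a b c →
                 ∃[ i ] IsAngle (point a) (point b) (point c) (value i)

Attainable : ∀ {k} → (Fin k → ℕ) → ℕ → Set
Attainable r d = Σ (Configuration r) λ 𝒫 → HasDistinctAngles 𝒫 d

IsMinimum : (ℕ → Set) → ℕ → Set
IsMinimum S a = S a × (∀ d → S d → a ℕ.≤ d)

-- a = A_no3l(r₁, …, rₖ)
IsAno3l : ∀ {k} → (Fin k → ℕ) → ℕ → Set
IsAno3l r = IsMinimum (Attainable r)

-- A_no3l(r₁, …, rₖ) ≤ b.  A nonempty set of naturals need not have a minimum
-- constructively, so a bound on every minimum could hold vacuously; the first
-- component rules that out by demanding a configuration that meets the bound.
Ano3l_≤_ : ∀ {k} → (Fin k → ℕ) → ℕ → Set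
Ano3l r ≤ b =
  (∃[ d ] (Attainable r d × d ℕ.≤ b)) × (∀ a → IsAno3l r a → a ℕ.≤ b)

module Submission where

open import Defs using (Ano3l_≤_)
open import Data.Integer.Base as ℤ using (-[1+_]; -1ℤ; 1ℤ)
import Data.Integer.Properties as ℤ
import Data.Nat.Coprimality as Coprime
open import Data.Nat.Base as ℕ using (ℕ; zero; suc; _!)
import Data.Nat.Properties as ℕ
open import Data.Product using (∃; ∃-syntax; _×_; _,_; proj₁; proj₂)
open import Data.Rational.Base as ℚ using (ℚ; mkℚ; 0ℚ; 1ℚ; ½)
import Data.Rational.Properties as ℚ
open import Data.Rational.Solver using (module +-*-Solver)
import Data.Rational.Unnormalised.Base as ℚᵘ
import Data.Rational.Unnormalised.Properties as ℚᵘ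
open import Data.Sum.Base using (_⊎_; inj₁; inj₂)
open import Function.Base using (_∘_)
open import Relation.Binary.Bundles using (Setoid)
open import Relation.Binary.Definitions using (tri<; tri≈; tri>)
open import Relation.Binary.PropositionalEquality
  using (_≡_; _≢_; refl; sym; trans; cong; cong₂; subst; subst₂; module ≡-Reasoning)
open import Relation.Nullary.Decidable using (Dec; yes; no; toWitness; map′; ¬?; _×-dec_; _⊎-dec_)
open import Relation.Nullary.Negation using (¬_; contradiction)
open +-*-Solver using (solve; con; _:=_; _:+_; _:*_; :-_; _:-_)

-- Cut the vertices of a regular n-gon into k consecutive arcs, the i-th of which
-- is 𝒫ᵢ.  By the inscribed angle theorem every angle between vertices is
-- j π/n for some 0 < j < n, where n - j counts the steps of the arc from x to z
-- through y.  If the angle is rainbow, that arc contains the whole colour class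
-- of y besides x and z, so n - j > rₖ: at most n - (rₖ + 1) values occur.
--
-- Constructively the work lies in the trigonometry.  A real is a sequence of
-- rationals, so cosine and sine are the diagonal partial sums of their series
-- along that sequence, and their addition theorems are estimates for truncated
-- Cauchy products of rationals.  π/2 is found by trisecting [1, 2] for the zero
-- of cosine, which decreases strictly there.

-- The weights of the cosine and sine series are real and imaginary parts of powers of i, at most 1
-- in absolute value. Hence tails, Lipschitz constants and errors of Cauchy products are all bounded
-- by the exponential series at a common bound of the arguments, uniformly in the truncation. The
-- uniformity is what the diagonal demands, since truncation and argument move together along it.
-- Apart from the signs of cosine at 1 and 2, the strict inequalities about cosine and sine come
-- from sin q ≥ q/3 on [0, 2]: it makes cosine decrease there, sine positive on (0, π), and distinct
-- vertices apart. The inscribed angle theorem is pure algebra once the circle is parametrised by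
-- half the central angle: the direction of a chord then depends on the sum of its two parameters,
-- and a common end cancels. `HasDistinctAngles` asks for the exact number of values, while the arc
-- argument only confines the indices to a range; a finite search selects those that occur.

-- Rational estimates: null sequences, geometric decay, finite sums.

module Rationals where
  open import Data.Rational.Base
  open import Data.Rational.Properties

  ≤-by : ∀ {p q} d → 0ℚ ≤ d → q ≡ p + d → p ≤ q
  ≤-by {p} d d≥0 refl = subst (_≤ p + d) (+-identityʳ p) (+-monoʳ-≤ p d≥0)

  <-by : ∀ {p q} d → 0ℚ < d → q ≡ p + d → p < q
  <-by {p} d d>0 refl = subst (_< p + d) (+-identityʳ p) (+-monoʳ-< p d>0)

  ≤⇒0≤- : ∀ {p q} → p ≤ q → 0ℚ ≤ q - p
  ≤⇒0≤- {p} {q} p≤q = subst (_≤ q - p) (+-inverseʳ p) (+-monoˡ-≤ (- p) p≤q)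

  <⇒0<- : ∀ {p q} → p < q → 0ℚ < q - p
  <⇒0<- {p} {q} p<q = subst (_< q - p) (+-inverseʳ p) (+-monoˡ-< (- p) p<q)

  0≤+ : ∀ {p q} → 0ℚ ≤ p → 0ℚ ≤ q → 0ℚ ≤ p + q
  0≤+ = +-mono-≤

  0<* : ∀ {p q} → 0ℚ < p → 0ℚ < q → 0ℚ < p * q
  0<* {p} {q} p>0 q>0 = subst (_< p * q) (*-zeroʳ p) (*-monoʳ-<-pos p {{positive p>0}} q>0)

  *-monoˡ : ∀ {p q} r → 0ℚ ≤ r → p ≤ q → r * p ≤ r * q
  *-monoˡ r r≥0 = *-monoˡ-≤-nonNeg r {{nonNegative r≥0}}

  *-monoʳ : ∀ {p q} r → 0ℚ ≤ r → p ≤ q → p * r ≤ q * r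
  *-monoʳ r r≥0 = *-monoʳ-≤-nonNeg r {{nonNegative r≥0}}

  0≤* : ∀ {p q} → 0ℚ ≤ p → 0ℚ ≤ q → 0ℚ ≤ p * q
  0≤* {p} {q} p≥0 q≥0 = subst (_≤ p * q) (*-zeroʳ p) (*-monoˡ p p≥0 q≥0)

  *-mono : ∀ {p q r s} → 0ℚ ≤ r → 0ℚ ≤ q → p ≤ q → r ≤ s → p * r ≤ q * s
  *-mono {p} {q} {r} {s} r≥0 q≥0 p≤q r≤s = ≤-trans (*-monoʳ r r≥0 p≤q) (*-monoˡ q q≥0 r≤s)

  p≤∣p∣ : ∀ p → p ≤ ∣ p ∣
  p≤∣p∣ p with ≤-total 0ℚ p
  ... | inj₁ p≥0 = ≤-reflexive (sym (0≤p⇒∣p∣≡p p≥0))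
  ... | inj₂ p≤0 = ≤-trans p≤0 (0≤∣p∣ p)

  -p≤∣p∣ : ∀ p → - p ≤ ∣ p ∣
  -p≤∣p∣ p = subst (- p ≤_) (∣-p∣≡∣p∣ p) (p≤∣p∣ (- p))

  ∣∣≤ : ∀ {p b} → p ≤ b → - p ≤ b → ∣ p ∣ ≤ b
  ∣∣≤ {p} {b} p≤b -p≤b with ∣p∣≡p∨∣p∣≡-p p
  ... | inj₁ e = subst (_≤ b) (sym e) p≤b
  ... | inj₂ e = subst (_≤ b) (sym e) -p≤b

  ∣p-q∣≡∣q-p∣ : ∀ p q → ∣ p - q ∣ ≡ ∣ q - p ∣
  ∣p-q∣≡∣q-p∣ p q = trans (cong ∣_∣ (solve 2 (λ p q → p :- q := :- (q :- p)) refl p q)) (∣-p∣≡∣p∣ (q - p))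

  ∣-∣-triangle : ∀ p q r → ∣ p - r ∣ ≤ ∣ p - q ∣ + ∣ q - r ∣
  ∣-∣-triangle p q r = subst (λ t → ∣ t ∣ ≤ ∣ p - q ∣ + ∣ q - r ∣)
    (solve 3 (λ p q r → (p :- q) :+ (q :- r) := p :- r) refl p q r)
    (∣p+q∣≤∣p∣+∣q∣ (p - q) (q - r))

  ½ε>0 : ∀ {ε} → 0ℚ < ε → 0ℚ < ½ * ε
  ½ε>0 = 0<* (positive⁻¹ ½)

  ½+½ : ∀ ε → ½ * ε + ½ * ε ≡ ε
  ½+½ ε = trans (sym (*-distribʳ-+ ε ½ ½)) (*-identityˡ ε)

  ½ε<ε : ∀ {ε} → 0ℚ < ε → ½ * ε < ε
  ½ε<ε {ε} ε>0 = <-by (½ * ε) (½ε>0 ε>0) (sym (½+½ ε))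

  2ℚ 3ℚ ⅔ ⅓ : ℚ
  2ℚ = ℤ.+ 2 / 1
  3ℚ = ℤ.+ 3 / 1
  ⅔  = ℤ.+ 2 / 3
  ⅓  = ℤ.+ 1 / 3

  -- Opaque, so that products with natℚ n and rec n do not unfold to normalised fractions.
  opaque
    natℚ : ℕ → ℚ
    natℚ n = mkℚ (ℤ.+ n) 0 (Coprime.sym (Coprime.1-coprimeTo n))

    rec : ℕ → ℚ
    rec m = 1/ natℚ (suc m)

    natℚ-0 : natℚ 0 ≡ 0ℚ
    natℚ-0 = refl

    natℚ-1 : natℚ 1 ≡ 1ℚ
    natℚ-1 = refl

    natℚ-2 : natℚ 2 ≡ 2ℚ
    natℚ-2 = refl

    natℚ-3 : natℚ 3 ≡ 3ℚ
    natℚ-3 = refl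

    natℚ-suc : ∀ n → natℚ (suc n) ≡ 1ℚ + natℚ n
    natℚ-suc n = toℚᵘ-injective (ℚᵘ.≃-sym (ℚᵘ.≃-trans (toℚᵘ-homo-+ 1ℚ (natℚ n))
      (ℚᵘ.*≡* (trans (ℤ.*-identityʳ _) (trans (cong (λ t → ℤ.+ 1 ℤ.+ t) (ℤ.*-identityʳ (ℤ.+ n))) (sym (ℤ.*-identityʳ (ℤ.+ suc n))))))))

    natℚ-* : ∀ m n → natℚ (m ℕ.* n) ≡ natℚ m * natℚ n
    natℚ-* m n = toℚᵘ-injective (ℚᵘ.≃-sym (ℚᵘ.≃-trans (toℚᵘ-homo-* (natℚ m) (natℚ n))
      (ℚᵘ.*≡* (cong (ℤ._* ℤ.+ 1) (sym (ℤ.pos-* m n))))))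

    natℚ-≥0 : ∀ n → 0ℚ ≤ natℚ n
    natℚ-≥0 n = nonNegative⁻¹ (natℚ n)

    natℚ->0 : ∀ n → 0ℚ < natℚ (suc n)
    natℚ->0 n = positive⁻¹ (natℚ (suc n))

    natℚ-mono : ∀ {m n} → m ℕ.≤ n → natℚ m ≤ natℚ n
    natℚ-mono m≤n = *≤* (ℤ.*-monoʳ-≤-nonNeg (ℤ.+ 1) (ℤ.+≤+ m≤n))

    archimedean : ∀ q → ∃[ n ] q < natℚ n
    archimedean (mkℚ (ℤ.+ a) d c) = suc a , *<* (subst₂ ℤ._<_
        (sym (ℤ.*-identityʳ (ℤ.+ a))) (ℤ.pos-* (suc a) (suc d))
        (ℤ.+<+ (ℕ.m≤m*n (suc a) (suc d))))
    archimedean (mkℚ -[1+ a ] d c) = 1 , *<* ℤ.-<+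

    rec-0 : rec 0 ≡ 1ℚ
    rec-0 = refl

    rec-1 : rec 1 ≡ ½
    rec-1 = refl

    rec-2 : rec 2 ≡ ⅓
    rec-2 = refl

    rec-3 : rec 3 ≡ ℤ.+ 1 / 4
    rec-3 = refl

    rec->0 : ∀ m → 0ℚ < rec m
    rec->0 m = positive⁻¹ (rec m)

    rec-inverse : ∀ m → natℚ (suc m) * rec m ≡ 1ℚ
    rec-inverse m = *-inverseʳ (natℚ (suc m))

    /-*-cancel : ∀ i n → .{{_ : ℕ.NonZero n}} → (i / n) * natℚ n ≡ i / 1
    /-*-cancel i (suc n) = toℚᵘ-injective (ℚᵘ.≃-trans (toℚᵘ-homo-* (i / suc n) (natℚ (suc n)))
      (ℚᵘ.≃-trans (ℚᵘ.*-congʳ (toℚᵘ-fromℚᵘ (ℚᵘ.mkℚᵘ i n)))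
      (ℚᵘ.≃-trans (ℚᵘ.*≡* (ℤ.*-assoc i (ℤ.+ suc n) 1ℤ)) (ℚᵘ.≃-sym (toℚᵘ-fromℚᵘ (ℚᵘ.mkℚᵘ i 0))))))

  rec-≥0 : ∀ m → 0ℚ ≤ rec m
  rec-≥0 m = <⇒≤ (rec->0 m)

  natℚ-+ : ∀ m n → natℚ (m ℕ.+ n) ≡ natℚ m + natℚ n
  natℚ-+ zero n = sym (trans (cong (_+ natℚ n) natℚ-0) (+-identityˡ (natℚ n)))
  natℚ-+ (suc m) n = trans (natℚ-suc (m ℕ.+ n)) (trans (cong (1ℚ +_) (natℚ-+ m n))
    (trans (sym (+-assoc 1ℚ (natℚ m) (natℚ n))) (cong (_+ natℚ n) (sym (natℚ-suc m)))))

  -- By unfolding, `x ≃ y` is `Null` of the difference of the two sequences, so closure properties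
  -- of null sequences become congruences of the reals.
  Null : (ℕ → ℚ) → Set
  Null f = ∀ ε → 0ℚ < ε → ∃[ N ] ∀ n → N ℕ.≤ n → ∣ f n ∣ < ε

  ⊔≤ˡ : ∀ {m n o} → m ℕ.⊔ n ℕ.≤ o → m ℕ.≤ o
  ⊔≤ˡ {m} {n} = ℕ.m⊔n≤o⇒m≤o m n

  ⊔≤ʳ : ∀ m {n o} → m ℕ.⊔ n ℕ.≤ o → n ℕ.≤ o
  ⊔≤ʳ m {n} = ℕ.m⊔n≤o⇒n≤o m n

  Null-dominated : ∀ {f g : ℕ → ℚ} (N₀ : ℕ) → (∀ n → N₀ ℕ.≤ n → ∣ f n ∣ ≤ ∣ g n ∣) → Null g → Null f
  Null-dominated N₀ f≤g g→0 ε ε>0 with g→0 ε ε>0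
  ... | N , h = N₀ ℕ.⊔ N , λ n n≥ → ≤-<-trans (f≤g n (⊔≤ˡ n≥)) (h n (⊔≤ʳ N₀ n≥))

  Null-cong : ∀ {f g : ℕ → ℚ} → (∀ n → f n ≡ g n) → Null g → Null f
  Null-cong e = Null-dominated 0 (λ n _ → ≤-reflexive (cong ∣_∣ (e n)))

  Null-+ : ∀ {f g : ℕ → ℚ} → Null f → Null g → Null (λ n → f n + g n)
  Null-+ {f} {g} f→0 g→0 ε ε>0 with f→0 (½ * ε) (½ε>0 ε>0) | g→0 (½ * ε) (½ε>0 ε>0)
  ... | M , hf | N , hg = M ℕ.⊔ N , λ n n≥ →
    ≤-<-trans (∣p+q∣≤∣p∣+∣q∣ (f n) (g n))
      (subst (∣ f n ∣ + ∣ g n ∣ <_) (½+½ ε) (+-mono-< (hf n (⊔≤ˡ n≥)) (hg n (⊔≤ʳ M n≥))))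

  Null-neg : ∀ {f : ℕ → ℚ} → Null f → Null (λ n → - f n)
  Null-neg {f} = Null-dominated 0 (λ n _ → ≤-reflexive (∣-p∣≡∣p∣ (f n)))

  quotient : ∀ {K ε} → 0ℚ < K → 0ℚ < ε → ∃[ δ ] (0ℚ < δ × K * δ ≡ ε)
  quotient {K} {ε} K>0 ε>0 = 1/ K * ε , 0<* (positive⁻¹ (1/ K)) ε>0 ,
      trans (sym (*-assoc K (1/ K) ε)) (trans (cong (_* ε) (*-inverseʳ K)) (*-identityˡ ε))
    where
    instance
      K-positive : Positive K
      K-positive = positive K>0
      K-nonZero : NonZero K
      K-nonZero = pos⇒nonZero K
      1/K-positive : Positive (1/ K)
      1/K-positive = 1/pos⇒pos K

  -- The choice δ = ε / (1 + L) instead of ε / L also covers L = 0.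
  small-factor : ∀ {L ε} → 0ℚ ≤ L → 0ℚ < ε → ∃[ δ ] (0ℚ < δ × (∀ {t} → 0ℚ ≤ t → t < δ → L * t < ε))
  small-factor {L} {ε} L≥0 ε>0 =
    let K>0 = +-mono-<-≤ (positive⁻¹ 1ℚ) L≥0
        δ , δ>0 , Kδ≡ε = quotient K>0 ε>0
    in δ , δ>0 , λ {t} t≥0 t<δ → ≤-<-trans (*-monoʳ {L} {1ℚ + L} t t≥0 (≤-by 1ℚ (nonNegative⁻¹ 1ℚ) (+-comm 1ℚ L)))
         (subst ((1ℚ + L) * t <_) Kδ≡ε (*-monoʳ-<-pos (1ℚ + L) {{positive K>0}} t<δ))

  Null-* : ∀ {f g : ℕ → ℚ} (B : ℚ) (N₀ : ℕ) → 0ℚ ≤ B → (∀ n → N₀ ℕ.≤ n → ∣ f n ∣ ≤ B) → Null g → Null (λ n → f n * g n)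
  Null-* {f} {g} B N₀ B≥0 f≤B g→0 ε ε>0 =
    let δ , δ>0 , small = small-factor B≥0 ε>0
        N , h = g→0 δ δ>0
    in N₀ ℕ.⊔ N , λ n n≥ → subst (_< ε) (sym (∣p*q∣≡∣p∣*∣q∣ (f n) (g n)))
         (≤-<-trans (*-monoʳ ∣ g n ∣ (0≤∣p∣ (g n)) (f≤B n (⊔≤ˡ n≥))) (small (0≤∣p∣ (g n)) (h n (⊔≤ʳ N₀ n≥))))

  -- Bernoulli: 1/(n+2) decays more slowly than (2/3)ⁿ.
  opaque
    geometric-Null : ∀ (u : ℕ → ℚ) → (∀ n → 0ℚ ≤ u n) → (∀ n → u (suc n) ≤ ⅔ * u n) → Null u
    geometric-Null u u≥0 step ε ε>0 with archimedean (2ℚ * u 0 * (1/ ε) {{>-nonZero ε>0}})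
    ... | N , N> = N , λ n n≥ → subst (_< ε) (sym (0≤p⇒∣p∣≡p (u≥0 n)))
        (*-cancelʳ-<-nonNeg (natℚ (2 ℕ.+ n)) {{nonNegative (natℚ-≥0 (2 ℕ.+ n))}}
          (≤-<-trans (bound n) (subst (_< ε * natℚ (2 ℕ.+ n)) cancel
            (*-monoʳ-<-pos ε {{positive ε>0}} (<-≤-trans N> (natℚ-mono (ℕ.≤-trans n≥ (ℕ.m≤n+m n 2))))))))
      where
      instance
        nz : NonZero ε
        nz = >-nonZero ε>0
      cancel : ε * (2ℚ * u 0 * 1/ ε) ≡ 2ℚ * u 0
      cancel = trans (solve 3 (λ e c d → e :* (c :* d) := c :* (e :* d)) refl ε (2ℚ * u 0) (1/ ε))
        (trans (cong (2ℚ * u 0 *_) (*-inverseʳ ε)) (*-identityʳ _))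
      2+ : ∀ n → natℚ (2 ℕ.+ n) ≡ 2ℚ + natℚ n
      2+ n = trans (natℚ-+ 2 n) (cong (_+ natℚ n) natℚ-2)
      3+ : ∀ n → natℚ (3 ℕ.+ n) ≡ 3ℚ + natℚ n
      3+ n = trans (natℚ-+ 3 n) (cong (_+ natℚ n) natℚ-3)
      bound : ∀ n → u n * natℚ (2 ℕ.+ n) ≤ 2ℚ * u 0
      bound zero = ≤-reflexive (trans (cong (u 0 *_) natℚ-2) (*-comm (u 0) 2ℚ))
      bound (suc n) = ≤-trans (*-monoʳ (natℚ (3 ℕ.+ n)) (natℚ-≥0 (3 ℕ.+ n)) (step n)) (≤-trans
        (≤-by (⅓ * (u n * natℚ n)) (0≤* (nonNegative⁻¹ ⅓) (0≤* (u≥0 n) (natℚ-≥0 n)))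
          (trans (cong (u n *_) (2+ n)) (trans
            (solve 2 (λ u n → u :* (con 2ℚ :+ n) := con ⅔ :* u :* (con 3ℚ :+ n) :+ con ⅓ :* (u :* n)) refl (u n) (natℚ n))
            (cong (λ t → ⅔ * u n * t + ⅓ * (u n * natℚ n)) (sym (3+ n))))))
        (bound n))

  ∑ : ℕ → (ℕ → ℚ) → ℚ
  ∑ zero f = 0ℚ
  ∑ (suc n) f = ∑ n f + f n

  ∑-cong : ∀ n {f g} → (∀ i → i ℕ.< n → f i ≡ g i) → ∑ n f ≡ ∑ n g
  ∑-cong zero e = refl
  ∑-cong (suc n) e = cong₂ _+_ (∑-cong n (λ i i<n → e i (ℕ.m<n⇒m<1+n i<n))) (e n ℕ.≤-refl)

  ∑-+ : ∀ n f g → ∑ n (λ i → f i + g i) ≡ ∑ n f + ∑ n g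
  ∑-+ zero f g = refl
  ∑-+ (suc n) f g = trans (cong (_+ (f n + g n)) (∑-+ n f g))
    (solve 4 (λ a b c d → (a :+ b) :+ (c :+ d) := (a :+ c) :+ (b :+ d)) refl (∑ n f) (∑ n g) (f n) (g n))

  ∑-*ˡ : ∀ n c f → ∑ n (λ i → c * f i) ≡ c * ∑ n f
  ∑-*ˡ zero c f = sym (*-zeroʳ c)
  ∑-*ˡ (suc n) c f = trans (cong (_+ c * f n) (∑-*ˡ n c f)) (sym (*-distribˡ-+ c (∑ n f) (f n)))

  ∑-*ʳ : ∀ n c f → ∑ n (λ i → f i * c) ≡ ∑ n f * c
  ∑-*ʳ n c f = trans (∑-cong n (λ i _ → *-comm (f i) c)) (trans (∑-*ˡ n c f) (*-comm c (∑ n f)))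

  ∑-neg : ∀ n f → ∑ n (λ i → - f i) ≡ - ∑ n f
  ∑-neg zero f = refl
  ∑-neg (suc n) f = trans (cong (_+ - f n) (∑-neg n f)) (sym (neg-distrib-+ (∑ n f) (f n)))

  ∑-sub : ∀ n f g → ∑ n (λ i → f i - g i) ≡ ∑ n f - ∑ n g
  ∑-sub n f g = trans (∑-+ n f (λ i → - g i)) (cong (∑ n f +_) (∑-neg n g))

  ∑-split : ∀ m k f → ∑ (m ℕ.+ k) f ≡ ∑ m f + ∑ k (λ i → f (m ℕ.+ i))
  ∑-split m zero f = trans (cong (λ t → ∑ t f) (ℕ.+-identityʳ m)) (sym (+-identityʳ (∑ m f)))
  ∑-split m (suc k) f = trans (cong (λ t → ∑ t f) (ℕ.+-suc m k))
    (trans (cong (_+ f (m ℕ.+ k)) (∑-split m k f)) (+-assoc (∑ m f) _ (f (m ℕ.+ k))))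

  ∑-head : ∀ n f → ∑ (suc n) f ≡ f 0 + ∑ n (λ i → f (suc i))
  ∑-head n f = trans (∑-split 1 n f) (cong (_+ ∑ n (λ i → f (suc i))) (+-identityˡ (f 0)))

  ∑-mono : ∀ n {f g} → (∀ i → i ℕ.< n → f i ≤ g i) → ∑ n f ≤ ∑ n g
  ∑-mono zero h = ≤-refl
  ∑-mono (suc n) h = +-mono-≤ (∑-mono n (λ i i<n → h i (ℕ.m<n⇒m<1+n i<n))) (h n ℕ.≤-refl)

  ∑-≥0 : ∀ n {f} → (∀ i → 0ℚ ≤ f i) → 0ℚ ≤ ∑ n f
  ∑-≥0 zero h = ≤-refl
  ∑-≥0 (suc n) h = 0≤+ (∑-≥0 n h) (h n)

  ∑-∣∣ : ∀ n f → ∣ ∑ n f ∣ ≤ ∑ n (λ i → ∣ f i ∣)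
  ∑-∣∣ zero f = ≤-refl
  ∑-∣∣ (suc n) f = ≤-trans (∣p+q∣≤∣p∣+∣q∣ (∑ n f) (f n)) (+-monoˡ-≤ ∣ f n ∣ (∑-∣∣ n f))

  ∑-monoˡ : ∀ {m n f} → (∀ i → 0ℚ ≤ f i) → m ℕ.≤ n → ∑ m f ≤ ∑ n f
  ∑-monoˡ {m} {n} {f} h m≤n = ≤-by (∑ k (λ i → f (m ℕ.+ i))) (∑-≥0 k (λ i → h _))
    (trans (cong (λ t → ∑ t f) (sym (ℕ.m+[n∸m]≡n m≤n))) (∑-split m k f))
    where k = n ℕ.∸ m

open Rationals

-- The exponential series and the series it dominates.

module ExponentialSeries where
  open import Data.Rational.Base
  open import Data.Rational.Properties

  -- The exponential terms eventually halve, but `geometric-Null` is stated for the ratio 2/3, at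
  -- which the brackets around π/2 shrink.
  ½≤⅔ : ½ ≤ ⅔
  ½≤⅔ = toWitness {a? = ½ ≤? ⅔} _

  -- q^m / m!, built from the ratio q / (m + 1) of consecutive terms, on which the decay, Lipschitz
  -- and addition arguments all rest. Factorials return only when the series are matched with
  -- `coefficient`.
  expTerm : ℚ → ℕ → ℚ
  expTerm q zero    = 1ℚ
  expTerm q (suc m) = q * rec m * expTerm q m

  expTerm-rec : ∀ q m → natℚ (suc m) * expTerm q (suc m) ≡ q * expTerm q m
  expTerm-rec q m = trans
    (solve 4 (λ n q r e → n :* (q :* r :* e) := (n :* r) :* (q :* e)) refl (natℚ (suc m)) q (rec m) (expTerm q m))
    (trans (cong (_* (q * expTerm q m)) (rec-inverse m)) (*-identityˡ _))

  expTerm-1 : ∀ q → expTerm q 1 ≡ q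
  expTerm-1 q = trans (*-identityʳ (q * rec 0)) (trans (cong (q *_) rec-0) (*-identityʳ q))

  expTerm-≥0 : ∀ {q} → 0ℚ ≤ q → ∀ m → 0ℚ ≤ expTerm q m
  expTerm-≥0 q≥0 zero = nonNegative⁻¹ 1ℚ
  expTerm-≥0 q≥0 (suc m) = 0≤* (0≤* q≥0 (rec-≥0 m)) (expTerm-≥0 q≥0 m)

  expTerm-∣∣ : ∀ {B q} → ∣ q ∣ ≤ B → ∀ m → ∣ expTerm q m ∣ ≤ expTerm B m
  expTerm-∣∣ q≤B zero = ≤-refl
  expTerm-∣∣ {B} {q} q≤B (suc m) = ≤-trans
    (≤-reflexive (trans (∣p*q∣≡∣p∣*∣q∣ (q * rec m) (expTerm q m))
      (cong (_* ∣ expTerm q m ∣) (trans (∣p*q∣≡∣p∣*∣q∣ q (rec m)) (cong (∣ q ∣ *_) (0≤p⇒∣p∣≡p (rec-≥0 m)))))))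
    (*-mono (0≤∣p∣ _) (0≤* B≥0 (rec-≥0 m)) (*-monoʳ (rec m) (rec-≥0 m) q≤B) (expTerm-∣∣ q≤B m))
    where
    B≥0 : 0ℚ ≤ B
    B≥0 = ≤-trans (0≤∣p∣ q) q≤B

  -- The ratio B / (m + 1) is at most 1/2 as soon as m + 1 ≥ 2B.
  expTerm-half : ∀ {B} → 0ℚ ≤ B → ∀ m → 2ℚ * B ≤ natℚ (suc m) → expTerm B (suc m) ≤ ½ * expTerm B m
  expTerm-half {B} B≥0 m 2B≤m = *-monoʳ (expTerm B m) (expTerm-≥0 B≥0 m)
    (subst₂ _≤_ (solve 2 (λ r b → (con ½ :* r) :* (con 2ℚ :* b) := b :* r) refl (rec m) B)
      (trans (*-assoc ½ (rec m) _) (trans (cong (½ *_) (trans (*-comm (rec m) _) (rec-inverse m))) (*-identityʳ ½)))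
      (*-monoˡ (½ * rec m) (0≤* (nonNegative⁻¹ ½) (rec-≥0 m)) 2B≤m))

  expTail : ℚ → ℕ → ℕ → ℚ
  expTail B m k = ∑ k (λ i → expTerm B (m ℕ.+ i))

  expTail-bound : ∀ {B} → 0ℚ ≤ B → ∀ m → 2ℚ * B ≤ natℚ m → ∀ k → expTail B m k ≤ 2ℚ * expTerm B m
  expTail-bound {B} B≥0 m 2B≤m k = ≤-trans
    (≤-by (2ℚ * expTerm B (m ℕ.+ k)) (0≤* (nonNegative⁻¹ 2ℚ) (expTerm-≥0 B≥0 (m ℕ.+ k))) refl) (strong k)
    where
    -- Strengthened so that the induction closes: the sum so far plus twice the next term does not
    -- grow, since each term is at most half of the one before.
    strong : ∀ k → expTail B m k + 2ℚ * expTerm B (m ℕ.+ k) ≤ 2ℚ * expTerm B m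
    strong zero = ≤-reflexive (trans (+-identityˡ _) (cong (λ t → 2ℚ * expTerm B t) (ℕ.+-identityʳ m)))
    strong (suc k) rewrite ℕ.+-suc m k = ≤-trans
      (+-monoʳ-≤ (expTail B m k + x)
        (*-monoˡ 2ℚ (nonNegative⁻¹ 2ℚ)
          (expTerm-half B≥0 (m ℕ.+ k) (≤-trans 2B≤m (natℚ-mono (ℕ.≤-trans (ℕ.m≤m+n m k) (ℕ.n≤1+n _)))))))
      (≤-trans (≤-reflexive (solve 2 (λ s x → (s :+ x) :+ con 2ℚ :* (con ½ :* x) := s :+ con 2ℚ :* x) refl (expTail B m k) x)) (strong k))
      where x = expTerm B (m ℕ.+ k)

  expTerm-shift-Null : ∀ {B} → 0ℚ ≤ B → ∀ K → 2ℚ * B ≤ natℚ K → Null (λ n → expTerm B (K ℕ.+ n))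
  expTerm-shift-Null {B} B≥0 K 2B≤K = geometric-Null (λ n → expTerm B (K ℕ.+ n)) (λ n → expTerm-≥0 B≥0 (K ℕ.+ n))
    (λ n → ≤-trans (≤-reflexive (cong (expTerm B) (ℕ.+-suc K n)))
      (≤-trans (expTerm-half B≥0 (K ℕ.+ n) (≤-trans 2B≤K (natℚ-mono (ℕ.≤-trans (ℕ.m≤m+n K n) (ℕ.n≤1+n _)))))
        (*-monoʳ (expTerm B (K ℕ.+ n)) (expTerm-≥0 B≥0 (K ℕ.+ n)) ½≤⅔)))

  2*½ : ∀ ε → 2ℚ * (½ * ε) ≡ ε
  2*½ ε = trans (sym (*-assoc 2ℚ ½ ε)) (*-identityˡ ε)

  expTail-small : ∀ {B} → 0ℚ ≤ B → ∀ {ε m} → 2ℚ * B ≤ natℚ m → expTerm B m < ½ * ε → ∀ k → expTail B m k < ε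
  expTail-small {B} B≥0 {ε} {m} 2B≤m small k = ≤-<-trans (expTail-bound B≥0 m 2B≤m k)
    (subst (2ℚ * expTerm B m <_) (2*½ ε) (*-monoʳ-<-pos 2ℚ small))

  expTerm-small : ∀ {B} K N {δ} → (∀ n → N ℕ.≤ n → ∣ expTerm B (K ℕ.+ n) ∣ < δ) → ∀ m → N ℕ.+ K ℕ.≤ m → expTerm B m < δ
  expTerm-small {B} K N {δ} h m m≥ = ≤-<-trans (p≤∣p∣ (expTerm B m))
    (subst (λ t → ∣ expTerm B t ∣ < δ) (ℕ.m+[n∸m]≡n (ℕ.m+n≤o⇒n≤o N m≥))
      (h (m ℕ.∸ K) (ℕ.m+n≤o⇒m≤o∸n N m≥)))

  opaque
    expTail-Null : ∀ {B} → 0ℚ ≤ B → ∀ ε → 0ℚ < ε → ∃[ N ] ∀ m k → N ℕ.≤ m → expTail B m k < ε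
    expTail-Null {B} B≥0 ε ε>0 =
      let K , 2B<K = archimedean (2ℚ * B)
          N , h    = expTerm-shift-Null B≥0 K (<⇒≤ 2B<K) (½ * ε) (½ε>0 ε>0)
      in N ℕ.+ K , λ m k m≥ → expTail-small B≥0 (≤-trans (<⇒≤ 2B<K) (natℚ-mono (ℕ.m+n≤o⇒n≤o N m≥)))
                                (expTerm-small K N h m m≥) k

  expSum : ℕ → ℚ → ℚ
  expSum N B = ∑ N (expTerm B)

  expSum-≤ : ∀ {B} → 0ℚ ≤ B → ∀ M {D} → (∀ k → expTail B M k < D) → ∀ N → expSum N B ≤ expSum M B + D
  expSum-≤ {B} B≥0 M {D} h N = ≤-trans
    (∑-monoˡ {f = expTerm B} (expTerm-≥0 B≥0) (ℕ.m≤n+m N M))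
    (≤-trans (≤-reflexive (∑-split M N (expTerm B))) (+-monoʳ-≤ (expSum M B) (<⇒≤ (h N))))

  opaque
    expSum-bounded : ∀ {B} → 0ℚ ≤ B → ∃[ L ] ∀ N → expSum N B ≤ L
    expSum-bounded {B} B≥0 =
      let M , h = expTail-Null B≥0 1ℚ (positive⁻¹ 1ℚ)
      in expSum M B + 1ℚ , expSum-≤ B≥0 M (λ k → h M k ℕ.≤-refl)

  Bounded₁ : (ℕ → ℚ) → Set
  Bounded₁ w = ∀ m → ∣ w m ∣ ≤ 1ℚ

  -- Cosine and sine differ only in the weights `w`, so each estimate is proved once, for all
  -- weights bounded by 1.
  partial : (ℕ → ℚ) → ℕ → ℚ → ℚ
  partial w N q = ∑ N (λ m → w m * expTerm q m)

  weighted-≤ : ∀ {w x} → ∣ w ∣ ≤ 1ℚ → ∣ w * x ∣ ≤ ∣ x ∣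
  weighted-≤ {w} {x} w≤1 = ≤-trans (≤-reflexive (∣p*q∣≡∣p∣*∣q∣ w x))
    (≤-trans (*-monoʳ ∣ x ∣ (0≤∣p∣ x) w≤1) (≤-reflexive (*-identityˡ ∣ x ∣)))

  partial-tail : ∀ {w B q} → Bounded₁ w → ∣ q ∣ ≤ B → ∀ m k → ∣ partial w (m ℕ.+ k) q - partial w m q ∣ ≤ expTail B m k
  partial-tail {w} {B} {q} wb q≤B m k = ≤-trans
    (≤-reflexive (cong ∣_∣ (trans (cong (_- partial w m q) (∑-split m k _))
      (solve 2 (λ x y → (x :+ y) :- x := y) refl (partial w m q) _))))
    (≤-trans (∑-∣∣ k _) (∑-mono k (λ i _ → ≤-trans (weighted-≤ {w (m ℕ.+ i)} (wb (m ℕ.+ i))) (expTerm-∣∣ q≤B (m ℕ.+ i)))))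

  partial-tail-≤ : ∀ {w B q m n} → Bounded₁ w → ∣ q ∣ ≤ B → m ℕ.≤ n → ∣ partial w n q - partial w m q ∣ ≤ expTail B m (n ℕ.∸ m)
  partial-tail-≤ {w} {B} {q} {m} {n} wb q≤B m≤n =
    subst (λ t → ∣ partial w t q - partial w m q ∣ ≤ expTail B m (n ℕ.∸ m)) (ℕ.m+[n∸m]≡n m≤n)
      (partial-tail {w} wb q≤B m (n ℕ.∸ m))

  partial-close : ∀ {B ε N} → (∀ m k → N ℕ.≤ m → expTail B m k < ε) → ∀ {w q} → Bounded₁ w → ∣ q ∣ ≤ B →
    ∀ m n → N ℕ.≤ m → N ℕ.≤ n → ∣ partial w m q - partial w n q ∣ < ε
  partial-close {B} {ε} h {w} {q} wb q≤B m n m≥ n≥ with ℕ.≤-total m n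
  ... | inj₁ m≤n = subst (_< ε) (∣p-q∣≡∣q-p∣ (partial w n q) (partial w m q))
                     (≤-<-trans (partial-tail-≤ {w} wb q≤B m≤n) (h m (n ℕ.∸ m) m≥))
  ... | inj₂ n≤m = ≤-<-trans (partial-tail-≤ {w} wb q≤B n≤m) (h n (m ℕ.∸ n) n≥)

  opaque
    -- N depends on B and ε alone, not on the weights or the argument: a diagonal evaluates every
    -- truncation at another rational.
    partial-cauchy : ∀ {B} → 0ℚ ≤ B → ∀ ε → 0ℚ < ε → ∃[ N ] ∀ {w q} → Bounded₁ w → ∣ q ∣ ≤ B →
      ∀ m n → N ℕ.≤ m → N ℕ.≤ n → ∣ partial w m q - partial w n q ∣ < ε
    partial-cauchy B≥0 ε ε>0 =
      let N , h = expTail-Null B≥0 ε ε>0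
      in N , λ {w} → partial-close h {w}

  -- The mean value estimate for q^(m+1) / (m+1)!, without derivatives. From p a - q b = p (a - b) +
  -- (p - q) b the induction gives two multiples of the same term, with factors m + 1 and 1; their
  -- sum m + 2 cancels against `rec (suc m)`.
  expTerm-lipschitz : ∀ {B p q} → ∣ p ∣ ≤ B → ∣ q ∣ ≤ B → ∀ m →
    ∣ expTerm p (suc m) - expTerm q (suc m) ∣ ≤ ∣ p - q ∣ * expTerm B m
  expTerm-lipschitz {B} {p} {q} p≤B q≤B zero = ≤-reflexive (trans
    (cong ∣_∣ (cong₂ _-_ (expTerm-1 p) (expTerm-1 q))) (sym (*-identityʳ _)))
  expTerm-lipschitz {B} {p} {q} p≤B q≤B (suc m) = ≤-trans
    (≤-reflexive (trans (cong ∣_∣ split) (trans (∣p*q∣≡∣p∣*∣q∣ r _) (cong (_* ∣ X ∣) (0≤p⇒∣p∣≡p (rec-≥0 (suc m)))))))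
    (≤-trans (*-monoˡ r (rec-≥0 (suc m)) bound) (≤-reflexive total))
    where
    B≥0 = ≤-trans (0≤∣p∣ q) q≤B
    r = rec (suc m)
    a = expTerm p (suc m)
    b = expTerm q (suc m)
    X = p * (a - b) + (p - q) * b
    D = ∣ p - q ∣
    split : p * r * a - q * r * b ≡ r * X
    split = solve 5 (λ p q r a b → p :* r :* a :- q :* r :* b := r :* (p :* (a :- b) :+ (p :- q) :* b)) refl p q r a b
    bound : ∣ X ∣ ≤ B * (D * expTerm B m) + D * expTerm B (suc m)
    bound = ≤-trans (∣p+q∣≤∣p∣+∣q∣ (p * (a - b)) ((p - q) * b)) (+-mono-≤
      (≤-trans (≤-reflexive (∣p*q∣≡∣p∣*∣q∣ p (a - b))) (*-mono (0≤∣p∣ _) B≥0 p≤B (expTerm-lipschitz p≤B q≤B m)))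
      (≤-trans (≤-reflexive (∣p*q∣≡∣p∣*∣q∣ (p - q) b)) (*-monoˡ D (0≤∣p∣ _) (expTerm-∣∣ q≤B (suc m)))))
    total : r * (B * (D * expTerm B m) + D * expTerm B (suc m)) ≡ D * expTerm B (suc m)
    total = begin
      r * (B * (D * expTerm B m) + D * expTerm B (suc m))
        ≡⟨ solve 5 (λ r B D x y → r :* (B :* (D :* x) :+ D :* y) := r :* D :* (B :* x :+ y)) refl r B D (expTerm B m) (expTerm B (suc m)) ⟩
      r * D * (B * expTerm B m + expTerm B (suc m))
        ≡⟨ cong (λ t → r * D * (t + expTerm B (suc m))) (sym (expTerm-rec B m)) ⟩
      r * D * (natℚ (suc m) * expTerm B (suc m) + expTerm B (suc m))
        ≡⟨ solve 4 (λ r D n y → r :* D :* (n :* y :+ y) := ((con 1ℚ :+ n) :* r) :* (D :* y)) refl r D (natℚ (suc m)) (expTerm B (suc m)) ⟩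
      (1ℚ + natℚ (suc m)) * r * (D * expTerm B (suc m))
        ≡⟨ cong (λ t → t * r * (D * expTerm B (suc m))) (sym (natℚ-suc (suc m))) ⟩
      natℚ (suc (suc m)) * r * (D * expTerm B (suc m))
        ≡⟨ cong (_* (D * expTerm B (suc m))) (rec-inverse (suc m)) ⟩
      1ℚ * (D * expTerm B (suc m))
        ≡⟨ *-identityˡ _ ⟩
      D * expTerm B (suc m) ∎
      where open ≡-Reasoning

  -- The terms of degree 0 agree and cancel. In the others `expTerm-lipschitz` lowers the degree by
  -- one, so the constant is again a partial sum of the exponential series.
  partial-lipschitz : ∀ {w B p q} → Bounded₁ w → ∣ p ∣ ≤ B → ∣ q ∣ ≤ B → ∀ N →
    ∣ partial w N p - partial w N q ∣ ≤ ∣ p - q ∣ * expSum N B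
  partial-lipschitz {w} {B} {p} {q} wb p≤B q≤B zero = ≤-reflexive (sym (*-zeroʳ ∣ p - q ∣))
  partial-lipschitz {w} {B} {p} {q} wb p≤B q≤B (suc N) = ≤-trans (≤-reflexive (cong ∣_∣ difference))
    (≤-trans (∑-∣∣ N _) (≤-trans (∑-mono N (λ i _ → ≤-trans (weighted-≤ {w (suc i)} (wb (suc i))) (expTerm-lipschitz p≤B q≤B i)))
    (≤-trans (≤-reflexive (∑-*ˡ N ∣ p - q ∣ (expTerm B)))
      (*-monoˡ ∣ p - q ∣ (0≤∣p∣ _) (∑-monoˡ {f = expTerm B} (expTerm-≥0 (≤-trans (0≤∣p∣ q) q≤B)) (ℕ.n≤1+n N))))))
    where
    open ≡-Reasoning
    tail : ℚ → ℚ
    tail p = ∑ N (λ i → w (suc i) * expTerm p (suc i))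
    difference : partial w (suc N) p - partial w (suc N) q ≡ ∑ N (λ i → w (suc i) * (expTerm p (suc i) - expTerm q (suc i)))
    difference = begin
      partial w (suc N) p - partial w (suc N) q
        ≡⟨ cong₂ _-_ (∑-head N _) (∑-head N _) ⟩
      (w 0 * 1ℚ + tail p) - (w 0 * 1ℚ + tail q)
        ≡⟨ solve 3 (λ a x y → (a :+ x) :- (a :+ y) := x :- y) refl (w 0 * 1ℚ) (tail p) (tail q) ⟩
      tail p - tail q
        ≡⟨ sym (∑-sub N _ _) ⟩
      ∑ N (λ i → w (suc i) * expTerm p (suc i) - w (suc i) * expTerm q (suc i))
        ≡⟨ ∑-cong N (λ i _ → solve 3 (λ a x y → a :* x :- a :* y := a :* (x :- y)) refl (w (suc i)) (expTerm p (suc i)) (expTerm q (suc i))) ⟩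
      ∑ N (λ i → w (suc i) * (expTerm p (suc i) - expTerm q (suc i))) ∎

  -- The antidiagonal a + b = m of a Cauchy product; the recursion peels off a = 0.
  diagonal : ℕ → (ℕ → ℕ → ℚ) → ℚ
  diagonal zero    f = f 0 0
  diagonal (suc m) f = f 0 (suc m) + diagonal m (λ a → f (suc a))

  -- Regions of index pairs: a + b < N for `triangle`, a and b < N for `square`, and for `corner`
  -- the rest of the square, where a + b ≥ N.
  triangle square corner : ℕ → (ℕ → ℕ → ℚ) → ℚ
  triangle N f = ∑ N (λ m → diagonal m f)
  square   N f = ∑ N (λ a → ∑ N (f a))
  corner   N f = ∑ N (λ a → ∑ a (λ b → f a (N ℕ.∸ a ℕ.+ b)))

  diagonal-cong : ∀ m {f g} → (∀ a b → a ℕ.+ b ≡ m → f a b ≡ g a b) → diagonal m f ≡ diagonal m g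
  diagonal-cong zero e = e 0 0 refl
  diagonal-cong (suc m) e = cong₂ _+_ (e 0 (suc m) refl) (diagonal-cong m (λ a b eq → e (suc a) b (cong suc eq)))

  diagonal-+ : ∀ m f g → diagonal m (λ a b → f a b + g a b) ≡ diagonal m f + diagonal m g
  diagonal-+ zero f g = refl
  diagonal-+ (suc m) f g = trans (cong (f 0 (suc m) + g 0 (suc m) +_) (diagonal-+ m _ _))
    (solve 4 (λ a b c d → (a :+ b) :+ (c :+ d) := (a :+ c) :+ (b :+ d)) refl (f 0 (suc m)) (g 0 (suc m)) _ _)

  diagonal-*ˡ : ∀ m c f → diagonal m (λ a b → c * f a b) ≡ c * diagonal m f
  diagonal-*ˡ zero c f = refl
  diagonal-*ˡ (suc m) c f = trans (cong (c * f 0 (suc m) +_) (diagonal-*ˡ m c _)) (sym (*-distribˡ-+ c _ _))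

  diagonal-weightˡ : ∀ m (f : ℕ → ℕ → ℚ) → diagonal (suc m) (λ a b → natℚ a * f a b) ≡ diagonal m (λ a b → natℚ (suc a) * f (suc a) b)
  diagonal-weightˡ m f = trans (cong (_+ rest) (trans (cong (_* f 0 (suc m)) natℚ-0) (*-zeroˡ (f 0 (suc m))))) (+-identityˡ rest)
    where rest = diagonal m (λ a b → natℚ (suc a) * f (suc a) b)

  diagonal-weightʳ : ∀ m (f : ℕ → ℕ → ℚ) → diagonal (suc m) (λ a b → natℚ b * f a b) ≡ diagonal m (λ a b → natℚ (suc b) * f a (suc b))
  diagonal-weightʳ zero f = trans (cong (natℚ 1 * f 0 1 +_) (trans (cong (_* f 1 0) natℚ-0) (*-zeroˡ (f 1 0)))) (+-identityʳ _)
  diagonal-weightʳ (suc m) f = cong (natℚ (suc (suc m)) * f 0 (suc (suc m)) +_) (diagonal-weightʳ m (λ a → f (suc a)))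

  -- The binomial theorem divided by m!, without binomial coefficients. Multiplying the antidiagonal
  -- of degree m + 1 by m + 1 = a + b splits it in two; the factor a lowers the exponent of p, the
  -- factor b that of q, and both parts become antidiagonals of degree m.
  expTerm-+ : ∀ p q m → diagonal m (λ a b → expTerm p a * expTerm q b) ≡ expTerm (p + q) m
  expTerm-+ p q zero = refl
  expTerm-+ p q (suc m) = begin
    diagonal (suc m) f
      ≡⟨ sym (*-identityˡ _) ⟩
    1ℚ * diagonal (suc m) f
      ≡⟨ cong (_* diagonal (suc m) f) (sym (rec-inverse m)) ⟩
    natℚ (suc m) * rec m * diagonal (suc m) f
      ≡⟨ solve 3 (λ n r d → n :* r :* d := r :* (n :* d)) refl (natℚ (suc m)) (rec m) (diagonal (suc m) f) ⟩
    rec m * (natℚ (suc m) * diagonal (suc m) f)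
      ≡⟨ cong (rec m *_) (sym (diagonal-*ˡ (suc m) (natℚ (suc m)) f)) ⟩
    rec m * diagonal (suc m) (λ a b → natℚ (suc m) * f a b)
      ≡⟨ cong (rec m *_) (diagonal-cong (suc m) (λ a b eq → trans (cong (λ t → natℚ t * f a b) (sym eq))
           (trans (cong (_* f a b) (natℚ-+ a b)) (*-distribʳ-+ (f a b) (natℚ a) (natℚ b))))) ⟩
    rec m * diagonal (suc m) (λ a b → natℚ a * f a b + natℚ b * f a b)
      ≡⟨ cong (rec m *_) (diagonal-+ (suc m) (λ a b → natℚ a * f a b) (λ a b → natℚ b * f a b)) ⟩
    rec m * (diagonal (suc m) (λ a b → natℚ a * f a b) + diagonal (suc m) (λ a b → natℚ b * f a b))
      ≡⟨ cong (rec m *_) (cong₂ _+_ (trans (diagonal-weightˡ m f) left) (trans (diagonal-weightʳ m f) right)) ⟩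
    rec m * (p * diagonal m f + q * diagonal m f)
      ≡⟨ solve 4 (λ r p q d → r :* (p :* d :+ q :* d) := (p :+ q) :* r :* d) refl (rec m) p q (diagonal m f) ⟩
    (p + q) * rec m * diagonal m f
      ≡⟨ cong ((p + q) * rec m *_) (expTerm-+ p q m) ⟩
    expTerm (p + q) (suc m) ∎
    where
    open ≡-Reasoning
    f : ℕ → ℕ → ℚ
    f a b = expTerm p a * expTerm q b
    left : diagonal m (λ a b → natℚ (suc a) * f (suc a) b) ≡ p * diagonal m f
    left = trans (diagonal-cong m (λ a b _ → trans (sym (*-assoc (natℚ (suc a)) _ _))
      (trans (cong (_* expTerm q b) (expTerm-rec p a)) (*-assoc p _ _)))) (diagonal-*ˡ m p f)
    right : diagonal m (λ a b → natℚ (suc b) * f a (suc b)) ≡ q * diagonal m f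
    right = trans (diagonal-cong m (λ a b _ → trans
      (solve 3 (λ n x y → n :* (x :* y) := x :* (n :* y)) refl (natℚ (suc b)) (expTerm p a) (expTerm q (suc b)))
      (trans (cong (expTerm p a *_) (expTerm-rec q b))
      (solve 3 (λ x q y → x :* (q :* y) := q :* (x :* y)) refl (expTerm p a) q (expTerm q b))))) (diagonal-*ˡ m q f)

  triangle-rows : ∀ N f → triangle N f ≡ ∑ N (λ a → ∑ (N ℕ.∸ a) (f a))
  triangle-rows zero f = refl
  triangle-rows (suc N) f = begin
    triangle (suc N) f
      ≡⟨ ∑-head N _ ⟩
    f 0 0 + ∑ N (λ m → f 0 (suc m) + diagonal m (λ a → f (suc a)))
      ≡⟨ cong (f 0 0 +_) (∑-+ N _ _) ⟩
    f 0 0 + (∑ N (λ m → f 0 (suc m)) + triangle N (λ a → f (suc a)))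
      ≡⟨ sym (+-assoc (f 0 0) _ _) ⟩
    f 0 0 + ∑ N (λ m → f 0 (suc m)) + triangle N (λ a → f (suc a))
      ≡⟨ cong₂ _+_ (sym (∑-head N (f 0))) (triangle-rows N (λ a → f (suc a))) ⟩
    ∑ (suc N) (f 0) + ∑ N (λ a → ∑ (N ℕ.∸ a) (f (suc a)))
      ≡⟨ sym (∑-head N _) ⟩
    ∑ (suc N) (λ a → ∑ (suc N ℕ.∸ a) (f a)) ∎
    where open ≡-Reasoning

  square-triangle : ∀ N f → square N f ≡ triangle N f + corner N f
  square-triangle N f = trans (∑-cong N row) (trans (∑-+ N _ _) (cong (_+ corner N f) (sym (triangle-rows N f))))
    where
    row : ∀ a → a ℕ.< N → ∑ N (f a) ≡ ∑ (N ℕ.∸ a) (f a) + ∑ a (λ b → f a (N ℕ.∸ a ℕ.+ b))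
    row a a<N = trans (cong (λ t → ∑ t (f a)) (sym (ℕ.m∸n+n≡m (ℕ.<⇒≤ a<N)))) (∑-split (N ℕ.∸ a) a (f a))

  -- If a and b are below N, then a + b < 2N. Subtracting `triangle N f` bounds the corner by the
  -- antidiagonals of degrees N to 2N - 1.
  square≤triangle : ∀ N {f} → (∀ a b → 0ℚ ≤ f a b) → square N f ≤ triangle (N ℕ.+ N) f
  square≤triangle N {f} f≥0 = ≤-trans
    (∑-mono N (λ a a<N → ∑-monoˡ {f = f a} (f≥0 a) (ℕ.≤-trans (ℕ.m≤m+n N (N ℕ.∸ a)) (ℕ.≤-reflexive (sym (ℕ.+-∸-assoc N (ℕ.<⇒≤ a<N)))))))
    (≤-trans (∑-monoˡ {f = λ a → ∑ (N ℕ.+ N ℕ.∸ a) (f a)} (λ a → ∑-≥0 (N ℕ.+ N ℕ.∸ a) (f≥0 a)) (ℕ.m≤m+n N N))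
      (≤-reflexive (sym (triangle-rows (N ℕ.+ N) f))))

  -- The truncated Cauchy product overshoots the partial sum at p + q by the
  -- corner a + b ≥ N of the square, which the exponential series dominates.
  partial-+ : ∀ {w P Q p q} → Bounded₁ w → ∣ p ∣ ≤ P → ∣ q ∣ ≤ Q → ∀ N →
    ∣ square N (λ a b → w (a ℕ.+ b) * (expTerm p a * expTerm q b)) - partial w N (p + q) ∣ ≤ expTail (P + Q) N N
  partial-+ {w} {P} {Q} {p} {q} wb p≤P q≤Q N = ≤-trans (≤-reflexive (cong ∣_∣ exact)) (≤-trans dominated expCorner)
    where
    f g : ℕ → ℕ → ℚ
    f a b = w (a ℕ.+ b) * (expTerm p a * expTerm q b)
    g a b = expTerm P a * expTerm Q b
    P≥0 = ≤-trans (0≤∣p∣ p) p≤P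
    Q≥0 = ≤-trans (0≤∣p∣ q) q≤Q
    g≥0 : ∀ a b → 0ℚ ≤ g a b
    g≥0 a b = 0≤* (expTerm-≥0 P≥0 a) (expTerm-≥0 Q≥0 b)
    f≤g : ∀ a b → ∣ f a b ∣ ≤ g a b
    f≤g a b = ≤-trans (weighted-≤ {w (a ℕ.+ b)} (wb (a ℕ.+ b))) (≤-trans (≤-reflexive (∣p*q∣≡∣p∣*∣q∣ (expTerm p a) (expTerm q b)))
      (*-mono (0≤∣p∣ _) (expTerm-≥0 P≥0 a) (expTerm-∣∣ p≤P a) (expTerm-∣∣ q≤Q b)))
    triangle-f : triangle N f ≡ partial w N (p + q)
    triangle-f = ∑-cong N (λ m _ → trans (diagonal-cong m (λ a b eq → cong (λ t → w t * (expTerm p a * expTerm q b)) eq))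
      (trans (diagonal-*ˡ m (w m) _) (cong (w m *_) (expTerm-+ p q m))))
    triangle-g : ∀ N → triangle N g ≡ expSum N (P + Q)
    triangle-g N = ∑-cong N (λ m _ → expTerm-+ P Q m)
    exact : square N f - partial w N (p + q) ≡ corner N f
    exact = trans (cong (_- partial w N (p + q)) (trans (square-triangle N f) (cong (_+ corner N f) triangle-f)))
      (solve 2 (λ x y → (x :+ y) :- x := y) refl (partial w N (p + q)) (corner N f))
    dominated : ∣ corner N f ∣ ≤ corner N g
    dominated = ≤-trans (∑-∣∣ N _) (∑-mono N (λ a _ → ≤-trans (∑-∣∣ a _) (∑-mono a (λ b _ → f≤g a _))))
    expCorner : corner N g ≤ expTail (P + Q) N N
    expCorner = subst₂ _≤_
      (trans (cong (_- triangle N g) (square-triangle N g)) (solve 2 (λ x y → (x :+ y) :- x := y) refl (triangle N g) (corner N g)))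
      (trans (cong₂ _-_ (trans (triangle-g (N ℕ.+ N)) (∑-split N N (expTerm (P + Q)))) (triangle-g N))
        (solve 2 (λ x y → (x :+ y) :- x := y) refl (expSum N (P + Q)) (expTail (P + Q) N N)))
      (+-monoˡ-≤ (- triangle N g) (square≤triangle N g≥0))

open ExponentialSeries

-- Weights of cosine and sine, their addition formulas, and alternating series.

module TrigonometricSeries where
  open import Defs using (coefficient)
  open import Data.Rational.Base
  open import Data.Rational.Properties

  -- iᵐ = κ m + i σ m
  κ σ : ℕ → ℚ
  κ zero    = 1ℚ
  κ (suc m) = - σ m
  σ zero    = 0ℚ
  σ (suc m) = κ m

  κ-bounded : Bounded₁ κ
  σ-bounded : Bounded₁ σ
  κ-bounded zero = ≤-refl
  κ-bounded (suc m) = subst (_≤ 1ℚ) (sym (∣-p∣≡∣p∣ (σ m))) (σ-bounded m)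
  σ-bounded zero = nonNegative⁻¹ 1ℚ
  σ-bounded (suc m) = κ-bounded m

  -- Real and imaginary parts of i^(a+b) = i^a i^b. Weighted with `expTerm` they become the addition
  -- theorems.
  κ-+ : ∀ a b → κ (a ℕ.+ b) ≡ κ a * κ b - σ a * σ b
  σ-+ : ∀ a b → σ (a ℕ.+ b) ≡ σ a * κ b + κ a * σ b
  κ-+ zero b = solve 2 (λ k s → k := con 1ℚ :* k :- con 0ℚ :* s) refl (κ b) (σ b)
  κ-+ (suc a) b = trans (cong -_ (σ-+ a b))
    (solve 4 (λ k s k′ s′ → :- (s :* k′ :+ k :* s′) := (:- s) :* k′ :- k :* s′) refl (κ a) (σ a) (κ b) (σ b))
  σ-+ zero b = solve 2 (λ k s → s := con 0ℚ :* k :+ con 1ℚ :* s) refl (κ b) (σ b)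
  σ-+ (suc a) b = trans (κ-+ a b)
    (solve 4 (λ k s k′ s′ → k :* k′ :- s :* s′ := k :* k′ :+ (:- s) :* s′) refl (κ a) (σ a) (κ b) (σ b))

  -- κ vanishes in odd degrees and σ in even ones. The two are proved together because
  -- multiplication by i exchanges them.
  κ-even : ∀ q m → κ m * expTerm (- q) m ≡ κ m * expTerm q m
  σ-odd  : ∀ q m → σ m * expTerm (- q) m ≡ - (σ m * expTerm q m)
  κ-even q zero = refl
  κ-even q (suc m) = trans
    (solve 4 (λ s q r e → (:- s) :* ((:- q) :* r :* e) := q :* r :* (s :* e)) refl (σ m) q (rec m) (expTerm (- q) m))
    (trans (cong (q * rec m *_) (σ-odd q m))
    (solve 4 (λ s q r e → q :* r :* (:- (s :* e)) := (:- s) :* (q :* r :* e)) refl (σ m) q (rec m) (expTerm q m)))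
  σ-odd q zero = refl
  σ-odd q (suc m) = trans
    (solve 4 (λ s q r e → s :* ((:- q) :* r :* e) := :- (q :* r :* (s :* e))) refl (κ m) q (rec m) (expTerm (- q) m))
    (trans (cong (λ t → - (q * rec m * t)) (κ-even q m))
    (solve 4 (λ s q r e → :- (q :* r :* (s :* e)) := :- (s :* (q :* r :* e))) refl (κ m) q (rec m) (expTerm q m)))

  partial-κ-neg : ∀ N q → partial κ N (- q) ≡ partial κ N q
  partial-κ-neg N q = ∑-cong N (λ m _ → κ-even q m)

  partial-σ-neg : ∀ N q → partial σ N (- q) ≡ - partial σ N q
  partial-σ-neg N q = trans (∑-cong N (λ m _ → σ-odd q m)) (∑-neg N _)

  square-* : ∀ N (x y : ℕ → ℚ) → square N (λ a b → x a * y b) ≡ ∑ N x * ∑ N y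
  square-* N x y = trans (∑-cong N (λ a _ → ∑-*ˡ N (x a) y)) (∑-*ʳ N (∑ N y) x)

  square-+ : ∀ N (f g : ℕ → ℕ → ℚ) → square N (λ a b → f a b + g a b) ≡ square N f + square N g
  square-+ N f g = trans (∑-cong N (λ a _ → ∑-+ N (f a) (g a))) (∑-+ N _ _)

  square-cong : ∀ N {f g : ℕ → ℕ → ℚ} → (∀ a b → f a b ≡ g a b) → square N f ≡ square N g
  square-cong N e = ∑-cong N (λ a _ → ∑-cong N (λ b _ → e a b))

  square-κ : ∀ N p q → square N (λ a b → κ (a ℕ.+ b) * (expTerm p a * expTerm q b)) ≡
    partial κ N p * partial κ N q - partial σ N p * partial σ N q
  square-κ N p q = begin
    square N (λ a b → κ (a ℕ.+ b) * (expTerm p a * expTerm q b))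
      ≡⟨ square-cong N (λ a b → trans (cong (_* (expTerm p a * expTerm q b)) (κ-+ a b))
          (solve 6 (λ k k′ s s′ x y → (k :* k′ :- s :* s′) :* (x :* y) := (k :* x) :* (k′ :* y) :+ (:- (s :* x)) :* (s′ :* y))
            refl (κ a) (κ b) (σ a) (σ b) (expTerm p a) (expTerm q b))) ⟩
    square N (λ a b → (κ a * expTerm p a) * (κ b * expTerm q b) + (- (σ a * expTerm p a)) * (σ b * expTerm q b))
      ≡⟨ square-+ N (λ a b → (κ a * expTerm p a) * (κ b * expTerm q b)) (λ a b → (- (σ a * expTerm p a)) * (σ b * expTerm q b)) ⟩
    square N (λ a b → (κ a * expTerm p a) * (κ b * expTerm q b)) + square N (λ a b → (- (σ a * expTerm p a)) * (σ b * expTerm q b))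
      ≡⟨ cong₂ _+_ (square-* N (λ a → κ a * expTerm p a) (λ b → κ b * expTerm q b))
                   (square-* N (λ a → - (σ a * expTerm p a)) (λ b → σ b * expTerm q b)) ⟩
    partial κ N p * partial κ N q + ∑ N (λ a → - (σ a * expTerm p a)) * partial σ N q
      ≡⟨ cong (λ t → partial κ N p * partial κ N q + t * partial σ N q) (∑-neg N _) ⟩
    partial κ N p * partial κ N q + (- partial σ N p) * partial σ N q
      ≡⟨ cong (partial κ N p * partial κ N q +_) (sym (neg-distribˡ-* (partial σ N p) (partial σ N q))) ⟩
    partial κ N p * partial κ N q - partial σ N p * partial σ N q ∎
    where open ≡-Reasoning

  square-σ : ∀ N p q → square N (λ a b → σ (a ℕ.+ b) * (expTerm p a * expTerm q b)) ≡
    partial σ N p * partial κ N q + partial κ N p * partial σ N q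
  square-σ N p q = begin
    square N (λ a b → σ (a ℕ.+ b) * (expTerm p a * expTerm q b))
      ≡⟨ square-cong N (λ a b → trans (cong (_* (expTerm p a * expTerm q b)) (σ-+ a b))
          (solve 6 (λ k k′ s s′ x y → (s :* k′ :+ k :* s′) :* (x :* y) := (s :* x) :* (k′ :* y) :+ (k :* x) :* (s′ :* y))
            refl (κ a) (κ b) (σ a) (σ b) (expTerm p a) (expTerm q b))) ⟩
    square N (λ a b → (σ a * expTerm p a) * (κ b * expTerm q b) + (κ a * expTerm p a) * (σ b * expTerm q b))
      ≡⟨ square-+ N (λ a b → (σ a * expTerm p a) * (κ b * expTerm q b)) (λ a b → (κ a * expTerm p a) * (σ b * expTerm q b)) ⟩
    square N (λ a b → (σ a * expTerm p a) * (κ b * expTerm q b)) + square N (λ a b → (κ a * expTerm p a) * (σ b * expTerm q b))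
      ≡⟨ cong₂ _+_ (square-* N (λ a → σ a * expTerm p a) (λ b → κ b * expTerm q b))
                   (square-* N (λ a → κ a * expTerm p a) (λ b → σ b * expTerm q b)) ⟩
    partial σ N p * partial κ N q + partial κ N p * partial σ N q ∎
    where open ≡-Reasoning

  -- Unlike `2 ℕ.* n`, `double (suc n)` computes to two successors and exposes two terms of a
  -- series: one of even degree for cosine, one of odd degree for sine.
  double : ℕ → ℕ
  double zero    = zero
  double (suc n) = suc (suc (double n))

  double≡2* : ∀ n → 2 ℕ.* n ≡ double n
  double≡2* zero = refl
  double≡2* (suc n) = cong suc (trans (ℕ.+-suc n (n ℕ.+ 0)) (cong suc (double≡2* n)))

  n≤double : ∀ n → n ℕ.≤ double n
  n≤double zero = ℕ.z≤n
  n≤double (suc n) = ℕ.s≤s (ℕ.≤-trans (n≤double n) (ℕ.n≤1+n _))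

  σ-double : ∀ n → σ (double n) ≡ 0ℚ
  σ-double zero = refl
  σ-double (suc n) = cong -_ (σ-double n)

  /1-neg : ∀ i → (ℤ.- i) / 1 ≡ - (i / 1)
  /1-neg (ℤ.+ zero) = refl
  /1-neg (ℤ.+ suc n) = refl
  /1-neg -[1+ n ] = sym (neg-involutive′ (ℤ.+ suc n / 1))
    where
    neg-involutive′ : ∀ p → - (- p) ≡ p
    neg-involutive′ = solve 1 (λ p → :- (:- p) := p) refl

  -1^/1 : ∀ j → (-1ℤ ℤ.^ j) / 1 ≡ κ (double j)
  -1^/1 zero = refl
  -1^/1 (suc j) = trans (cong (_/ 1) (ℤ.-1*i≡-i (-1ℤ ℤ.^ j))) (trans (/1-neg (-1ℤ ℤ.^ j)) (cong -_ (-1^/1 j)))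

  pow : ℚ → ℕ → ℚ
  pow q zero    = 1ℚ
  pow q (suc m) = q * pow q m

  !-expTerm : ∀ q m → natℚ (m !) * expTerm q m ≡ pow q m
  !-expTerm q zero = trans (*-identityʳ (natℚ 1)) natℚ-1
  !-expTerm q (suc m) = begin
    natℚ (suc m ℕ.* m !) * (q * rec m * expTerm q m)
      ≡⟨ cong (_* (q * rec m * expTerm q m)) (natℚ-* (suc m) (m !)) ⟩
    natℚ (suc m) * natℚ (m !) * (q * rec m * expTerm q m)
      ≡⟨ solve 5 (λ n f q r e → n :* f :* (q :* r :* e) := (n :* r) :* (q :* (f :* e))) refl (natℚ (suc m)) (natℚ (m !)) q (rec m) (expTerm q m) ⟩
    natℚ (suc m) * rec m * (q * (natℚ (m !) * expTerm q m))
      ≡⟨ cong₂ (λ a b → a * (q * b)) (rec-inverse m) (!-expTerm q m) ⟩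
    1ℚ * (q * pow q m)
      ≡⟨ *-identityˡ _ ⟩
    q * pow q m ∎
    where open ≡-Reasoning

  -- Writing q^m as m! times `expTerm q m` cancels the denominator of `coefficient`, and (-1)^j is
  -- left as a value of κ.
  coefficient-pow : ∀ q j m → coefficient j m * pow q m ≡ κ (double j) * expTerm q m
  coefficient-pow q j m = trans (cong (coefficient j m *_) (sym (!-expTerm q m)))
    (trans (sym (*-assoc (coefficient j m) (natℚ (m !)) (expTerm q m)))
    (cong (_* expTerm q m) (trans (/-*-cancel (-1ℤ ℤ.^ j) (m !) {{m ℕ.!≢0}}) (-1^/1 j))))

  -- `κ (double j)` is (-1)^j. Both series take this form once the terms of weight 0 are dropped,
  -- and Leibniz's estimates apply to it.
  alternating : (ℕ → ℚ) → ℕ → ℚ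
  alternating t n = ∑ n (λ j → κ (double j) * t j)

  partial-κ-double : ∀ n q → partial κ (double n) q ≡ alternating (λ j → expTerm q (double j)) n
  partial-κ-double zero q = refl
  partial-κ-double (suc n) q = trans
    (cong₂ _+_ (cong (_+ κ (double n) * expTerm q (double n)) (partial-κ-double n q))
      (trans (cong (λ t → (- t) * expTerm q (suc (double n))) (σ-double n)) (*-zeroˡ (expTerm q (suc (double n))))))
    (+-identityʳ _)

  partial-σ-double : ∀ n q → partial σ (double n) q ≡ alternating (λ j → expTerm q (suc (double j))) n
  partial-σ-double zero q = refl
  partial-σ-double (suc n) q = cong (_+ κ (double n) * expTerm q (suc (double n)))
    (trans (cong₂ _+_ (partial-σ-double n q) (trans (cong (_* expTerm q (double n)) (σ-double n)) (*-zeroˡ (expTerm q (double n)))))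
      (+-identityʳ (alternating (λ j → expTerm q (suc (double j))) n)))

  alternating-suc : ∀ t n → alternating t (suc n) ≡ t 0 - alternating (λ j → t (suc j)) n
  alternating-suc t n = trans (∑-head n _) (cong₂ _+_ (*-identityˡ (t 0))
    (trans (∑-cong n (λ j _ → sym (neg-distribˡ-* (κ (double j)) (t (suc j))))) (∑-neg n _)))

  p-q≤p : ∀ {p q} → 0ℚ ≤ q → p - q ≤ p
  p-q≤p {p} {q} q≥0 = ≤-by q q≥0 (solve 2 (λ p q → p := (p :- q) :+ q) refl p q)

  -- Leibniz: the sum is t 0 minus the alternating sum of the shifted terms, so the upper bound for
  -- the shift gives the lower bound here and the lower one the upper.
  alternating-bounds : ∀ t → (∀ j → 0ℚ ≤ t j) → (∀ j → t (suc j) ≤ t j) → ∀ n →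
    0ℚ ≤ alternating t n × alternating t n ≤ t 0
  alternating-bounds t t≥0 dec zero = ≤-refl , t≥0 0
  alternating-bounds t t≥0 dec (suc n) =
    subst (0ℚ ≤_) (sym (alternating-suc t n)) (≤⇒0≤- (≤-trans (proj₂ ih) (dec 0))) ,
    subst (_≤ t 0) (sym (alternating-suc t n)) (p-q≤p (proj₁ ih))
    where ih = alternating-bounds (λ j → t (suc j)) (λ j → t≥0 (suc j)) (λ j → dec (suc j)) n

  -- Monotonicity is asked only from t 1 on, because the terms of cosine at 2 begin with 1, 2, 2/3.
  alternating-lower : ∀ t → (∀ j → 0ℚ ≤ t j) → (∀ j → t (suc (suc j)) ≤ t (suc j)) → ∀ n →
    t 0 - t 1 ≤ alternating t (suc n)
  alternating-lower t t≥0 dec n = subst (t 0 - t 1 ≤_) (sym (alternating-suc t n))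
    (+-monoʳ-≤ (t 0) (neg-antimono-≤ (proj₂ (alternating-bounds (λ j → t (suc j)) (λ j → t≥0 (suc j)) dec n))))

  alternating-upper : ∀ t → (∀ j → 0ℚ ≤ t j) → (∀ j → t (suc (suc j)) ≤ t (suc j)) → ∀ n →
    alternating t (suc (suc n)) ≤ t 0 - (t 1 - t 2)
  alternating-upper t t≥0 dec n = subst (_≤ t 0 - (t 1 - t 2)) (sym (alternating-suc t (suc n)))
    (+-monoʳ-≤ (t 0) (neg-antimono-≤ (alternating-lower (λ j → t (suc j)) (λ j → t≥0 (suc j)) (λ j → dec (suc j)) n)))

  expTerm-decreasing : ∀ {q} → 0ℚ ≤ q → q ≤ 2ℚ → ∀ m → expTerm q (suc (suc m)) ≤ expTerm q (suc m)
  expTerm-decreasing {q} q≥0 q≤2 m = ≤-trans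
    (*-monoʳ (expTerm q (suc m)) (expTerm-≥0 q≥0 (suc m))
      (≤-trans (*-monoʳ (rec (suc m)) (rec-≥0 (suc m)) (≤-trans q≤2 2≤))
        (≤-reflexive (rec-inverse (suc m)))))
    (≤-reflexive (*-identityˡ (expTerm q (suc m))))
    where
    2≤ : 2ℚ ≤ natℚ (suc (suc m))
    2≤ = subst (_≤ natℚ (suc (suc m))) natℚ-2 (natℚ-mono (ℕ.s≤s (ℕ.s≤s ℕ.z≤n)))

  expTerm-decreasing₂ : ∀ {q} → 0ℚ ≤ q → q ≤ 2ℚ → ∀ m → expTerm q (suc (suc (suc m))) ≤ expTerm q (suc m)
  expTerm-decreasing₂ q≥0 q≤2 m = ≤-trans (expTerm-decreasing q≥0 q≤2 (suc m)) (expTerm-decreasing q≥0 q≤2 m)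

  -- sin q ≥ q - q³/6, and q³/6 = (q/3)(q²/2) ≤ (2/3) q because q ≤ 2. Being linear and valid for
  -- all these truncations, the bound carries a positive gap from the argument over to the sine.
  partial-σ-lower : ∀ {q} → 0ℚ ≤ q → q ≤ 2ℚ → ∀ n → ⅓ * q ≤ partial σ (double (suc n)) q
  partial-σ-lower {q} q≥0 q≤2 n = subst (⅓ * q ≤_) (sym (partial-σ-double (suc n) q))
    (≤-trans first (alternating-lower (λ j → expTerm q (suc (double j))) (λ j → expTerm-≥0 q≥0 (suc (double j)))
      (λ j → expTerm-decreasing₂ q≥0 q≤2 (suc (suc (double j)))) n))
    where
    cubic : expTerm q 3 ≤ ⅔ * q
    cubic = ≤-trans (*-mono (expTerm-≥0 q≥0 2) (nonNegative⁻¹ ⅔)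
        (≤-trans (≤-reflexive (cong (q *_) rec-2)) (*-monoʳ ⅓ (nonNegative⁻¹ ⅓) q≤2))
        (≤-trans (expTerm-decreasing q≥0 q≤2 0) (≤-reflexive (expTerm-1 q))))
      ≤-refl
    first : ⅓ * q ≤ expTerm q 1 - expTerm q 3
    first = ≤-trans (≤-reflexive (solve 1 (λ q → con ⅓ :* q := q :- con ⅔ :* q) refl q))
      (+-mono-≤ (≤-reflexive (sym (expTerm-1 q))) (neg-antimono-≤ cubic))

  partial-κ-1 : ∀ n → ½ ≤ partial κ (double (suc n)) 1ℚ
  partial-κ-1 n = subst (½ ≤_) (sym (partial-κ-double (suc n) 1ℚ))
    (≤-trans (≤-reflexive first) (alternating-lower (λ j → expTerm 1ℚ (double j)) (λ j → expTerm-≥0 1≥0 (double j))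
      (λ j → expTerm-decreasing₂ 1≥0 1≤2 (suc (double j))) n))
    where
    1≥0 : 0ℚ ≤ 1ℚ
    1≥0 = nonNegative⁻¹ 1ℚ
    1≤2 : 1ℚ ≤ 2ℚ
    1≤2 = toWitness {a? = 1ℚ ≤? 2ℚ} _
    first : ½ ≡ 1ℚ - expTerm 1ℚ 2
    first rewrite rec-1 | rec-0 = refl

  -- The upper estimate 1 - 2²/2! + 2⁴/4! = 1 - 2 + 2/3 is already negative. Together with
  -- `partial-κ-1` it places a zero of cosine between 1 and 2.
  partial-κ-2 : ∀ n → partial κ (double (suc (suc n))) 2ℚ ≤ - ⅓
  partial-κ-2 n = subst (_≤ - ⅓) (sym (partial-κ-double (suc (suc n)) 2ℚ))
    (≤-trans (alternating-upper (λ j → expTerm 2ℚ (double j)) (λ j → expTerm-≥0 2≥0 (double j))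
      (λ j → expTerm-decreasing₂ 2≥0 ≤-refl (suc (double j))) n) (≤-reflexive value))
    where
    2≥0 : 0ℚ ≤ 2ℚ
    2≥0 = nonNegative⁻¹ 2ℚ
    value : 1ℚ - (expTerm 2ℚ 2 - expTerm 2ℚ 4) ≡ - ⅓
    value rewrite rec-3 | rec-2 | rec-1 | rec-0 = refl

  partial-κ-0 : ∀ n → partial κ (suc n) 0ℚ ≡ 1ℚ
  partial-κ-0 n = trans (∑-head n _) (trans (cong (1ℚ +_) zeros) (+-identityʳ 1ℚ))
    where
    zeros : ∑ n (λ i → κ (suc i) * expTerm 0ℚ (suc i)) ≡ 0ℚ
    zeros = trans (∑-cong n (λ i _ → solve 3 (λ k r e → k :* (con 0ℚ :* r :* e) := con 0ℚ :* k) refl (κ (suc i)) (rec i) (expTerm 0ℚ i)))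
      (trans (∑-*ˡ n 0ℚ (λ i → κ (suc i))) (*-zeroˡ (∑ n (λ i → κ (suc i)))))

open TrigonometricSeries

-- Real arithmetic, and cosine and sine of a real.

module Reals where
  open import Defs
  open import Data.Rational.Base using (∣_∣)

  infix 4 _≈_

  -- A wrapper around _≃_ from whose type both sides can be inferred.
  record _≈_ (x y : ℝ) : Set where
    constructor wrap
    field unwrap : x ≃ y

  open _≈_ public

  eventually≈ : ∀ {x y} N → (∀ n → N ℕ.≤ n → seq x n ≡ seq y n) → x ≈ y
  eventually≈ {x} {y} N e = wrap λ ε ε>0 → N , λ n n≥ →
    subst (λ t → ∣ t ℚ.- seq y n ∣ ℚ.< ε) (sym (e n n≥))
      (subst (ℚ._< ε) (sym (cong ∣_∣ (ℚ.+-inverseʳ (seq y n)))) ε>0)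

  pointwise : ∀ {x y} → (∀ n → seq x n ≡ seq y n) → x ≈ y
  pointwise e = eventually≈ 0 (λ n _ → e n)

  ≈-refl : ∀ {x} → x ≈ x
  ≈-refl = pointwise (λ _ → refl)

  ≈-sym : ∀ {x y} → x ≈ y → y ≈ x
  ≈-sym {x} {y} (wrap e) = wrap (Null-dominated {g = λ n → seq x n ℚ.- seq y n} 0
    (λ n _ → ℚ.≤-reflexive (∣p-q∣≡∣q-p∣ (seq y n) (seq x n))) e)

  ≈-trans : ∀ {x y z} → x ≈ y → y ≈ z → x ≈ z
  ≈-trans {x} {y} {z} (wrap e) (wrap f) = wrap (Null-cong
    (λ n → solve 3 (λ x y z → x :- z := (x :- y) :+ (y :- z)) refl (seq x n) (seq y n) (seq z n))
    (Null-+ {λ n → seq x n ℚ.- seq y n} {λ n → seq y n ℚ.- seq z n} e f))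

  ≈-setoid : Setoid _ _
  ≈-setoid = record
    { Carrier = ℝ ; _≈_ = _≈_
    ; isEquivalence = record { refl = ≈-refl ; sym = ≈-sym ; trans = ≈-trans } }

  ∣∣-near : ∀ {p q a} → ∣ p ℚ.- q ∣ ℚ.≤ a → ∣ p ∣ ℚ.≤ a ℚ.+ ∣ q ∣
  ∣∣-near {p} {q} {a} h = ℚ.≤-trans (ℚ.≤-reflexive (cong ∣_∣ (solve 2 (λ p q → p := (p :- q) :+ q) refl p q)))
    (ℚ.≤-trans (ℚ.∣p+q∣≤∣p∣+∣q∣ (p ℚ.- q) q) (ℚ.+-monoˡ-≤ ∣ q ∣ h))

  record EventuallyBounded (f : ℕ → ℚ) : Set where
    field
      bound   : ℚ
      bound≥0 : 0ℚ ℚ.≤ bound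
      from    : ℕ
      bounded : ∀ n → from ℕ.≤ n → ∣ f n ∣ ℚ.≤ bound

  opaque
    eventuallyBounded : ∀ x → EventuallyBounded (seq x)
    eventuallyBounded x =
      let N , close = cauchy x 1ℚ (ℚ.positive⁻¹ 1ℚ) in record
      { bound   = 1ℚ ℚ.+ ∣ seq x N ∣
      ; bound≥0 = 0≤+ (ℚ.nonNegative⁻¹ 1ℚ) (ℚ.0≤∣p∣ (seq x N))
      ; from    = N
      ; bounded = λ n n≥ → ∣∣-near (ℚ.<⇒≤ (close n N n≥ ℕ.≤-refl)) }

  +-cong : ∀ {x x′ y y′} → x ≈ x′ → y ≈ y′ → x + y ≈ x′ + y′
  +-cong {x} {x′} {y} {y′} (wrap e) (wrap f) = wrap (Null-cong
    (λ n → solve 4 (λ x x′ y y′ → (x :+ y) :- (x′ :+ y′) := (x :- x′) :+ (y :- y′)) refl (seq x n) (seq x′ n) (seq y n) (seq y′ n))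
    (Null-+ {λ n → seq x n ℚ.- seq x′ n} {λ n → seq y n ℚ.- seq y′ n} e f))

  neg-cong : ∀ {x x′} → x ≈ x′ → - x ≈ - x′
  neg-cong {x} {x′} (wrap e) = wrap (Null-cong
    (λ n → solve 2 (λ x x′ → (:- x) :- (:- x′) := :- (x :- x′)) refl (seq x n) (seq x′ n))
    (Null-neg {λ n → seq x n ℚ.- seq x′ n} e))

  sub-cong : ∀ {x x′ y y′} → x ≈ x′ → y ≈ y′ → x - y ≈ x′ - y′
  sub-cong e f = +-cong e (neg-cong f)

  *-congˡ : ∀ x {y y′} → y ≈ y′ → x * y ≈ x * y′
  *-congˡ x {y} {y′} (wrap e) = wrap (Null-cong
    (λ n → solve 3 (λ x y y′ → x :* y :- x :* y′ := x :* (y :- y′)) refl (seq x n) (seq y n) (seq y′ n))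
    (Null-* {seq x} {λ n → seq y n ℚ.- seq y′ n} bound from bound≥0 bounded e))
    where open EventuallyBounded (eventuallyBounded x)

  *-comm : ∀ x y → x * y ≈ y * x
  *-comm x y = pointwise (λ n → ℚ.*-comm (seq x n) (seq y n))

  *-cong : ∀ {x x′ y y′} → x ≈ x′ → y ≈ y′ → x * y ≈ x′ * y′
  *-cong {x} {x′} {y} {y′} e f = ≈-trans (*-congˡ x f)
    (≈-trans (*-comm x y′) (≈-trans (*-congˡ y′ e) (*-comm y′ x′)))

  -- Strict order as a predicate of one real: `x < y` is interchangeable with `Pos (y - x)`, and
  -- `Pos` is closed under sums and products.
  record Pos (x : ℝ) : Set where
    constructor pos
    field
      gap   : ℚ
      gap>0 : 0ℚ ℚ.< gap
      from  : ℕ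
      above : ∀ n → from ℕ.≤ n → gap ℚ.< seq x n

  <⇒Pos : ∀ {x y} → x < y → Pos (y - x)
  <⇒Pos {x} {y} (ε , ε>0 , N , h) = pos ε ε>0 N λ n n≥ →
    subst (ℚ._< seq y n ℚ.- seq x n) (solve 2 (λ x e → (x :+ e) :- x := e) refl (seq x n) ε)
      (ℚ.+-monoˡ-< (ℚ.- seq x n) (h n n≥))

  Pos⇒< : ∀ {x y} → Pos (y - x) → x < y
  Pos⇒< {x} {y} (pos ε ε>0 N h) = ε , ε>0 , N , λ n n≥ →
    subst (seq x n ℚ.+ ε ℚ.<_) (solve 2 (λ x y → x :+ (y :- x) := y) refl (seq x n) (seq y n))
      (ℚ.+-monoʳ-< (seq x n) (h n n≥))

  Pos-resp : ∀ {x y} → x ≈ y → Pos x → Pos y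
  Pos-resp {x} {y} (wrap e) (pos ε ε>0 N h) = pos (½ ℚ.* ε) (½ε>0 ε>0) (N ℕ.⊔ proj₁ close) λ n n≥ →
    subst₂ ℚ._<_ (trans (cong (ℚ._- ½ ℚ.* ε) (sym (½+½ ε))) (solve 1 (λ e → (e :+ e) :- e := e) refl (½ ℚ.* ε)))
      (solve 2 (λ x y → x :- (x :- y) := y) refl (seq x n) (seq y n))
      (ℚ.+-mono-<-≤ (h n (⊔≤ˡ n≥)) (ℚ.neg-antimono-≤ (ℚ.≤-trans (p≤∣p∣ (seq x n ℚ.- seq y n)) (ℚ.<⇒≤ (proj₂ close n (⊔≤ʳ N n≥))))))
    where
    close : ∃[ N ] ∀ n → N ℕ.≤ n → ∣ seq x n ℚ.- seq y n ∣ ℚ.< ½ ℚ.* ε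
    close = e (½ ℚ.* ε) (½ε>0 ε>0)

  Pos-+ : ∀ {x y} → Pos x → Pos y → Pos (x + y)
  Pos-+ (pos ε ε>0 N h) (pos δ δ>0 M k) = pos (ε ℚ.+ δ) (ℚ.+-mono-< ε>0 δ>0) (N ℕ.⊔ M)
    λ n n≥ → ℚ.+-mono-< (h n (⊔≤ˡ n≥)) (k n (⊔≤ʳ N n≥))

  Pos-* : ∀ {x y} → Pos x → Pos y → Pos (x * y)
  Pos-* {x} {y} (pos ε ε>0 N h) (pos δ δ>0 M k) = pos (ε ℚ.* δ) (0<* ε>0 δ>0) (N ℕ.⊔ M)
    λ n n≥ → ℚ.<-trans (ℚ.*-monoʳ-<-pos ε {{ℚ.positive ε>0}} (k n (⊔≤ʳ N n≥)))
      (ℚ.*-monoˡ-<-pos (seq y n) {{ℚ.positive (ℚ.<-trans δ>0 (k n (⊔≤ʳ N n≥)))}} (h n (⊔≤ˡ n≥)))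

  Pos-fromℚ : ∀ {q} → 0ℚ ℚ.< q → Pos (fromℚ q)
  Pos-fromℚ {q} q>0 = pos (½ ℚ.* q) (½ε>0 q>0) 0 (λ _ _ → ½ε<ε q>0)

  Pos-≉0 : ∀ {x} → Pos x → ¬ x ≈ 0ℝ
  Pos-≉0 p x≈0 = contra (Pos-resp x≈0 p)
    where
    contra : ¬ Pos 0ℝ
    contra (pos ε ε>0 N h) = ℚ.<-asym ε>0 (h N ℕ.≤-refl)

  Pos-asym : ∀ {x} → Pos x → ¬ Pos (- x)
  Pos-asym {x} p q = Pos-≉0 (Pos-+ p q) (pointwise (λ n → ℚ.+-inverseʳ (seq x n)))

  Pos⇒≥0 : ∀ {x} → Pos x → 0ℝ ≤ x
  Pos⇒≥0 {x} p x<0 = Pos-asym p (Pos-resp (pointwise (λ n → ℚ.+-identityˡ (ℚ.- seq x n))) (<⇒Pos {x} {0ℝ} x<0))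

  Null-scaled : ∀ {f g : ℕ → ℚ} {L} N₀ → 0ℚ ℚ.≤ L → (∀ n → N₀ ℕ.≤ n → ∣ f n ∣ ℚ.≤ L ℚ.* ∣ g n ∣) → Null g → Null f
  Null-scaled {f} {g} {L} N₀ L≥0 h g→0 ε ε>0 =
    let δ , δ>0 , small = small-factor L≥0 ε>0
        N , k = g→0 δ δ>0
    in N₀ ℕ.⊔ N , λ n n≥ → ℚ.≤-<-trans (h n (⊔≤ˡ n≥)) (small (ℚ.0≤∣p∣ (g n)) (k n (⊔≤ʳ N₀ n≥)))

  -- From some index on s exceeds its gap ε, so ∣t∣ ≤ ∣s t∣ / ε there; this takes the place of
  -- dividing by s.
  Pos-cancel : ∀ {s t} → Pos s → s * t ≈ 0ℝ → t ≈ 0ℝ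
  Pos-cancel {s} {t} (pos ε ε>0 N h) (wrap st≈0) =
    let δ , δ>0 , εδ≡1 = quotient ε>0 (ℚ.positive⁻¹ 1ℚ)
    in wrap (Null-scaled {g = λ n → seq s n ℚ.* seq t n ℚ.- 0ℚ} N (ℚ.<⇒≤ δ>0) (bound (ℚ.<⇒≤ δ>0) εδ≡1) st≈0)
    where
    bound : ∀ {δ} → 0ℚ ℚ.≤ δ → ε ℚ.* δ ≡ 1ℚ → ∀ n → N ℕ.≤ n → ∣ seq t n ℚ.- 0ℚ ∣ ℚ.≤ δ ℚ.* ∣ seq s n ℚ.* seq t n ℚ.- 0ℚ ∣
    bound {δ} δ≥0 εδ≡1 n n≥ = subst₂ (λ a b → ∣ a ∣ ℚ.≤ δ ℚ.* ∣ b ∣) (sym (ℚ.+-identityʳ T)) (sym (ℚ.+-identityʳ (S ℚ.* T)))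
      (ℚ.≤-trans (ℚ.≤-reflexive (trans (sym (ℚ.*-identityˡ ∣ T ∣)) (trans (cong (ℚ._* ∣ T ∣) (trans (sym εδ≡1) (ℚ.*-comm ε δ))) (ℚ.*-assoc δ ε ∣ T ∣))))
      (*-monoˡ δ δ≥0 (ℚ.≤-trans (*-monoʳ ∣ T ∣ (ℚ.0≤∣p∣ T) (ℚ.≤-trans (ℚ.<⇒≤ (h n n≥)) (p≤∣p∣ S)))
        (ℚ.≤-reflexive (sym (ℚ.∣p*q∣≡∣p∣*∣q∣ S T))))))
      where
      S = seq s n
      T = seq t n

  -- One constant for all truncations, as the truncation changes with the index of the sequence.
  record LipschitzOn (B : ℚ) : Set where
    field
      const     : ℚ
      const≥0   : 0ℚ ℚ.≤ const
      lipschitz : ∀ {w p q} → Bounded₁ w → ∣ p ∣ ℚ.≤ B → ∣ q ∣ ℚ.≤ B → ∀ N →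
                  ∣ partial w N p ℚ.- partial w N q ∣ ℚ.≤ const ℚ.* ∣ p ℚ.- q ∣

  opaque
    lipschitzOn : ∀ {B} → 0ℚ ℚ.≤ B → LipschitzOn B
    lipschitzOn B≥0 =
      let L , h = expSum-bounded B≥0 in record
      { const     = L
      ; const≥0   = h 0
      ; lipschitz = λ {w} {p} {q} wb p≤ q≤ N →
          ℚ.≤-trans (partial-lipschitz {w} wb p≤ q≤ N) (ℚ.≤-trans (*-monoˡ ∣ p ℚ.- q ∣ (ℚ.0≤∣p∣ _) (h N))
            (ℚ.≤-reflexive (ℚ.*-comm ∣ p ℚ.- q ∣ L))) }

  opaque
    -- Passing from index m to n changes truncation and argument at once. The intermediate value has
    -- the truncation of n and the argument of m, so that the first step is a tail and the second is
    -- Lipschitz.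
    series-cauchy : ∀ {w} → Bounded₁ w → ∀ x → IsCauchy (λ n → partial w (double n) (seq x n))
    series-cauchy {w} wb x ε ε>0 =
      let open EventuallyBounded (eventuallyBounded x)
          open LipschitzOn (lipschitzOn bound≥0)
          N₁ , tails       = partial-cauchy bound≥0 (½ ℚ.* ε) (½ε>0 ε>0)
          δ , δ>0 , small  = small-factor const≥0 (½ε>0 ε>0)
          N₂ , close       = cauchy x δ δ>0
      in from ℕ.⊔ (N₁ ℕ.⊔ N₂) , λ m n m≥ n≥ →
        ℚ.≤-<-trans
          (∣-∣-triangle (partial w (double m) (seq x m)) (partial w (double n) (seq x m)) (partial w (double n) (seq x n)))
          (subst (∣ partial w (double m) (seq x m) ℚ.- partial w (double n) (seq x m) ∣ ℚ.+
                  ∣ partial w (double n) (seq x m) ℚ.- partial w (double n) (seq x n) ∣ ℚ.<_) (½+½ ε) (ℚ.+-mono-<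
            (tails {w} wb (bounded m (⊔≤ˡ m≥)) (double m) (double n)
              (ℕ.≤-trans (⊔≤ˡ (⊔≤ʳ from m≥)) (n≤double m)) (ℕ.≤-trans (⊔≤ˡ (⊔≤ʳ from n≥)) (n≤double n)))
            (ℚ.≤-<-trans (lipschitz {w} wb (bounded m (⊔≤ˡ m≥)) (bounded n (⊔≤ˡ n≥)) (double n))
              (small (ℚ.0≤∣p∣ (seq x m ℚ.- seq x n)) (close m n (⊔≤ʳ N₁ (⊔≤ʳ from m≥)) (⊔≤ʳ N₁ (⊔≤ʳ from n≥)))))))

  series : ∀ w → Bounded₁ w → ℝ → ℝ
  series w wb x = mkℝ (λ n → partial w (double n) (seq x n)) (series-cauchy wb x)

  series-cong : ∀ {w} (wb : Bounded₁ w) {x y} → x ≈ y → series w wb x ≈ series w wb y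
  series-cong {w} wb {x} {y} (wrap e) =
    let module X = EventuallyBounded (eventuallyBounded x)
        module Y = EventuallyBounded (eventuallyBounded y)
        module L = LipschitzOn (lipschitzOn (0≤+ X.bound≥0 Y.bound≥0))
    in wrap (Null-scaled {g = λ n → seq x n ℚ.- seq y n} (X.from ℕ.⊔ Y.from) L.const≥0
      (λ n n≥ → L.lipschitz {w} wb
        (ℚ.≤-trans (X.bounded n (⊔≤ˡ n≥)) (≤-by Y.bound Y.bound≥0 refl))
        (ℚ.≤-trans (Y.bounded n (⊔≤ʳ X.from n≥)) (≤-by X.bound X.bound≥0 (ℚ.+-comm X.bound Y.bound)))
        (double n)) e)

  series-+ : ∀ {w} (wb : Bounded₁ w) x y →
    Null (λ n → square (double n) (λ a b → w (a ℕ.+ b) ℚ.* (expTerm (seq x n) a ℚ.* expTerm (seq y n) b))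
                  ℚ.- partial w (double n) (seq x n ℚ.+ seq y n))
  series-+ {w} wb x y ε ε>0 =
    let module X = EventuallyBounded (eventuallyBounded x)
        module Y = EventuallyBounded (eventuallyBounded y)
        K , tail = expTail-Null (0≤+ X.bound≥0 Y.bound≥0) ε ε>0
    in X.from ℕ.⊔ (Y.from ℕ.⊔ K) , λ n n≥ → ℚ.≤-<-trans
      (partial-+ {w} wb (X.bounded n (⊔≤ˡ n≥)) (Y.bounded n (⊔≤ˡ (⊔≤ʳ X.from n≥))) (double n))
      (tail (double n) (double n) (ℕ.≤-trans (⊔≤ʳ Y.from (⊔≤ʳ X.from n≥)) (n≤double n)))

  cos sin : ℝ → ℝ
  cos = series κ κ-bounded
  sin = series σ σ-bounded

  cos-cong : ∀ {x y} → x ≈ y → cos x ≈ cos y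
  cos-cong = series-cong κ-bounded

  sin-cong : ∀ {x y} → x ≈ y → sin x ≈ sin y
  sin-cong = series-cong σ-bounded

  cos-+ : ∀ x y → cos (x + y) ≈ cos x * cos y - sin x * sin y
  cos-+ x y = ≈-sym (wrap (Null-cong
    (λ n → cong (ℚ._- partial κ (double n) (seq x n ℚ.+ seq y n)) (sym (square-κ (double n) (seq x n) (seq y n))))
    (series-+ κ-bounded x y)))

  sin-+ : ∀ x y → sin (x + y) ≈ sin x * cos y + cos x * sin y
  sin-+ x y = ≈-sym (wrap (Null-cong
    (λ n → cong (ℚ._- partial σ (double n) (seq x n ℚ.+ seq y n)) (sym (square-σ (double n) (seq x n) (seq y n))))
    (series-+ σ-bounded x y)))

  cos-neg : ∀ x → cos (- x) ≈ cos x
  cos-neg x = pointwise (λ n → partial-κ-neg (double n) (seq x n))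

  sin-neg : ∀ x → sin (- x) ≈ - sin x
  sin-neg x = pointwise (λ n → partial-σ-neg (double n) (seq x n))

  cos-0 : cos 0ℝ ≈ 1ℝ
  -- At index 0 the truncation is the empty sum, which is 0 instead of 1.
  cos-0 = eventually≈ 1 λ { (suc n) _ → partial-κ-0 (suc (double n)) }

  seq-^ : ∀ x m n → seq (x ^ m) n ≡ pow (seq x n) m
  seq-^ x zero n = refl
  seq-^ x (suc m) n = cong (seq x n ℚ.*_) (seq-^ x m n)

  seq-cosTerm : ∀ x M n → seq (partialSum (cosTerm x) M) n ≡ partial κ (double M) (seq x n)
  seq-cosTerm x M n = trans (go M) (sym (partial-κ-double M (seq x n)))
    where
    go : ∀ M → seq (partialSum (cosTerm x) M) n ≡ alternating (λ j → expTerm (seq x n) (double j)) M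
    go zero = refl
    go (suc M) = cong₂ ℚ._+_ (go M) (trans (cong (Defs.coefficient M (2 ℕ.* M) ℚ.*_) (seq-^ x (2 ℕ.* M) n))
      (trans (coefficient-pow (seq x n) M (2 ℕ.* M)) (cong (λ t → κ (double M) ℚ.* expTerm (seq x n) t) (double≡2* M))))

  seq-sinTerm : ∀ x M n → seq (partialSum (sinTerm x) M) n ≡ partial σ (double M) (seq x n)
  seq-sinTerm x M n = trans (go M) (sym (partial-σ-double M (seq x n)))
    where
    go : ∀ M → seq (partialSum (sinTerm x) M) n ≡ alternating (λ j → expTerm (seq x n) (suc (double j))) M
    go zero = refl
    go (suc M) = cong₂ ℚ._+_ (go M) (trans (cong (Defs.coefficient M (suc (2 ℕ.* M)) ℚ.*_) (seq-^ x (suc (2 ℕ.* M)) n))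
      (trans (coefficient-pow (seq x n) M (suc (2 ℕ.* M))) (cong (λ t → κ (double M) ℚ.* expTerm (seq x n) (suc t)) (double≡2* M))))

  -- At index n the partial sum and the diagonal have the same argument `seq x n` and differ only in
  -- truncation, so the uniform Cauchy estimate suffices.
  partialSums⟶series : ∀ {w} (wb : Bounded₁ w) x (t : ℕ → ℝ) →
    (∀ M n → seq (partialSum t M) n ≡ partial w (double M) (seq x n)) → partialSum t ⟶ series w wb x
  partialSums⟶series {w} wb x t e ε ε>0 =
    let open EventuallyBounded (eventuallyBounded x)
        N₁ , tails = partial-cauchy bound≥0 (½ ℚ.* ε) (½ε>0 ε>0)
        near : ∀ M n → N₁ ℕ.≤ M → from ℕ.⊔ N₁ ℕ.≤ n → ∣ seq (partialSum t M) n ℚ.- partial w (double n) (seq x n) ∣ ℚ.< ½ ℚ.* ε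
        near M n M≥ n≥ = subst (λ z → ∣ z ℚ.- partial w (double n) (seq x n) ∣ ℚ.< ½ ℚ.* ε) (sym (e M n))
          (tails {w} wb (bounded n (⊔≤ˡ n≥)) (double M) (double n)
            (ℕ.≤-trans M≥ (n≤double M)) (ℕ.≤-trans (⊔≤ʳ from n≥) (n≤double n)))
    in N₁ , λ M M≥ →
      -- Half of ε bounds the error; the other half is the gap that `_<_` demands.
      (½ ℚ.* ε , ½ε>0 ε>0 , from ℕ.⊔ N₁ , λ n n≥ → below (p≤∣p∣ _) (near M n M≥ n≥)) ,
      (½ ℚ.* ε , ½ε>0 ε>0 , from ℕ.⊔ N₁ , λ n n≥ → below
        (ℚ.≤-trans (p≤∣p∣ _) (ℚ.≤-reflexive (∣p-q∣≡∣q-p∣ (partial w (double n) (seq x n)) (seq (partialSum t M) n))))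
        (near M n M≥ n≥))
    where
    below : ∀ {p q} → p ℚ.≤ q → q ℚ.< ½ ℚ.* ε → p ℚ.+ ½ ℚ.* ε ℚ.< ε
    below {p} p≤q q< = subst (p ℚ.+ ½ ℚ.* ε ℚ.<_) (½+½ ε) (ℚ.+-monoˡ-< (½ ℚ.* ε) (ℚ.≤-<-trans p≤q q<))

  cos-IsCos : ∀ x → IsCos x (cos x)
  cos-IsCos x = partialSums⟶series κ-bounded x (cosTerm x) (seq-cosTerm x)

  sin-IsSin : ∀ x → IsSin x (sin x)
  sin-IsSin x = partialSums⟶series σ-bounded x (sinTerm x) (seq-sinTerm x)

open Reals

-- Trigonometric identities, the zero π/2 of cosine, and π.

module Pi where
  open import Defs
  open import Data.Rational.Base using (∣_∣)
  import Relation.Binary.Reasoning.Setoid ≈-setoid as ≈-Reasoning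

  2ℝ : ℝ
  2ℝ = fromℚ 2ℚ

  -- The addition theorem for cos (x - x).
  cos²+sin² : ∀ x → cos x * cos x + sin x * sin x ≈ 1ℝ
  cos²+sin² x = begin
    cos x * cos x + sin x * sin x
      ≈⟨ pointwise (λ n → solve 2 (λ c s → c :* c :+ s :* s := c :* c :- s :* (:- s)) refl (seq (cos x) n) (seq (sin x) n)) ⟩
    cos x * cos x - sin x * - sin x
      ≈⟨ sub-cong (*-congˡ (cos x) (≈-sym (cos-neg x))) (*-congˡ (sin x) (≈-sym (sin-neg x))) ⟩
    cos x * cos (- x) - sin x * sin (- x)
      ≈⟨ ≈-sym (cos-+ x (- x)) ⟩
    cos (x - x)
      ≈⟨ cos-cong (pointwise (λ n → ℚ.+-inverseʳ (seq x n))) ⟩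
    cos 0ℝ
      ≈⟨ cos-0 ⟩
    1ℝ ∎
    where open ≈-Reasoning

  cos-sub : ∀ x y → cos (x - y) ≈ cos x * cos y + sin x * sin y
  cos-sub x y = begin
    cos (x - y)
      ≈⟨ cos-+ x (- y) ⟩
    cos x * cos (- y) - sin x * sin (- y)
      ≈⟨ sub-cong (*-congˡ (cos x) (cos-neg y)) (*-congˡ (sin x) (sin-neg y)) ⟩
    cos x * cos y - sin x * - sin y
      ≈⟨ pointwise (λ n → solve 4 (λ a b c d → a :* b :- c :* (:- d) := a :* b :+ c :* d) refl
           (seq (cos x) n) (seq (cos y) n) (seq (sin x) n) (seq (sin y) n)) ⟩
    cos x * cos y + sin x * sin y ∎
    where open ≈-Reasoning

  sin-sub : ∀ x y → sin (x - y) ≈ sin x * cos y - cos x * sin y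
  sin-sub x y = begin
    sin (x - y)
      ≈⟨ sin-+ x (- y) ⟩
    sin x * cos (- y) + cos x * sin (- y)
      ≈⟨ +-cong (*-congˡ (sin x) (cos-neg y)) (*-congˡ (cos x) (sin-neg y)) ⟩
    sin x * cos y + cos x * - sin y
      ≈⟨ pointwise (λ n → solve 4 (λ a b c d → a :* b :+ c :* (:- d) := a :* b :- c :* d) refl
           (seq (sin x) n) (seq (cos y) n) (seq (cos x) n) (seq (sin y) n)) ⟩
    sin x * cos y - cos x * sin y ∎
    where open ≈-Reasoning

  cos-difference : ∀ u v → cos (u - v) - cos (u + v) ≈ 2ℝ * (sin u * sin v)
  cos-difference u v = ≈-trans (sub-cong (cos-sub u v) (cos-+ u v))
    (pointwise (λ n → solve 2 (λ a b → (a :+ b) :- (a :- b) := con 2ℚ :* b) refl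
      (seq (cos u) n ℚ.* seq (cos v) n) (seq (sin u) n ℚ.* seq (sin v) n)))

  -- Stronger than `x ≤ 2ℝ`, which would let the sequence approach 2 from above; `partial-σ-lower`
  -- needs the rationals themselves to be at most 2.
  EventuallyBelow2 : ℝ → Set
  EventuallyBelow2 x = ∃[ N ] ∀ n → N ℕ.≤ n → seq x n ℚ.≤ 2ℚ

  sin-pos : ∀ {x} → Pos x → EventuallyBelow2 x → Pos (sin x)
  sin-pos {x} (pos ε ε>0 N h) (M , k) = pos (⅓ ℚ.* ε) (0<* (ℚ.positive⁻¹ ⅓) ε>0) (suc (N ℕ.⊔ M)) above
    where
    above : ∀ n → suc (N ℕ.⊔ M) ℕ.≤ n → ⅓ ℚ.* ε ℚ.< seq (sin x) n
    above (suc n) (ℕ.s≤s n≥) = ℚ.<-≤-trans (ℚ.*-monoʳ-<-pos ⅓ ε<)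
      (partial-σ-lower (ℚ.<⇒≤ (ℚ.<-trans ε>0 ε<)) (k (suc n) (ℕ.m≤n⇒m≤1+n (⊔≤ʳ N n≥))) n)
      where
      ε< : ε ℚ.< seq x (suc n)
      ε< = h (suc n) (ℕ.m≤n⇒m≤1+n (⊔≤ˡ n≥))

  -- cos p - cos q = 2 sin ((p + q)/2) sin ((q - p)/2), and both half-angles lie in (0, 2].
  cos-decreasing : ∀ {p q} → 0ℚ ℚ.≤ p → p ℚ.< q → q ℚ.≤ 2ℚ → Pos (cos (fromℚ p) - cos (fromℚ q))
  cos-decreasing {p} {q} p≥0 p<q q≤2 = Pos-resp
    (≈-trans (≈-sym (cos-difference (fromℚ u) (fromℚ v)))
      (sub-cong (cos-cong (pointwise (λ _ → solve 2 (λ p q → con ½ :* (p :+ q) :- con ½ :* (q :- p) := p) refl p q)))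
              (cos-cong (pointwise (λ _ → solve 2 (λ p q → con ½ :* (p :+ q) :+ con ½ :* (q :- p) := q) refl p q)))))
    (Pos-* (Pos-fromℚ (ℚ.positive⁻¹ 2ℚ)) (Pos-*
      (sin-pos (Pos-fromℚ u>0) (0 , λ _ _ → u≤2))
      (sin-pos (Pos-fromℚ v>0) (0 , λ _ _ → v≤2))))
    where
    u = ½ ℚ.* (p ℚ.+ q)
    v = ½ ℚ.* (q ℚ.- p)
    v>0 : 0ℚ ℚ.< v
    v>0 = ½ε>0 (<⇒0<- p<q)
    u>0 : 0ℚ ℚ.< u
    u>0 = ½ε>0 (ℚ.+-mono-≤-< p≥0 (ℚ.≤-<-trans p≥0 p<q))
    u≤2 : u ℚ.≤ 2ℚ
    u≤2 = *-monoˡ ½ (ℚ.nonNegative⁻¹ ½) (ℚ.+-mono-≤ (ℚ.≤-trans (ℚ.<⇒≤ p<q) q≤2) q≤2)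
    v≤2 : v ℚ.≤ 2ℚ
    v≤2 = ℚ.≤-trans (≤-by p p≥0 (solve 2 (λ p q → con ½ :* (p :+ q) := con ½ :* (q :- p) :+ p) refl p q)) u≤2

  -- A comparison of rationals at one late index M decides: either x ≥ ε/2 there, or y < - ε/2
  -- because x - y > ε. The Cauchy property with tolerance ε/4 keeps a gap of ε/4 at all later
  -- indices.
  Pos-split : ∀ {x y} → Pos (x - y) → Pos x ⊎ Pos (- y)
  Pos-split {x} {y} (pos ε ε>0 N h) = decide (proj₁ cx) (proj₂ cx) (proj₁ cy) (proj₂ cy)
    where
    δ = ½ ℚ.* (½ ℚ.* ε)
    δ>0 : 0ℚ ℚ.< δ
    δ>0 = ½ε>0 (½ε>0 ε>0)
    cx : ∃[ N ] ∀ m n → N ℕ.≤ m → N ℕ.≤ n → ∣ seq x m ℚ.- seq x n ∣ ℚ.< δ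
    cx = cauchy x δ δ>0
    cy : ∃[ N ] ∀ m n → N ℕ.≤ m → N ℕ.≤ n → ∣ seq y m ℚ.- seq y n ∣ ℚ.< δ
    cy = cauchy y δ δ>0
    ½ε-δ : ½ ℚ.* ε ℚ.- δ ≡ δ
    ½ε-δ = solve 1 (λ e → con ½ :* e :- con ½ :* (con ½ :* e) := con ½ :* (con ½ :* e)) refl ε
    near : ∀ {p q} → ½ ℚ.* ε ℚ.≤ p → ∣ p ℚ.- q ∣ ℚ.< δ → δ ℚ.< q
    near {p} {q} ½ε≤p pq<δ = subst₂ ℚ._<_ ½ε-δ (solve 2 (λ p q → p :- (p :- q) := q) refl p q)
      (ℚ.+-mono-≤-< ½ε≤p (ℚ.neg-antimono-< (ℚ.≤-<-trans (p≤∣p∣ (p ℚ.- q)) pq<δ)))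
    decide : ∀ A → (∀ m n → A ℕ.≤ m → A ℕ.≤ n → ∣ seq x m ℚ.- seq x n ∣ ℚ.< δ) →
             ∀ B → (∀ m n → B ℕ.≤ m → B ℕ.≤ n → ∣ seq y m ℚ.- seq y n ∣ ℚ.< δ) → Pos x ⊎ Pos (- y)
    decide A hx B hy with ½ ℚ.* ε ℚ.≤? seq x (N ℕ.⊔ (A ℕ.⊔ B))
    ... | yes ½ε≤x = inj₁ (pos δ δ>0 A λ n n≥ → near ½ε≤x (hx (N ℕ.⊔ (A ℕ.⊔ B)) n (⊔≤ˡ (⊔≤ʳ N ℕ.≤-refl)) n≥))
    ... | no  ½ε≰x = inj₂ (pos δ δ>0 B λ n n≥ → near ½ε≤-y
            (subst (ℚ._< δ) (trans (∣p-q∣≡∣q-p∣ (seq y M) (seq y n)) (cong ∣_∣ (solve 2 (λ p q → q :- p := (:- p) :- (:- q)) refl (seq y M) (seq y n))))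
              (hy M n (⊔≤ʳ A (⊔≤ʳ N ℕ.≤-refl)) n≥)))
      where
      M = N ℕ.⊔ (A ℕ.⊔ B)
      ½ε≤-y : ½ ℚ.* ε ℚ.≤ ℚ.- seq y M
      ½ε≤-y = ℚ.<⇒≤ (subst₂ ℚ._<_ (solve 1 (λ e → e :- con ½ :* e := con ½ :* e) refl ε)
        (solve 2 (λ x y → (x :- y) :- x := :- y) refl (seq x M) (seq y M))
        (ℚ.+-mono-< (h M (⊔≤ˡ ℕ.≤-refl)) (ℚ.neg-antimono-< (ℚ.≰⇒> ½ε≰x))))

  -- The sign of a real is undecidable, but Pos-split finds the sign of cosine at
  -- one of two points where its values differ: hence trisection, not bisection.
  record Bracket : Set where
    field
      lo hi  : ℚ
      1≤lo   : 1ℚ ℚ.≤ lo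
      lo<hi  : lo ℚ.< hi
      hi≤2   : hi ℚ.≤ 2ℚ
      cos-lo : Pos (cos (fromℚ lo))
      cos-hi : Pos (- cos (fromℚ hi))

    width : ℚ
    width = hi ℚ.- lo

  open Bracket

  infix 4 _⊑_

  record _⊑_ (C B : Bracket) : Set where
    constructor _,_
    field
      lo≤ : lo B ℚ.≤ lo C
      hi≤ : hi C ℚ.≤ hi B

  ⊑-refl : ∀ {B} → B ⊑ B
  ⊑-refl = ℚ.≤-refl , ℚ.≤-refl

  ⊑-trans : ∀ {B C D} → B ⊑ C → C ⊑ D → B ⊑ D
  ⊑-trans (a , b) (c , d) = ℚ.≤-trans c a , ℚ.≤-trans b d

  record Refinement (B : Bracket) : Set where
    field
      refined  : Bracket
      refined⊑ : refined ⊑ B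
      shrunk   : width refined ≡ ⅔ ℚ.* width B

  open Refinement

  1≤2 : 1ℚ ℚ.≤ 2ℚ
  1≤2 = toWitness {a? = 1ℚ ℚ.≤? 2ℚ} _

  1<2 : 1ℚ ℚ.< 2ℚ
  1<2 = toWitness {a? = 1ℚ ℚ.<? 2ℚ} _

  0≤1 : 0ℚ ℚ.≤ 1ℚ
  0≤1 = ℚ.nonNegative⁻¹ 1ℚ

  initial : Bracket
  initial = record
    { lo = 1ℚ ; hi = 2ℚ ; 1≤lo = ℚ.≤-refl ; lo<hi = 1<2 ; hi≤2 = ℚ.≤-refl
    -- The gaps must lie strictly below the bounds 1/2 and 1/3. These hold once the truncation
    -- contains one term of cosine at 1 and two at 2, hence the starting indices.
    ; cos-lo = pos ⅓ (ℚ.positive⁻¹ ⅓) 1 (λ { (suc n) _ → ℚ.<-≤-trans (toWitness {a? = ⅓ ℚ.<? ½} _) (partial-κ-1 n) })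
    ; cos-hi = pos (½ ℚ.* ⅓) (½ε>0 (ℚ.positive⁻¹ ⅓)) 2 (λ { (suc zero) (ℕ.s≤s ()) ; (suc (suc n)) _ →
        ℚ.<-≤-trans (½ε<ε (ℚ.positive⁻¹ ⅓)) (ℚ.neg-antimono-≤ (partial-κ-2 n)) }) }

  opaque
    -- At the points p < q that cut the bracket in thirds cosine is strictly larger at p. So it is
    -- positive at p and [p, hi] is kept, or negative at q and [lo, q] is kept; either is two thirds
    -- of the bracket.
    refine : ∀ B → Refinement B
    refine B = choose (Pos-split {cos (fromℚ p)} {cos (fromℚ q)}
        (cos-decreasing (ℚ.≤-trans 0≤1 (ℚ.≤-trans (1≤lo B) (ℚ.<⇒≤ lo<p))) p<q (ℚ.≤-trans (ℚ.<⇒≤ q<hi) (hi≤2 B))))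
      where
      p q : ℚ
      p = lo B ℚ.+ ⅓ ℚ.* width B
      q = lo B ℚ.+ ⅔ ℚ.* width B
      ⅓w>0 : 0ℚ ℚ.< ⅓ ℚ.* width B
      ⅓w>0 = 0<* (ℚ.positive⁻¹ ⅓) (<⇒0<- (lo<hi B))
      lo<p : lo B ℚ.< p
      lo<p = <-by (⅓ ℚ.* width B) ⅓w>0 refl
      p<q : p ℚ.< q
      p<q = <-by (⅓ ℚ.* width B) ⅓w>0
        (solve 2 (λ a w → a :+ con ⅔ :* w := (a :+ con ⅓ :* w) :+ con ⅓ :* w) refl (lo B) (width B))
      q<hi : q ℚ.< hi B
      q<hi = <-by (⅓ ℚ.* width B) ⅓w>0
        (solve 2 (λ a b → b := (a :+ con ⅔ :* (b :- a)) :+ con ⅓ :* (b :- a)) refl (lo B) (hi B))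
      choose : Pos (cos (fromℚ p)) ⊎ Pos (- cos (fromℚ q)) → Refinement B
      choose (inj₁ cos-p) = record
        { refined  = record
          { lo = p ; hi = hi B ; 1≤lo = ℚ.≤-trans (1≤lo B) (ℚ.<⇒≤ lo<p) ; lo<hi = ℚ.<-trans p<q q<hi
          ; hi≤2 = hi≤2 B ; cos-lo = cos-p ; cos-hi = cos-hi B }
        ; refined⊑ = ℚ.<⇒≤ lo<p , ℚ.≤-refl
        ; shrunk   = solve 2 (λ a b → b :- (a :+ con ⅓ :* (b :- a)) := con ⅔ :* (b :- a)) refl (lo B) (hi B) }
      choose (inj₂ cos-q) = record
        { refined  = record
          { lo = lo B ; hi = q ; 1≤lo = 1≤lo B ; lo<hi = ℚ.<-trans lo<p p<q
          ; hi≤2 = ℚ.≤-trans (ℚ.<⇒≤ q<hi) (hi≤2 B) ; cos-lo = cos-lo B ; cos-hi = cos-q }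
        ; refined⊑ = ℚ.≤-refl , ℚ.<⇒≤ q<hi
        ; shrunk   = solve 2 (λ a w → (a :+ con ⅔ :* w) :- a := con ⅔ :* w) refl (lo B) (width B) }

  bracket : ℕ → Bracket
  bracket zero    = initial
  bracket (suc n) = refined (refine (bracket n))

  bracket-⊑ : ∀ {m n} → m ℕ.≤′ n → bracket n ⊑ bracket m
  bracket-⊑ ℕ.≤′-refl = ⊑-refl
  bracket-⊑ {m} (ℕ.≤′-step {n} m≤n) = ⊑-trans (refined⊑ (refine (bracket n))) (bracket-⊑ m≤n)

  width≥0 : ∀ B → 0ℚ ℚ.≤ width B
  width≥0 B = ℚ.<⇒≤ (<⇒0<- (lo<hi B))

  width-Null : Null (λ n → width (bracket n))
  width-Null = geometric-Null (λ n → width (bracket n)) (λ n → width≥0 (bracket n)) (λ n → ℚ.≤-reflexive (shrunk (refine (bracket n))))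

  ⊑-close : ∀ {B C D} → C ⊑ B → D ⊑ B → ∣ lo C ℚ.- lo D ∣ ℚ.≤ width B
  ⊑-close {B} {C} {D} (bc , cb) (bd , db) = ∣∣≤ (half {C} {D} cb bd)
    (ℚ.≤-trans (ℚ.≤-reflexive (solve 2 (λ c d → :- (c :- d) := d :- c) refl (lo C) (lo D))) (half {D} {C} db bc))
    where
    half : ∀ {C D} → hi C ℚ.≤ hi B → lo B ℚ.≤ lo D → lo C ℚ.- lo D ℚ.≤ width B
    half {C} cb bd = ℚ.+-mono-≤ (ℚ.≤-trans (ℚ.<⇒≤ (lo<hi C)) cb) (ℚ.neg-antimono-≤ bd)

  opaque
    half-π-cauchy : IsCauchy (λ n → lo (bracket n))
    half-π-cauchy ε ε>0 =
      let N , h = width-Null ε ε>0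
      in N , λ m n m≥ n≥ → ℚ.≤-<-trans
        (⊑-close {bracket N} {bracket m} {bracket n} (bracket-⊑ (ℕ.≤⇒≤′ m≥)) (bracket-⊑ (ℕ.≤⇒≤′ n≥)))
        (ℚ.≤-<-trans (p≤∣p∣ (width (bracket N))) (h N ℕ.≤-refl))

  half-π : ℝ
  half-π = mkℝ (λ n → lo (bracket n)) half-π-cauchy

  half-π-≤2 : ∀ n → seq half-π n ℚ.≤ 2ℚ
  half-π-≤2 n = ℚ.≤-trans (ℚ.<⇒≤ (lo<hi (bracket n))) (hi≤2 (bracket n))

  half-π-pos : Pos half-π
  half-π-pos = pos ½ (ℚ.positive⁻¹ ½) 0 (λ n _ → ℚ.<-≤-trans (toWitness {a? = ½ ℚ.<? 1ℚ} _) (1≤lo (bracket n)))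

  ∣∣-lo : ∀ B → ∣ lo B ∣ ℚ.≤ 2ℚ
  ∣∣-lo B = ∣∣≤ (ℚ.≤-trans (ℚ.<⇒≤ (lo<hi B)) (hi≤2 B))
    (ℚ.≤-trans (ℚ.neg-antimono-≤ (ℚ.≤-trans 0≤1 (1≤lo B))) (ℚ.nonNegative⁻¹ 2ℚ))

  ∣∣-hi : ∀ B → ∣ hi B ∣ ℚ.≤ 2ℚ
  ∣∣-hi B = ∣∣≤ (hi≤2 B)
    (ℚ.≤-trans (ℚ.neg-antimono-≤ (ℚ.≤-trans 0≤1 (ℚ.≤-trans (1≤lo B) (ℚ.<⇒≤ (lo<hi B))))) (ℚ.nonNegative⁻¹ 2ℚ))

  opposite-signs : ∀ {a b} → 0ℚ ℚ.≤ a → 0ℚ ℚ.≤ ℚ.- b → ∣ a ∣ ℚ.≤ ∣ a ℚ.- b ∣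
  opposite-signs {a} {b} a≥0 -b≥0 = ℚ.≤-trans (ℚ.≤-reflexive (ℚ.0≤p⇒∣p∣≡p a≥0))
    (ℚ.≤-trans (≤-by (ℚ.- b) -b≥0 refl) (p≤∣p∣ (a ℚ.- b)))

  -- On one bracket B the change of sign bounds the cosine at `lo B` by its change across B, at most
  -- L times the width; moving from `lo B` to a later `lo` costs as much again. B is fixed before n,
  -- because the signs of the truncated sums at its ends are known only beyond an index that depends
  -- on B.
  cos-half-π : cos half-π ≈ 0ℝ
  cos-half-π = wrap λ ε ε>0 →
    let open LipschitzOn (lipschitzOn {2ℚ} (ℚ.nonNegative⁻¹ 2ℚ))
        δ , δ>0 , small = small-factor const≥0 (½ε>0 ε>0)
        k , width<δ     = width-Null δ δ>0
        B               = bracket k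
        Lw<½ε : const ℚ.* width B ℚ.< ½ ℚ.* ε
        Lw<½ε = small (width≥0 B) (ℚ.≤-<-trans (p≤∣p∣ (width B)) (width<δ k ℕ.≤-refl))
        pos α α>0 N₁ h₁ = cos-lo B
        pos β β>0 N₂ h₂ = cos-hi B
    in k ℕ.⊔ (N₁ ℕ.⊔ N₂) , λ n n≥ →
      let P = partial κ (double n)
          near : ∣ P (lo (bracket n)) ℚ.- P (lo B) ∣ ℚ.≤ const ℚ.* width B
          near = ℚ.≤-trans (lipschitz {κ} κ-bounded (∣∣-lo (bracket n)) (∣∣-lo B) (double n))
            (*-monoˡ const const≥0 (⊑-close {B} {bracket n} {B} (bracket-⊑ {k} {n} (ℕ.≤⇒≤′ (⊔≤ˡ {k} n≥))) (⊑-refl {B})))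
          end : ∣ P (lo B) ∣ ℚ.≤ const ℚ.* width B
          end = ℚ.≤-trans (opposite-signs {P (lo B)} {P (hi B)}
              (ℚ.<⇒≤ (ℚ.<-trans α>0 (h₁ n (⊔≤ˡ (⊔≤ʳ k n≥))))) (ℚ.<⇒≤ (ℚ.<-trans β>0 (h₂ n (⊔≤ʳ N₁ (⊔≤ʳ k n≥))))))
            (ℚ.≤-trans (lipschitz {κ} κ-bounded (∣∣-lo B) (∣∣-hi B) (double n))
              (ℚ.≤-reflexive (cong (const ℚ.*_) (trans (∣p-q∣≡∣q-p∣ (lo B) (hi B)) (ℚ.0≤p⇒∣p∣≡p (width≥0 B))))))
      in subst (λ t → ∣ t ∣ ℚ.< ε) (sym (ℚ.+-identityʳ (P (lo (bracket n)))))
        (ℚ.≤-<-trans (∣∣-near {P (lo (bracket n))} {P (lo B)} near)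
          (subst (const ℚ.* width B ℚ.+ ∣ P (lo B) ∣ ℚ.<_) (½+½ ε)
            (ℚ.+-mono-< Lw<½ε (ℚ.≤-<-trans end Lw<½ε))))

  sin-half-π-pos : Pos (sin half-π)
  sin-half-π-pos = sin-pos half-π-pos (0 , λ n _ → half-π-≤2 n)

  sin²-half-π : sin half-π * sin half-π ≈ 1ℝ
  sin²-half-π = begin
    sin half-π * sin half-π
      ≈⟨ pointwise (λ n → solve 1 (λ s → s :* s := con 0ℚ :* con 0ℚ :+ s :* s) refl (seq (sin half-π) n)) ⟩
    0ℝ * 0ℝ + sin half-π * sin half-π
      ≈⟨ +-cong (*-cong (≈-sym cos-half-π) (≈-sym cos-half-π)) ≈-refl ⟩
    cos half-π * cos half-π + sin half-π * sin half-π
      ≈⟨ cos²+sin² half-π ⟩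
    1ℝ ∎
    where open ≈-Reasoning

  π : ℝ
  π = half-π + half-π

  π-pos : Pos π
  π-pos = Pos-+ half-π-pos half-π-pos

  sin-π : sin π ≈ 0ℝ
  sin-π = begin
    sin π
      ≈⟨ sin-+ half-π half-π ⟩
    sin half-π * cos half-π + cos half-π * sin half-π
      ≈⟨ +-cong (*-congˡ (sin half-π) cos-half-π) (*-cong cos-half-π ≈-refl) ⟩
    sin half-π * 0ℝ + 0ℝ * sin half-π
      ≈⟨ pointwise (λ n → solve 1 (λ s → s :* con 0ℚ :+ con 0ℚ :* s := con 0ℚ) refl (seq (sin half-π) n)) ⟩
    0ℝ ∎
    where open ≈-Reasoning

  cos-π : cos π ≈ - 1ℝ
  cos-π = begin
    cos π
      ≈⟨ cos-+ half-π half-π ⟩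
    cos half-π * cos half-π - sin half-π * sin half-π
      ≈⟨ sub-cong (*-cong cos-half-π cos-half-π) sin²-half-π ⟩
    0ℝ * 0ℝ - 1ℝ
      ≈⟨ pointwise (λ _ → refl) ⟩
    - 1ℝ ∎
    where open ≈-Reasoning

  -- sin t = 2 sin (t/2) sin (π/2 - t/2), and both halves lie in (0, 2).  The
  -- factor sin (π/2) is carried along because only its square is known to be 1.
  sin-pos-below-π : ∀ {t} → Pos t → Pos (π - t) → Pos (sin t)
  sin-pos-below-π {t} t>0@(pos ε ε>0 N h) t<π@(pos δ δ>0 M k) = Pos-resp (≈-sym identity)
    (Pos-* sin-half-π-pos (Pos-* (Pos-fromℚ (ℚ.positive⁻¹ 2ℚ)) (Pos-*
      (sin-pos y-pos (M , y-small)) (sin-pos (Pos-resp z-half z-pos) (N , z-small)))))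
    where
    y = fromℚ ½ * t
    z = half-π - y
    y-pos : Pos y
    y-pos = Pos-* (Pos-fromℚ (ℚ.positive⁻¹ ½)) t>0
    z-pos : Pos (fromℚ ½ * (π - t))
    z-pos = Pos-* (Pos-fromℚ (ℚ.positive⁻¹ ½)) t<π
    z-half : fromℚ ½ * (π - t) ≈ z
    z-half = pointwise (λ n → solve 2 (λ h t → con ½ :* (h :+ h :- t) := h :- con ½ :* t) refl (seq half-π n) (seq t n))
    z-small : ∀ n → N ℕ.≤ n → seq z n ℚ.≤ 2ℚ
    z-small n n≥ = ℚ.≤-trans (p-q≤p (ℚ.<⇒≤ (½ε>0 (ℚ.<-trans ε>0 (h n n≥))))) (half-π-≤2 n)
    y-small : ∀ n → M ℕ.≤ n → seq y n ℚ.≤ 2ℚ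
    y-small n n≥ = ℚ.≤-trans (≤-by (½ ℚ.* (seq π n ℚ.- seq t n)) (ℚ.<⇒≤ (½ε>0 (ℚ.<-trans δ>0 (k n n≥))))
      (solve 2 (λ h t → h := con ½ :* t :+ con ½ :* (h :+ h :- t)) refl (seq half-π n) (seq t n))) (half-π-≤2 n)
    H = sin half-π
    open ≈-Reasoning
    sin-z : sin z ≈ H * cos y
    sin-z = begin
      sin z
        ≈⟨ sin-sub half-π y ⟩
      H * cos y - cos half-π * sin y
        ≈⟨ sub-cong ≈-refl (*-cong cos-half-π ≈-refl) ⟩
      H * cos y - 0ℝ * sin y
        ≈⟨ pointwise (λ n → solve 2 (λ a b → a :- con 0ℚ :* b := a) refl (seq H n ℚ.* seq (cos y) n) (seq (sin y) n)) ⟩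
      H * cos y ∎
    identity : sin t ≈ H * (2ℝ * (sin y * sin z))
    identity = begin
      sin t
        ≈⟨ sin-cong (pointwise (λ n → solve 1 (λ t → t := con ½ :* t :+ con ½ :* t) refl (seq t n))) ⟩
      sin (y + y)
        ≈⟨ sin-+ y y ⟩
      sin y * cos y + cos y * sin y
        ≈⟨ pointwise (λ n → solve 2 (λ s c → s :* c :+ c :* s := con 1ℚ :* (con 2ℚ :* (s :* c))) refl (seq (sin y) n) (seq (cos y) n)) ⟩
      1ℝ * (2ℝ * (sin y * cos y))
        ≈⟨ *-cong (≈-sym sin²-half-π) ≈-refl ⟩
      H * H * (2ℝ * (sin y * cos y))
        ≈⟨ pointwise (λ n → solve 3 (λ h s c → h :* h :* (con 2ℚ :* (s :* c)) := h :* (con 2ℚ :* (s :* (h :* c)))) refl (seq H n) (seq (sin y) n) (seq (cos y) n)) ⟩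
      H * (2ℝ * (sin y * (H * cos y)))
        ≈⟨ *-congˡ H (*-congˡ 2ℝ (*-congˡ (sin y) (≈-sym sin-z))) ⟩
      H * (2ℝ * (sin y * sin z)) ∎

  0<⇒Pos : ∀ {x} → 0ℝ < x → Pos x
  0<⇒Pos {x} 0<x = Pos-resp (pointwise (λ n → ℚ.+-identityʳ (seq x n))) (<⇒Pos {0ℝ} {x} 0<x)

  Pos⇒0< : ∀ {x} → Pos x → 0ℝ < x
  Pos⇒0< {x} p = Pos⇒< {0ℝ} {x} (Pos-resp (pointwise (λ n → sym (ℚ.+-identityʳ (seq x n)))) p)

  -- `IsPi` names the limit `0ℝ`, whereas the sine series at π is known to converge to `sin π`,
  -- which agrees with it only up to `_≃_`.
  ⟶-resp : ∀ {f s t} → s ≃ t → f ⟶ s → f ⟶ t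
  ⟶-resp {f} {s} {t} s≃t f→s ε ε>0 =
    let N , h = f→s (½ ℚ.* ε) (½ε>0 ε>0)
        K , k = s≃t (½ ℚ.* ε) (½ε>0 ε>0)
    in N , λ m m≥ →
      let (δ , δ>0 , M , below) , (δ′ , δ′>0 , M′ , above) = h m m≥
      in (δ , δ>0 , M ℕ.⊔ K , λ n n≥ → subst₂ ℚ._<_
            (solve 4 (λ f s t d → ((f :- s) :+ d) :+ (s :- t) := (f :- t) :+ d) refl (seq (f m) n) (seq s n) (seq t n) δ) (½+½ ε)
            (ℚ.+-mono-< (below n (⊔≤ˡ n≥)) (ℚ.≤-<-trans (p≤∣p∣ (seq s n ℚ.- seq t n)) (k n (⊔≤ʳ M n≥))))) ,
         (δ′ , δ′>0 , M′ ℕ.⊔ K , λ n n≥ → subst₂ ℚ._<_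
            (solve 4 (λ f s t d → ((s :- f) :+ d) :+ (:- (s :- t)) := (t :- f) :+ d) refl (seq (f m) n) (seq s n) (seq t n) δ′) (½+½ ε)
            (ℚ.+-mono-< (above n (⊔≤ˡ n≥)) (ℚ.≤-<-trans (-p≤∣p∣ (seq s n ℚ.- seq t n)) (k n (⊔≤ʳ M′ n≥)))))

  IsSin-resp : ∀ {x s t} → s ≈ t → IsSin x s → IsSin x t
  IsSin-resp {x} {s} {t} (wrap s≃t) = ⟶-resp {partialSum (sinTerm x)} {s} {t} s≃t

  π-IsPi : IsPi π
  π-IsPi = record
    { positive = Pos⇒0< π-pos
    ; zero-sin = IsSin-resp sin-π (sin-IsSin π)
    ; smallest = λ t 0<t t<π → sin t , sin-IsSin t , λ s≃0 →
        Pos-≉0 (sin-pos-below-π (0<⇒Pos {t} 0<t) (<⇒Pos {t} {π} t<π)) (wrap s≃0) }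

open Pi

-- Chords, inscribed angles and the regular polygon.

module Circle where
  open import Defs
  open import Data.Rational.Base using (∣_∣)
  import Relation.Binary.Reasoning.Setoid ≈-setoid as ≈-Reasoning

  -- The parameter is half the central angle, so that inscribed angles are differences of
  -- parameters, up to supplement.
  circle : ℝ → Point
  circle x = ⟨ cos (x + x) , sin (x + x) ⟩

  sin-difference : ∀ u v → sin (u + v) - sin (u - v) ≈ 2ℝ * (cos u * sin v)
  sin-difference u v = ≈-trans (sub-cong (sin-+ u v) (sin-sub u v))
    (pointwise (λ n → solve 2 (λ a b → (a :+ b) :- (a :- b) := con 2ℚ :* b) refl
      (seq (sin u) n ℚ.* seq (cos v) n) (seq (cos u) n ℚ.* seq (sin v) n)))

  double-left : ∀ x y → x + x ≈ (x + y) + (x - y)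
  double-left x y = pointwise (λ n → solve 2 (λ x y → x :+ x := (x :+ y) :+ (x :- y)) refl (seq x n) (seq y n))

  double-right : ∀ x y → y + y ≈ (x + y) - (x - y)
  double-right x y = pointwise (λ n → solve 2 (λ x y → y :+ y := (x :+ y) :- (x :- y)) refl (seq x n) (seq y n))

  -- Signed length: `circle x -ᵥ circle y` is `chord x y` times the unit vector (- sin (x + y), cos
  -- (x + y)).
  chord : ℝ → ℝ → ℝ
  chord x y = 2ℝ * sin (x - y)

  chord-xc : ∀ x y → xc (circle x -ᵥ circle y) ≈ chord x y * - sin (x + y)
  chord-xc x y = begin
    cos (x + x) - cos (y + y)
      ≈⟨ sub-cong (cos-cong (double-left x y)) (cos-cong (double-right x y)) ⟩
    cos (u + v) - cos (u - v)
      ≈⟨ pointwise (λ n → solve 2 (λ a b → a :- b := :- (b :- a)) refl (seq (cos (u + v)) n) (seq (cos (u - v)) n)) ⟩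
    - (cos (u - v) - cos (u + v))
      ≈⟨ neg-cong (cos-difference u v) ⟩
    - (2ℝ * (sin u * sin v))
      ≈⟨ pointwise (λ n → solve 2 (λ a b → :- (con 2ℚ :* (a :* b)) := con 2ℚ :* b :* (:- a)) refl (seq (sin u) n) (seq (sin v) n)) ⟩
    2ℝ * sin v * - sin u ∎
    where
    open ≈-Reasoning
    u = x + y
    v = x - y

  chord-yc : ∀ x y → yc (circle x -ᵥ circle y) ≈ chord x y * cos (x + y)
  chord-yc x y = begin
    sin (x + x) - sin (y + y)
      ≈⟨ sub-cong (sin-cong (double-left x y)) (sin-cong (double-right x y)) ⟩
    sin (u + v) - sin (u - v)
      ≈⟨ sin-difference u v ⟩
    2ℝ * (cos u * sin v)
      ≈⟨ pointwise (λ n → solve 2 (λ a b → con 2ℚ :* (a :* b) := con 2ℚ :* b :* a) refl (seq (cos u) n) (seq (sin v) n)) ⟩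
    2ℝ * sin v * cos u ∎
    where
    open ≈-Reasoning
    u = x + y
    v = x - y

  -- The inscribed angle theorem. The chords at y have the directions of x + y and z + y, and the
  -- vertex y cancels in the difference.
  chord-dot : ∀ x y z → (circle x -ᵥ circle y) · (circle z -ᵥ circle y) ≈ chord x y * chord z y * cos (x - z)
  chord-dot x y z = begin
    xc (circle x -ᵥ circle y) * xc (circle z -ᵥ circle y) + yc (circle x -ᵥ circle y) * yc (circle z -ᵥ circle y)
      ≈⟨ +-cong (*-cong (chord-xc x y) (chord-xc z y)) (*-cong (chord-yc x y) (chord-yc z y)) ⟩
    chord x y * - sin (x + y) * (chord z y * - sin (z + y)) + chord x y * cos (x + y) * (chord z y * cos (z + y))
      ≈⟨ pointwise (λ n → solve 6 (λ p q s s′ c c′ → p :* (:- s) :* (q :* (:- s′)) :+ p :* c :* (q :* c′) := p :* q :* (c :* c′ :+ s :* s′)) refl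
           (seq (chord x y) n) (seq (chord z y) n) (seq (sin (x + y)) n) (seq (sin (z + y)) n) (seq (cos (x + y)) n) (seq (cos (z + y)) n)) ⟩
    chord x y * chord z y * (cos (x + y) * cos (z + y) + sin (x + y) * sin (z + y))
      ≈⟨ *-congˡ (chord x y * chord z y) (≈-sym (cos-sub (x + y) (z + y))) ⟩
    chord x y * chord z y * cos ((x + y) - (z + y))
      ≈⟨ *-congˡ (chord x y * chord z y) (cos-cong (pointwise (λ n → solve 3 (λ x y z → (x :+ y) :- (z :+ y) := x :- z) refl (seq x n) (seq y n) (seq z n)))) ⟩
    chord x y * chord z y * cos (x - z) ∎
    where open ≈-Reasoning

  -- A norm is nonnegative while `chord` is signed; the sign is split off as a rational ε of square
  -- 1.
  circle-norm : ∀ x y {ε ρ} → ε ℚ.* ε ≡ 1ℚ → chord x y ≈ fromℚ ε * ρ → Pos ρ → IsNorm (circle x -ᵥ circle y) ρ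
  circle-norm x y {ε} {ρ} ε²≡1 e ρ>0 = Pos⇒≥0 ρ>0 , unwrap (≈-sym (begin
    (circle x -ᵥ circle y) · (circle x -ᵥ circle y)
      ≈⟨ chord-dot x y x ⟩
    chord x y * chord x y * cos (x - x)
      ≈⟨ *-cong (*-cong e e) (≈-trans (cos-cong (pointwise (λ n → ℚ.+-inverseʳ (seq x n)))) cos-0) ⟩
    fromℚ ε * ρ * (fromℚ ε * ρ) * 1ℝ
      ≈⟨ pointwise (λ n → trans (solve 2 (λ e r → e :* r :* (e :* r) :* con 1ℚ := e :* e :* (r :* r)) refl ε (seq ρ n))
           (trans (cong (ℚ._* (seq ρ n ℚ.* seq ρ n)) ε²≡1) (ℚ.*-identityˡ _))) ⟩
    ρ * ρ ∎))
    where open ≈-Reasoning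

  -- ε and δ are the signs of sin (x - y) and sin (z - y).
  inscribed : ∀ x y z {ε δ ρ τ φ} → ε ℚ.* ε ≡ 1ℚ → δ ℚ.* δ ≡ 1ℚ →
    chord x y ≈ fromℚ ε * ρ → Pos ρ → chord z y ≈ fromℚ δ * τ → Pos τ →
    cos (x - z) ≈ fromℚ (ε ℚ.* δ) * cos φ → Pos φ → Pos (π - φ) →
    IsAngle (circle x) (circle y) (circle z) φ
  inscribed x y z {ε} {δ} {ρ} {τ} {φ} ε² δ² eρ ρ>0 eτ τ>0 eφ φ>0 φ<π = record
    { θ>0 = Pos⇒0< φ>0
    ; θ<π = π , π-IsPi , Pos⇒< {φ} {π} φ<π
    ; cosine = ρ , τ , cos φ , circle-norm x y ε² eρ ρ>0 , circle-norm z y δ² eτ τ>0 , cos-IsCos φ , unwrap (begin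
        (circle x -ᵥ circle y) · (circle z -ᵥ circle y)
          ≈⟨ chord-dot x y z ⟩
        chord x y * chord z y * cos (x - z)
          ≈⟨ *-cong (*-cong eρ eτ) eφ ⟩
        fromℚ ε * ρ * (fromℚ δ * τ) * (fromℚ (ε ℚ.* δ) * cos φ)
          ≈⟨ pointwise (λ n → trans
               (solve 5 (λ e d r t c → e :* r :* (d :* t) :* (e :* d :* c) := (e :* e) :* (d :* d) :* (r :* t :* c)) refl
                 ε δ (seq ρ n) (seq τ n) (seq (cos φ) n))
               (trans (cong₂ (λ a b → a ℚ.* b ℚ.* (seq ρ n ℚ.* seq τ n ℚ.* seq (cos φ) n)) ε² δ²) (ℚ.*-identityˡ _))) ⟩
        ρ * τ * cos φ ∎) }
    where open ≈-Reasoning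

  IsAngle-sym : ∀ {x y z φ} → IsAngle x y z φ → IsAngle z y x φ
  IsAngle-sym {x} {y} {z} a = record
    { θ>0 = θ>0 ; θ<π = θ<π
    ; cosine = let ρ , τ , c , nρ , nτ , isCos , dot = cosine in
        τ , ρ , c , nτ , nρ , isCos , unwrap (begin
          (z -ᵥ y) · (x -ᵥ y)
            ≈⟨ +-cong (*-comm (xc (z -ᵥ y)) (xc (x -ᵥ y))) (*-comm (yc (z -ᵥ y)) (yc (x -ᵥ y))) ⟩
          (x -ᵥ y) · (z -ᵥ y)
            ≈⟨ wrap dot ⟩
          ρ * τ * c
            ≈⟨ *-cong (*-comm ρ τ) ≈-refl ⟩
          τ * ρ * c ∎) }
    where
    open IsAngle a
    open ≈-Reasoning

  -- Nonzero with a known sign, which supplies the gap that `Pos-cancel` uses.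
  Apart0 : ℝ → Set
  Apart0 s = Pos s ⊎ Pos (- s)

  Apart0-cancel : ∀ {s t} → Apart0 s → s * t ≈ 0ℝ → t ≈ 0ℝ
  Apart0-cancel (inj₁ s>0) e = Pos-cancel s>0 e
  Apart0-cancel {s} {t} (inj₂ s<0) e = Pos-cancel s<0 (≈-trans
    (pointwise (λ n → solve 2 (λ s t → (:- s) :* t := :- (s :* t)) refl (seq s n) (seq t n)))
    (≈-trans (neg-cong e) (pointwise (λ _ → refl))))

  Apart0-chord : ∀ {x y} → Apart0 (sin (x - y)) → Apart0 (chord x y)
  Apart0-chord (inj₁ s>0) = inj₁ (Pos-* (Pos-fromℚ (ℚ.positive⁻¹ 2ℚ)) s>0)
  Apart0-chord {x} {y} (inj₂ s<0) = inj₂ (Pos-resp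
    (pointwise (λ n → solve 1 (λ s → con 2ℚ :* (:- s) := :- (con 2ℚ :* s)) refl (seq (sin (x - y)) n)))
    (Pos-* (Pos-fromℚ (ℚ.positive⁻¹ 2ℚ)) s<0))

  0*ˡ : ∀ {s} t → s ≈ 0ℝ → s * t ≈ 0ℝ
  0*ˡ t e = ≈-trans (*-cong e ≈-refl) (pointwise (λ n → ℚ.*-zeroˡ (seq t n)))

  ≈⇒-≈0 : ∀ {x y} → x ≈ y → x - y ≈ 0ℝ
  ≈⇒-≈0 {x} {y} e = ≈-trans (sub-cong e ≈-refl) (pointwise (λ n → ℚ.+-inverseʳ (seq y n)))

  -- If the points coincide, the nonzero chord cancels and leaves the direction (- sin (x + y), cos
  -- (x + y)) equal to 0, although it is a unit vector.
  circle-injective : ∀ {x y} → Apart0 (sin (x - y)) → ¬ circle x ≈ₚ circle y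
  circle-injective {x} {y} s≠0 (ex , ey) = Pos-≉0 (Pos-fromℚ (ℚ.positive⁻¹ 1ℚ)) (begin
    1ℝ
      ≈⟨ ≈-sym (cos²+sin² (x + y)) ⟩
    C * C + S * S
      ≈⟨ pointwise (λ n → solve 2 (λ c s → c :* c :+ s :* s := c :* c :- (:- s) :* s) refl (seq C n) (seq S n)) ⟩
    C * C - (- S) * S
      ≈⟨ sub-cong (0*ˡ C C≈0) (0*ˡ S -S≈0) ⟩
    0ℝ - 0ℝ
      ≈⟨ pointwise (λ _ → refl) ⟩
    0ℝ ∎)
    where
    open ≈-Reasoning
    C = cos (x + y)
    S = sin (x + y)
    C≈0 : C ≈ 0ℝ
    C≈0 = Apart0-cancel (Apart0-chord {x} {y} s≠0) (≈-trans (≈-sym (chord-yc x y)) (≈⇒-≈0 (wrap ey)))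
    -S≈0 : - S ≈ 0ℝ
    -S≈0 = Apart0-cancel (Apart0-chord {x} {y} s≠0) (≈-trans (≈-sym (chord-xc x y)) (≈⇒-≈0 (wrap ex)))

  -- A line through two points of the circle is orthogonal to their chord, and
  -- two chords with a common end are not parallel.
  circle-no3l : ∀ {x y z} → Apart0 (sin (x - y)) → Apart0 (sin (z - y)) → Apart0 (sin (x - z)) →
    ¬ Collinear (circle x) (circle y) (circle z)
  circle-no3l {x} {y} {z} xy zy xz (ℓ , onx , ony , onz) =
    Line.nondegenerate ℓ (unwrap (Apart0-cancel xz sin*α) , unwrap (Apart0-cancel xz sin*β))
    where
    open ≈-Reasoning
    α β γ : ℝ
    α = Line.α ℓ
    β = Line.β ℓ
    γ = Line.γ ℓ
    normal : ℝ → ℝ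
    normal x = β * cos (x + y) - α * sin (x + y)
    orthogonal : ∀ x → Apart0 (sin (x - y)) → α * xc (circle x) + β * yc (circle x) ≈ γ → normal x ≈ 0ℝ
    orthogonal x xy on = Apart0-cancel (Apart0-chord {x} {y} xy) (begin
      chord x y * normal x
        ≈⟨ pointwise (λ n → solve 5 (λ k a b s c → k :* (b :* c :- a :* s) := a :* (k :* (:- s)) :+ b :* (k :* c)) refl
             (seq (chord x y) n) (seq α n) (seq β n) (seq (sin (x + y)) n) (seq (cos (x + y)) n)) ⟩
      α * (chord x y * - sin (x + y)) + β * (chord x y * cos (x + y))
        ≈⟨ +-cong (*-congˡ α (≈-sym (chord-xc x y))) (*-congˡ β (≈-sym (chord-yc x y))) ⟩
      α * (xc (circle x) - xc (circle y)) + β * (yc (circle x) - yc (circle y))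
        ≈⟨ pointwise (λ n → solve 6 (λ a b p p′ q q′ → a :* (p :- p′) :+ b :* (q :- q′) := (a :* p :+ b :* q) :- (a :* p′ :+ b :* q′)) refl
             (seq α n) (seq β n) (seq (xc (circle x)) n) (seq (xc (circle y)) n) (seq (yc (circle x)) n) (seq (yc (circle y)) n)) ⟩
      (α * xc (circle x) + β * yc (circle x)) - (α * xc (circle y) + β * yc (circle y))
        ≈⟨ ≈⇒-≈0 (≈-trans on (≈-sym (wrap {x = α * xc (circle y) + β * yc (circle y)} {γ} ony))) ⟩
      0ℝ ∎)
    nx : normal x ≈ 0ℝ
    nx = orthogonal x xy (wrap onx)
    nz : normal z ≈ 0ℝ
    nz = orthogonal z zy (wrap onz)
    s s′ c c′ : ℝ
    s = sin (x + y)
    s′ = sin (z + y)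
    c = cos (x + y)
    c′ = cos (z + y)
    -- Up to sign this is the determinant of the linear system `normal x` = `normal z` = 0 in α and
    -- β; `sin*α` and `sin*β` are Cramer's rule.
    sin-xz : sin (x - z) ≈ s * c′ - c * s′
    sin-xz = ≈-trans (sin-cong (pointwise (λ n → solve 3 (λ x y z → x :- z := (x :+ y) :- (z :+ y)) refl (seq x n) (seq y n) (seq z n))))
      (sin-sub (x + y) (z + y))
    vanish : ∀ a b → normal z * a - normal x * b ≈ 0ℝ
    vanish a b = ≈-trans (sub-cong (0*ˡ a nz) (0*ˡ b nx)) (pointwise (λ _ → refl))
    sin*α : sin (x - z) * α ≈ 0ℝ
    sin*α = ≈-trans (*-cong sin-xz ≈-refl) (≈-trans
      (pointwise (λ n → solve 6 (λ a b s s′ c c′ → (s :* c′ :- c :* s′) :* a := (b :* c′ :- a :* s′) :* c :- (b :* c :- a :* s) :* c′) refl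
        (seq α n) (seq β n) (seq s n) (seq s′ n) (seq c n) (seq c′ n)))
      (vanish c c′))
    sin*β : sin (x - z) * β ≈ 0ℝ
    sin*β = ≈-trans (*-cong sin-xz ≈-refl) (≈-trans
      (pointwise (λ n → solve 6 (λ a b s s′ c c′ → (s :* c′ :- c :* s′) :* b := (b :* c′ :- a :* s′) :* s :- (b :* c :- a :* s) :* s′) refl
        (seq α n) (seq β n) (seq s n) (seq s′ n) (seq c n) (seq c′ n)))
      (vanish s s′))

  module Polygon (n-1 : ℕ) where

    -- With n = `suc n-1`, `rec n-1` is 1/n, so this is j π/n: half the central angle of vertex j,
    -- and for 0 < j < n the candidate values of the inscribed angles.
    θ : ℕ → ℝ
    θ j = fromℚ (natℚ j ℚ.* rec n-1) * π

    θ-+ : ∀ a b → θ (a ℕ.+ b) ≈ θ a + θ b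
    θ-+ a b = pointwise (λ n → trans (cong (λ t → t ℚ.* rec n-1 ℚ.* seq π n) (natℚ-+ a b))
      (solve 4 (λ a b r p → (a :+ b) :* r :* p := a :* r :* p :+ b :* r :* p) refl (natℚ a) (natℚ b) (rec n-1) (seq π n)))

    θ-∸ : ∀ {a b} → a ℕ.≤ b → θ (b ℕ.∸ a) ≈ θ b - θ a
    θ-∸ {a} {b} a≤b = begin
      θ (b ℕ.∸ a)
        ≈⟨ pointwise (λ n → solve 2 (λ c a → c := (c :+ a) :- a) refl (seq (θ (b ℕ.∸ a)) n) (seq (θ a) n)) ⟩
      (θ (b ℕ.∸ a) + θ a) - θ a
        ≈⟨ sub-cong (≈-sym (θ-+ (b ℕ.∸ a) a)) ≈-refl ⟩
      θ (b ℕ.∸ a ℕ.+ a) - θ a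
        ≡⟨ cong (λ t → θ t - θ a) (ℕ.m∸n+n≡m a≤b) ⟩
      θ b - θ a ∎
      where open ≈-Reasoning

    θ-n : θ (suc n-1) ≈ π
    θ-n = pointwise (λ n → trans (cong (ℚ._* seq π n) (rec-inverse n-1)) (ℚ.*-identityˡ (seq π n)))

    θ-pos : ∀ {j} → 0 ℕ.< j → Pos (θ j)
    θ-pos {suc j} _ = Pos-* (Pos-fromℚ (0<* (natℚ->0 j) (rec->0 n-1))) π-pos

    θ-mono : ∀ {i j} → i ℕ.< j → Pos (θ j - θ i)
    θ-mono i<j = Pos-resp (θ-∸ (ℕ.<⇒≤ i<j)) (θ-pos (ℕ.m<n⇒0<n∸m i<j))

    θ<π : ∀ {j} → j ℕ.< suc n-1 → Pos (π - θ j)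
    θ<π j<n = Pos-resp (sub-cong θ-n ≈-refl) (θ-mono j<n)

    θ-injective : ∀ {i j} → θ i ≃ θ j → i ≡ j
    θ-injective {i} {j} e with ℕ.<-cmp i j
    ... | tri< i<j _ _ = contradiction (wrap e) (λ e → Pos-≉0 (θ-mono i<j) (≈⇒-≈0 (≈-sym e)))
    ... | tri≈ _ i≡j _ = i≡j
    ... | tri> _ _ j<i = contradiction (wrap e) (λ e → Pos-≉0 (θ-mono j<i) (≈⇒-≈0 e))

    sin-θ-pos : ∀ {j} → 0 ℕ.< j → j ℕ.< suc n-1 → Pos (sin (θ j))
    sin-θ-pos j>0 j<n = sin-pos-below-π (θ-pos j>0) (θ<π j<n)

    chordLength : ℕ → ℝ
    chordLength j = 2ℝ * sin (θ j)

    chordLength-pos : ∀ {j} → 0 ℕ.< j → j ℕ.< suc n-1 → Pos (chordLength j)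
    chordLength-pos j>0 j<n = Pos-* (Pos-fromℚ (ℚ.positive⁻¹ 2ℚ)) (sin-θ-pos j>0 j<n)

    chord-≥ : ∀ {a b} → b ℕ.≤ a → chord (θ a) (θ b) ≈ fromℚ 1ℚ * chordLength (a ℕ.∸ b)
    chord-≥ {a} {b} b≤a = ≈-trans (*-congˡ 2ℝ (sin-cong (≈-sym (θ-∸ b≤a))))
      (pointwise (λ n → sym (ℚ.*-identityˡ (seq (chordLength (a ℕ.∸ b)) n))))

    chord-≤ : ∀ {a b} → a ℕ.≤ b → chord (θ a) (θ b) ≈ fromℚ (ℚ.- 1ℚ) * chordLength (b ℕ.∸ a)
    chord-≤ {a} {b} a≤b = begin
      2ℝ * sin (θ a - θ b)
        ≈⟨ *-congˡ 2ℝ (sin-cong (pointwise (λ n → solve 2 (λ a b → a :- b := :- (b :- a)) refl (seq (θ a) n) (seq (θ b) n)))) ⟩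
      2ℝ * sin (- (θ b - θ a))
        ≈⟨ *-congˡ 2ℝ (≈-trans (sin-neg (θ b - θ a)) (neg-cong (sin-cong (≈-sym (θ-∸ a≤b))))) ⟩
      2ℝ * - sin (θ (b ℕ.∸ a))
        ≈⟨ pointwise (λ n → solve 1 (λ s → con 2ℚ :* (:- s) := con (ℚ.- 1ℚ) :* (con 2ℚ :* s)) refl (seq (sin (θ (b ℕ.∸ a))) n)) ⟩
      fromℚ (ℚ.- 1ℚ) * chordLength (b ℕ.∸ a) ∎
      where open ≈-Reasoning

    cos-θ-∸ : ∀ {a c} → a ℕ.≤ c → cos (θ a - θ c) ≈ cos (θ (c ℕ.∸ a))
    cos-θ-∸ {a} {c} a≤c = begin
      cos (θ a - θ c)
        ≈⟨ cos-cong (pointwise (λ n → solve 2 (λ a b → a :- b := :- (b :- a)) refl (seq (θ a) n) (seq (θ c) n))) ⟩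
      cos (- (θ c - θ a))
        ≈⟨ cos-neg (θ c - θ a) ⟩
      cos (θ c - θ a)
        ≈⟨ cos-cong (≈-sym (θ-∸ a≤c)) ⟩
      cos (θ (c ℕ.∸ a)) ∎
      where open ≈-Reasoning

    cos-θ-supplement : ∀ {j} → j ℕ.≤ suc n-1 → cos (θ j) ≈ - cos (θ (suc n-1 ℕ.∸ j))
    cos-θ-supplement {j} j≤n = ≈-sym (begin
      - cos (θ (suc n-1 ℕ.∸ j))
        ≈⟨ neg-cong (cos-cong (≈-trans (θ-∸ j≤n) (sub-cong θ-n ≈-refl))) ⟩
      - cos (π - θ j)
        ≈⟨ neg-cong (cos-sub π (θ j)) ⟩
      - (cos π * cos (θ j) + sin π * sin (θ j))
        ≈⟨ neg-cong (+-cong (*-cong cos-π ≈-refl) (*-cong sin-π ≈-refl)) ⟩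
      - (- 1ℝ * cos (θ j) + 0ℝ * sin (θ j))
        ≈⟨ pointwise (λ n → solve 2 (λ c s → :- ((:- con 1ℚ) :* c :+ con 0ℚ :* s) := c) refl (seq (cos (θ j)) n) (seq (sin (θ j)) n)) ⟩
      cos (θ j) ∎)
      where open ≈-Reasoning

    vertex : ℕ → Point
    vertex a = circle (θ a)

    ∸-bounds : ∀ {a b} → a ℕ.< b → b ℕ.< suc n-1 → 0 ℕ.< b ℕ.∸ a × b ℕ.∸ a ℕ.< suc n-1
    ∸-bounds {a} {b} a<b b<n = ℕ.m<n⇒0<n∸m a<b , ℕ.≤-<-trans (ℕ.m∸n≤m b a) b<n

    angle-below : ∀ {a b c} → b ℕ.< a → a ℕ.< c → c ℕ.< suc n-1 → IsAngle (vertex a) (vertex b) (vertex c) (θ (c ℕ.∸ a))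
    angle-below {a} {b} {c} b<a a<c c<n = inscribed (θ a) (θ b) (θ c) {1ℚ} {1ℚ} refl refl
      (chord-≥ (ℕ.<⇒≤ b<a)) (chordLength-pos (proj₁ ab) (proj₂ ab))
      (chord-≥ (ℕ.<⇒≤ b<c)) (chordLength-pos (proj₁ bc) (proj₂ bc))
      (≈-trans (cos-θ-∸ (ℕ.<⇒≤ a<c)) (pointwise (λ n → sym (ℚ.*-identityˡ (seq (cos (θ (c ℕ.∸ a))) n)))))
      (θ-pos (proj₁ ac)) (θ<π (proj₂ ac))
      where
      b<c = ℕ.<-trans b<a a<c
      ab = ∸-bounds b<a (ℕ.<-trans a<c c<n)
      bc = ∸-bounds b<c c<n
      ac = ∸-bounds a<c c<n

    angle-above : ∀ {a b c} → a ℕ.< c → c ℕ.< b → b ℕ.< suc n-1 → IsAngle (vertex a) (vertex b) (vertex c) (θ (c ℕ.∸ a))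
    angle-above {a} {b} {c} a<c c<b b<n = inscribed (θ a) (θ b) (θ c) {ℚ.- 1ℚ} {ℚ.- 1ℚ} refl refl
      (chord-≤ (ℕ.<⇒≤ a<b)) (chordLength-pos (proj₁ ab) (proj₂ ab))
      (chord-≤ (ℕ.<⇒≤ c<b)) (chordLength-pos (proj₁ cb) (proj₂ cb))
      (≈-trans (cos-θ-∸ (ℕ.<⇒≤ a<c)) (pointwise (λ n → sym (ℚ.*-identityˡ (seq (cos (θ (c ℕ.∸ a))) n)))))
      (θ-pos (proj₁ ac)) (θ<π (proj₂ ac))
      where
      a<b = ℕ.<-trans a<c c<b
      ab = ∸-bounds a<b b<n
      cb = ∸-bounds c<b b<n
      ac = ∸-bounds a<c (ℕ.<-trans c<b b<n)

    -- Here b separates a from c, so the two chords have opposite signs. The minus sign that falls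
    -- on the cosine turns the angle into its supplement.
    angle-between : ∀ {a b c} → a ℕ.< b → b ℕ.< c → c ℕ.< suc n-1 →
      IsAngle (vertex a) (vertex b) (vertex c) (θ (suc n-1 ℕ.∸ (c ℕ.∸ a)))
    angle-between {a} {b} {c} a<b b<c c<n = inscribed (θ a) (θ b) (θ c) {ℚ.- 1ℚ} {1ℚ} refl refl
      (chord-≤ (ℕ.<⇒≤ a<b)) (chordLength-pos (proj₁ ab) (proj₂ ab))
      (chord-≥ (ℕ.<⇒≤ b<c)) (chordLength-pos (proj₁ bc) (proj₂ bc))
      (≈-trans (cos-θ-∸ (ℕ.<⇒≤ a<c)) (≈-trans (cos-θ-supplement (ℕ.<⇒≤ (proj₂ ac)))
        (pointwise (λ n → solve 1 (λ x → :- x := con (ℚ.- 1ℚ) :* x) refl (seq (cos (θ (suc n-1 ℕ.∸ (c ℕ.∸ a)))) n)))))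
      (θ-pos (ℕ.m<n⇒0<n∸m (proj₂ ac))) (θ<π (ℕ.∸-monoʳ-< (proj₁ ac) (ℕ.<⇒≤ (proj₂ ac))))
      where
      a<c = ℕ.<-trans a<b b<c
      ab = ∸-bounds a<b (ℕ.<-trans b<c c<n)
      bc = ∸-bounds b<c c<n
      ac = ∸-bounds a<c c<n

    apart : ∀ {a b} → a ℕ.< suc n-1 → b ℕ.< suc n-1 → a ≢ b → Apart0 (sin (θ a - θ b))
    apart {a} {b} a<n b<n a≢b with ℕ.<-cmp a b
    ... | tri≈ _ a≡b _ = contradiction a≡b a≢b
    ... | tri> _ _ b<a = inj₁ (Pos-resp (sin-cong (θ-∸ (ℕ.<⇒≤ b<a)))
            (sin-θ-pos (proj₁ (∸-bounds b<a a<n)) (proj₂ (∸-bounds b<a a<n))))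
    ... | tri< a<b _ _ = inj₂ (Pos-resp
            (≈-trans (sin-cong (θ-∸ (ℕ.<⇒≤ a<b))) (≈-trans
              (sin-cong (pointwise (λ n → solve 2 (λ a b → b :- a := :- (a :- b)) refl (seq (θ a) n) (seq (θ b) n))))
              (sin-neg (θ a - θ b))))
            (sin-θ-pos (proj₁ (∸-bounds a<b b<n)) (proj₂ (∸-bounds a<b b<n))))

    vertex-injective : ∀ {a b} → a ℕ.< suc n-1 → b ℕ.< suc n-1 → vertex a ≈ₚ vertex b → a ≡ b
    vertex-injective {a} {b} a<n b<n e with a ℕ.≟ b
    ... | yes a≡b = a≡b
    ... | no  a≢b = contradiction e (circle-injective (apart a<n b<n a≢b))

    vertex-no3l : ∀ {a b c} → a ℕ.< suc n-1 → b ℕ.< suc n-1 → c ℕ.< suc n-1 → a ≢ b → b ≢ c → a ≢ c →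
      ¬ Collinear (vertex a) (vertex b) (vertex c)
    vertex-no3l a<n b<n c<n a≢b b≢c a≢c =
      circle-no3l (apart a<n b<n a≢b) (apart c<n b<n (λ e → b≢c (sym e))) (apart a<n c<n a≢c)

open Circle

open import Defs using (Configuration; HasDistinctAngles; Attainable; Label; Rainbow; IsAngle)
open import Data.Nat.Base using (ℕ; _+_; _∸_; _⊔_; _≤_)
open import Data.Nat.Base using (pred; _<_; s≤s; ∣_-_∣; >-nonZero)
open import Data.Nat.Properties using (+-0-commutativeMonoid)
open import Data.Fin.Base as Fin using (Fin; fromℕ)
open import Data.Fin.Base using (toℕ; zero; suc)
import Data.Fin.Properties as Fin
open import Data.List.Base using (List; _∷_; applyUpTo; filter; length; lookup)
import Data.List.Properties as List
open import Data.List.Membership.Propositional using (_∈_)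
open import Data.List.Membership.Propositional.Properties using (∈-filter⁺; ∈-filter⁻; ∈-lookup; ∈-applyUpTo⁺)
import Data.List.Relation.Unary.All as All
open import Data.List.Relation.Unary.Any using (index)
open import Data.List.Relation.Unary.Any.Properties using (lookup-index)
open import Data.List.Relation.Unary.AllPairs using (_∷_)
open import Data.List.Relation.Unary.Unique.Propositional using (Unique)
import Data.List.Relation.Unary.Unique.Propositional.Properties as Unique
open import Algebra.Properties.CommutativeMonoid.Sum +-0-commutativeMonoid using (sum)

-- The index of an inscribed angle.

Between : ℕ → ℕ → ℕ → Set
Between a b c = (a < b × b < c) ⊎ (c < b × b < a)

between? : ∀ a b c → Dec (Between a b c)
between? a b c = (a ℕ.<? b ×-dec b ℕ.<? c) ⊎-dec (c ℕ.<? b ×-dec b ℕ.<? a)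

Between-sym : ∀ {a b c} → Between a b c → Between c b a
Between-sym (inj₁ p) = inj₂ p
Between-sym (inj₂ p) = inj₁ p

-- In the regular n-gon the angle with vertex b and sides through a and c is
-- inscribedIndex n a b c times π/n.
inscribedIndex : ℕ → ℕ → ℕ → ℕ → ℕ
inscribedIndex n a b c with between? a b c
... | yes _ = n ∸ ∣ a - c ∣
... | no  _ = ∣ a - c ∣

inscribedIndex-yes : ∀ n {a b c} → Between a b c → inscribedIndex n a b c ≡ n ∸ ∣ a - c ∣
inscribedIndex-yes n {a} {b} {c} p with between? a b c
... | yes _ = refl
... | no ¬p = contradiction p ¬p

inscribedIndex-no : ∀ n {a b c} → ¬ Between a b c → inscribedIndex n a b c ≡ ∣ a - c ∣
inscribedIndex-no n {a} {b} {c} ¬p with between? a b c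
... | yes p = contradiction p ¬p
... | no  _ = refl

inscribedIndex-sym : ∀ n a b c → inscribedIndex n a b c ≡ inscribedIndex n c b a
inscribedIndex-sym n a b c with between? a b c
... | yes p = trans (cong (n ∸_) (ℕ.∣-∣-comm a c)) (sym (inscribedIndex-yes n (Between-sym p)))
... | no ¬p = trans (ℕ.∣-∣-comm a c) (sym (inscribedIndex-no n (¬p ∘ Between-sym)))

-- Cases for a < c only; exchanging the two sides of the angle covers c < a.
data Order (a b c : ℕ) : Set where
  below   : b < a → a < c → Order a b c
  between : a < b → b < c → Order a b c
  above   : a < c → c < b → Order a b c

order : ∀ {a b c} → a < c → a ≢ b → b ≢ c → Order a b c
order {a} {b} {c} a<c a≢b b≢c with ℕ.<-cmp a b | ℕ.<-cmp b c
... | tri> _ _ b<a | _            = below b<a a<c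
... | tri≈ _ a≡b _ | _            = contradiction a≡b a≢b
... | tri< a<b _ _ | tri< b<c _ _ = between a<b b<c
... | tri< a<b _ _ | tri≈ _ b≡c _ = contradiction b≡c b≢c
... | tri< a<b _ _ | tri> _ _ c<b = above a<c c<b

orderedIndex : ℕ → ∀ {a b c} → Order a b c → ℕ
orderedIndex n {a} {b} {c} (below _ _)   = c ∸ a
orderedIndex n {a} {b} {c} (between _ _) = n ∸ (c ∸ a)
orderedIndex n {a} {b} {c} (above _ _)   = c ∸ a

inscribedIndex-ordered : ∀ n {a b c} (o : Order a b c) → inscribedIndex n a b c ≡ orderedIndex n o
inscribedIndex-ordered n (below b<a a<c) = trans
  (inscribedIndex-no n (λ { (inj₁ (a<b , _)) → ℕ.<-asym a<b b<a ; (inj₂ (c<b , _)) → ℕ.<-asym c<b (ℕ.<-trans b<a a<c) }))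
  (ℕ.m≤n⇒∣m-n∣≡n∸m (ℕ.<⇒≤ a<c))
inscribedIndex-ordered n (between a<b b<c) = trans (inscribedIndex-yes n (inj₁ (a<b , b<c)))
  (cong (n ∸_) (ℕ.m≤n⇒∣m-n∣≡n∸m (ℕ.<⇒≤ (ℕ.<-trans a<b b<c))))
inscribedIndex-ordered n (above a<c c<b) = trans
  (inscribedIndex-no n (λ { (inj₁ (_ , b<c)) → ℕ.<-asym b<c c<b ; (inj₂ (_ , b<a)) → ℕ.<-asym b<a (ℕ.<-trans a<c c<b) }))
  (ℕ.m≤n⇒∣m-n∣≡n∸m (ℕ.<⇒≤ a<c))

module _ (n-1 : ℕ) where
  open Polygon n-1

  ordered-angle : ∀ {a b c} → b < suc n-1 → c < suc n-1 → (o : Order a b c) →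
    IsAngle (vertex a) (vertex b) (vertex c) (θ (orderedIndex (suc n-1) o))
  ordered-angle b<n c<n (below b<a a<c)   = angle-below b<a a<c c<n
  ordered-angle b<n c<n (between a<b b<c) = angle-between a<b b<c c<n
  ordered-angle b<n c<n (above a<c c<b)   = angle-above a<c c<b b<n

  inscribedIndex-angle : ∀ {a b c} → a < suc n-1 → b < suc n-1 → c < suc n-1 → a ≢ b → b ≢ c → a ≢ c →
    IsAngle (vertex a) (vertex b) (vertex c) (θ (inscribedIndex (suc n-1) a b c))
  inscribedIndex-angle {a} {b} {c} a<n b<n c<n a≢b b≢c a≢c with ℕ.<-cmp a c
  ... | tri< a<c _ _ = let o = order a<c a≢b b≢c in
    subst (λ t → IsAngle (vertex a) (vertex b) (vertex c) (θ t)) (sym (inscribedIndex-ordered (suc n-1) o))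
      (ordered-angle b<n c<n o)
  ... | tri≈ _ a≡c _ = contradiction a≡c a≢c
  ... | tri> _ _ c<a = let o = order c<a (b≢c ∘ sym) (a≢b ∘ sym) in
    subst (λ t → IsAngle (vertex a) (vertex b) (vertex c) (θ t))
      (sym (trans (inscribedIndex-sym (suc n-1) a b c) (inscribedIndex-ordered (suc n-1) o)))
      (IsAngle-sym (ordered-angle b<n a<n o))

-- The colour classes are consecutive arcs of the polygon.

offset : ∀ {k} (r : Fin k → ℕ) → Fin k → ℕ
offset r zero    = 0
offset r (suc i) = r zero + offset (r ∘ suc) i

position : ∀ {k} (r : Fin k → ℕ) → Label r → ℕ
position r (i , x) = offset r i + toℕ x

offset-end : ∀ {k} (r : Fin k → ℕ) i → offset r i + r i ≤ sum r
offset-end r zero    = ℕ.m≤m+n (r zero) _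
offset-end r (suc i) = subst (_≤ sum r) (sym (ℕ.+-assoc (r zero) (offset (r ∘ suc) i) (r (suc i))))
  (ℕ.+-monoʳ-≤ (r zero) (offset-end (r ∘ suc) i))

offset-mono : ∀ {k} (r : Fin k → ℕ) {i j} → i Fin.< j → offset r i + r i ≤ offset r j
offset-mono r {zero}  {suc j} i<j       = ℕ.m≤m+n (r zero) _
offset-mono r {suc i} {suc j} (s≤s i<j) = subst (_≤ r zero + offset (r ∘ suc) j) (sym (ℕ.+-assoc (r zero) (offset (r ∘ suc) i) (r (suc i))))
  (ℕ.+-monoʳ-≤ (r zero) (offset-mono (r ∘ suc) i<j))

position-< : ∀ {k} (r : Fin k → ℕ) (a : Label r) → position r a < offset r (proj₁ a) + r (proj₁ a)
position-< r (i , x) = ℕ.+-monoʳ-< (offset r i) (Fin.toℕ<n x)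

position-mono : ∀ {k} (r : Fin k → ℕ) {a b : Label r} → proj₁ a Fin.< proj₁ b → offset r (proj₁ a) + r (proj₁ a) ≤ position r b
position-mono r i<j = ℕ.≤-trans (offset-mono r i<j) (ℕ.m≤m+n _ _)

position-reflects : ∀ {k} (r : Fin k → ℕ) {a b : Label r} → proj₁ a ≢ proj₁ b → position r a < position r b → proj₁ a Fin.< proj₁ b
position-reflects r {a} {b} a≢b a<b with Fin.<-cmp (proj₁ a) (proj₁ b)
... | tri< i<j _ _ = i<j
... | tri≈ _ i≡j _ = contradiction i≡j a≢b
... | tri> _ _ j<i = contradiction a<b (ℕ.<-asym (ℕ.<-≤-trans (position-< r b) (position-mono r {b} {a} j<i)))

position-injective : ∀ {k} (r : Fin k → ℕ) {a b : Label r} → position r a ≡ position r b → a ≡ b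
position-injective r {i , x} {j , y} e with Fin.<-cmp i j
... | tri< i<j _ _  = contradiction e (ℕ.<⇒≢ (ℕ.<-≤-trans (position-< r (i , x)) (position-mono r {i , x} {j , y} i<j)))
... | tri≈ _ refl _ = cong (i ,_) (Fin.toℕ-injective (ℕ.+-cancelˡ-≡ (offset r i) (toℕ x) (toℕ y) e))
... | tri> _ _ j<i  = contradiction (sym e) (ℕ.<⇒≢ (ℕ.<-≤-trans (position-< r (j , y)) (position-mono r {j , y} {i , x} j<i)))

-- Rainbow angles of the coloured polygon and their number.

Rainbow-sym : ∀ {k} {r : Fin k → ℕ} a b c → Rainbow {r = r} a b c → Rainbow {r = r} c b a
Rainbow-sym a b c (a≢b , b≢c , a≢c) = b≢c ∘ sym , a≢b ∘ sym , a≢c ∘ sym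

-- `s` becomes rₖ, the least class size: the colour of the middle point b is arbitrary, so its class
-- contributes at least that many points.
module Arcs {k} (r : Fin k → ℕ) {s : ℕ} (s≤r : ∀ i → s ≤ r i) where

  n = sum r

  position<n : ∀ a → position r a < n
  position<n a = ℕ.<-≤-trans (position-< r a) (offset-end r (proj₁ a))

  position-≢ : ∀ {a b : Label r} → proj₁ a ≢ proj₁ b → position r a ≢ position r b
  position-≢ a≢b e = a≢b (cong proj₁ (position-injective r e))

  -- The arc of b lies strictly between a and c, or outside [a, c], and it has
  -- at least s points.
  ordered-bounds : ∀ a b c → Rainbow {r = r} a b c → (o : Order (position r a) (position r b) (position r c)) →
    0 < orderedIndex n o × orderedIndex n o ≤ n ∸ suc s
  ordered-bounds a b c (a≢b , b≢c , a≢c) (below b<a a<c) =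
    -- The extra 1 in `suc s` comes here from c ≤ n - 1. In the two other cases it is the point a,
    -- respectively c, which precedes the arc of b.
    ℕ.m<n⇒0<n∸m a<c , ℕ.≤-trans (ℕ.∸-mono (ℕ.<⇒≤pred (position<n c)) s≤a) (ℕ.≤-reflexive (trans (cong (_∸ s) (ℕ.pred[m∸n]≡m∸[1+n] n 0)) (ℕ.∸-+-assoc n 1 s)))
    where
    s≤a : s ≤ position r a
    s≤a = ℕ.≤-trans (s≤r (proj₁ b)) (ℕ.≤-trans (ℕ.m≤n+m (r (proj₁ b)) (offset r (proj₁ b)))
      (position-mono r {b} {a} (position-reflects r {b} {a} (a≢b ∘ sym) b<a)))
  ordered-bounds a b c (a≢b , b≢c , a≢c) (between a<b b<c) =
    ℕ.m<n⇒0<n∸m (ℕ.≤-<-trans (ℕ.m∸n≤m (position r c) (position r a)) (position<n c)) ,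
    ℕ.∸-monoʳ-≤ n (ℕ.m+n≤o⇒m≤o∸n (suc s) (ℕ.≤-trans (ℕ.≤-reflexive (cong suc (ℕ.+-comm s (position r a)))) (ℕ.≤-trans
      (ℕ.+-mono-≤ (ℕ.<-≤-trans (position-< r a) (offset-mono r (position-reflects r {a} {b} a≢b a<b))) (s≤r (proj₁ b)))
      (position-mono r {b} {c} (position-reflects r {b} {c} b≢c b<c)))))
  ordered-bounds a b c (a≢b , b≢c , a≢c) (above a<c c<b) =
    ℕ.m<n⇒0<n∸m a<c , ℕ.≤-trans (ℕ.m∸n≤m (position r c) (position r a))
      (ℕ.m+n≤o⇒m≤o∸n (position r c) (ℕ.≤-trans (ℕ.≤-reflexive (ℕ.+-suc (position r c) s)) (ℕ.≤-trans
        (ℕ.+-mono-≤ (ℕ.<-≤-trans (position-< r c) (offset-mono r (position-reflects r {c} {b} (b≢c ∘ sym) c<b))) (s≤r (proj₁ b)))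
        (offset-end r (proj₁ b)))))

  labelIndex : Label r → Label r → Label r → ℕ
  labelIndex a b c = inscribedIndex n (position r a) (position r b) (position r c)

  labelIndex-bounds : ∀ a b c → Rainbow {r = r} a b c → 0 < labelIndex a b c × labelIndex a b c ≤ n ∸ suc s
  labelIndex-bounds a b c ρ@(a≢b , b≢c , a≢c) with ℕ.<-cmp (position r a) (position r c)
  ... | tri< a<c _ _ = let o = order a<c (position-≢ {a} {b} a≢b) (position-≢ {b} {c} b≢c) in
    subst (λ t → 0 < t × t ≤ n ∸ suc s) (sym (inscribedIndex-ordered n o)) (ordered-bounds a b c ρ o)
  ... | tri≈ _ a≡c _ = contradiction a≡c (position-≢ {a} {c} a≢c)
  ... | tri> _ _ c<a = let o = order c<a (position-≢ {c} {b} (b≢c ∘ sym)) (position-≢ {b} {a} (a≢b ∘ sym)) in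
    subst (λ t → 0 < t × t ≤ n ∸ suc s)
      (sym (trans (inscribedIndex-sym n (position r a) (position r b) (position r c)) (inscribedIndex-ordered n o)))
      (ordered-bounds c b a (Rainbow-sym {r = r} a b c ρ) o)

  Realised : ℕ → Set
  Realised j = ∃[ a ] ∃[ b ] ∃[ c ] (Rainbow {r = r} a b c × labelIndex a b c ≡ j)

  anyLabel? : ∀ {P : Label r → Set} → (∀ a → Dec (P a)) → Dec (∃ P)
  anyLabel? P? = map′ (λ { (i , x , p) → (i , x) , p }) (λ { ((i , x) , p) → i , x , p })
    (Fin.any? (λ i → Fin.any? (λ x → P? (i , x))))

  rainbow? : ∀ a b c → Dec (Rainbow {r = r} a b c)
  rainbow? a b c = ¬? (proj₁ a Fin.≟ proj₁ b) ×-dec ¬? (proj₁ b Fin.≟ proj₁ c) ×-dec ¬? (proj₁ a Fin.≟ proj₁ c)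

  realised? : ∀ j → Dec (Realised j)
  realised? j = anyLabel? λ a → anyLabel? λ b → anyLabel? λ c → rainbow? a b c ×-dec labelIndex a b c ℕ.≟ j

  -- Not every index in the range need occur, yet the values have to be enumerated exactly. Labels
  -- form a finite type, so occurrence is decidable and the range can be filtered.
  indices : List ℕ
  indices = filter realised? (applyUpTo suc (n ∸ suc s))

  indices-unique : Unique indices
  indices-unique = Unique.filter⁺ realised? (Unique.applyUpTo⁺₁ suc (n ∸ suc s) (λ i<j _ e → ℕ.<⇒≢ i<j (ℕ.suc-injective e)))

  indices-length : length indices ≤ n ∸ suc s
  indices-length = subst (length indices ≤_) (List.length-applyUpTo suc (n ∸ suc s))
    (List.length-filter realised? (applyUpTo suc (n ∸ suc s)))

  labelIndex-∈ : ∀ a b c → Rainbow {r = r} a b c → labelIndex a b c ∈ indices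
  labelIndex-∈ a b c ρ = ∈-filter⁺ realised? (in-range (proj₁ (labelIndex-bounds a b c ρ)) (proj₂ (labelIndex-bounds a b c ρ)))
    (a , b , c , ρ , refl)
    where
    in-range : ∀ {j M} → 0 < j → j ≤ M → j ∈ applyUpTo suc M
    in-range {suc j} _ j<M = ∈-applyUpTo⁺ suc j<M

  -- `sum r` does not compute to a successor, while `Polygon` expects n - 1; the equation `n≡`
  -- transports between the two.
  module Colouring (n-1 : ℕ) (n≡ : n ≡ suc n-1) where
    open Polygon n-1

    position<suc : ∀ a → position r a < suc n-1
    position<suc a = subst (position r a <_) n≡ (position<n a)

    configuration : Configuration r
    configuration = record
      { point     = vertex ∘ position r
      ; injective = λ {a} {b} e → position-injective r (vertex-injective (position<suc a) (position<suc b) e)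
      ; no3l      = λ a b c a≢b b≢c a≢c → vertex-no3l (position<suc a) (position<suc b) (position<suc c)
          (a≢b ∘ position-injective r) (b≢c ∘ position-injective r) (a≢c ∘ position-injective r) }

    labelIndex-angle : ∀ a b c → Rainbow {r = r} a b c →
      IsAngle (vertex (position r a)) (vertex (position r b)) (vertex (position r c)) (θ (labelIndex a b c))
    labelIndex-angle a b c (a≢b , b≢c , a≢c) =
      subst (λ t → IsAngle (vertex (position r a)) (vertex (position r b)) (vertex (position r c))
                     (θ (inscribedIndex t (position r a) (position r b) (position r c)))) (sym n≡)
        (inscribedIndex-angle n-1 (position<suc a) (position<suc b) (position<suc c)
          (position-≢ {a} {b} a≢b) (position-≢ {b} {c} b≢c) (position-≢ {a} {c} a≢c))

    hasDistinctAngles : HasDistinctAngles configuration (length indices)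
    hasDistinctAngles = record
      { value      = θ ∘ lookup indices
      ; distinct   = λ e → lookup-injective indices-unique (θ-injective e)
      ; realised   = λ i → let a , b , c , ρ , e = proj₂ (∈-filter⁻ realised? {xs = applyUpTo suc (n ∸ suc s)} (∈-lookup i)) in
          a , b , c , ρ , subst (λ t → IsAngle (vertex (position r a)) (vertex (position r b)) (vertex (position r c)) (θ t)) e
            (labelIndex-angle a b c ρ)
      ; exhaustive = λ a b c ρ → index (labelIndex-∈ a b c ρ) ,
          subst (λ t → IsAngle (vertex (position r a)) (vertex (position r b)) (vertex (position r c)) (θ t))
            (lookup-index (labelIndex-∈ a b c ρ)) (labelIndex-angle a b c ρ) }
      where
      lookup-injective : ∀ {xs : List ℕ} → Unique xs → ∀ {i j} → lookup xs i ≡ lookup xs j → i ≡ j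
      lookup-injective (_ ∷ _)  {zero}  {zero}  e = refl
      lookup-injective (x ∷ _)  {zero}  {suc j} e = contradiction e (All.lookup x (∈-lookup j))
      lookup-injective (x ∷ _)  {suc i} {zero}  e = contradiction (sym e) (All.lookup x (∈-lookup i))
      lookup-injective (_ ∷ xs) {suc i} {suc j} e = cong suc (lookup-injective xs e)

lemma5p9 : ∀ (m : ℕ) → let k = 3 + m in
    (r : Fin k → ℕ) →
    (∀ i j → i Fin.≤ j → r j ≤ r i) →
    let rₖ = r (fromℕ (2 + m)) in
    1 ≤ rₖ →
    let n = sum r in
    Ano3l r ≤ (n ∸ (2 ⊔ (rₖ + 1)))
lemma5p9 m r decreasing 1≤rₖ =
  -- One configuration serves both components: it meets the bound, and no minimum exceeds its number
  -- of angles.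
  (length indices , attainable , bound) , λ a minimum → ℕ.≤-trans (proj₂ minimum (length indices) attainable) bound
  where
  rₖ = r (fromℕ (2 + m))
  open Arcs r {rₖ} (λ i → decreasing i (fromℕ (2 + m)) (Fin.≤fromℕ i))
  0<n : 0 < n
  0<n = ℕ.≤-trans 1≤rₖ (ℕ.≤-trans (ℕ.m≤n+m rₖ _) (offset-end r (fromℕ (2 + m))))
  open Colouring (pred n) (sym (ℕ.suc-pred n {{>-nonZero 0<n}}))
  attainable : Attainable r (length indices)
  attainable = configuration , hasDistinctAngles
  bound : length indices ≤ n ∸ (2 ⊔ (rₖ + 1))
  -- The maximum of 2 and rₖ + 1 is rₖ + 1, because rₖ ≥ 1.
  bound = subst (λ t → length indices ≤ n ∸ t)
    (sym (trans (ℕ.m≤n⇒m⊔n≡n (ℕ.+-monoˡ-≤ 1 1≤rₖ)) (ℕ.+-comm rₖ 1))) indices-length
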